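{- There is an absolute constant $C>0$ such that the following holds. Let $K$ be a real number and let $\mathcal{A}\subset\{0,1\}^n$ be nonempty with $|\mathcal{A}|\le\frac78 2^n$ and $$|\partial_e(\mathcal{A})|\le|\mathcal{A}|\Big(\log_2\big(2^n/|\mathcal{A}|\big)+K\Big).$$ Then $$\max_{i\in[n]}I_i(\mathbf{1}_{\mathcal{A}})\ge 2^{ -C(K+1)^2}\frac{|\mathcal{A}|}{2^n}.$$
   Context: $Q_n$ is the graph on $\{0,1\}^n$ with edges between vertices differing in exactly one coordinate; $\partial_e(\mathcal{A})$ is the set of edges of $Q_n$ with exactly one endpoint in $\mathcal{A}$. $\mathbf{1}_{\mathcal{A}}$ is the indicator function of $\mathcal{A}$. For $f:\{0,1\}^n\to\{0,1\}$ and $i\in[n]$, the influence in direction $i$ is $I_i(f)=|\{x\in\{0,1\}^n: f(x)\ne f(x\oplus e_i)\}|/2^n$, where $x\oplus e_i$ is $x$ with its $i$th coordinate changed.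
   Formalization: The number K ranges over the rationals instead of the reals (and the constant C is given as a rational); the case of real K follows by letting rational K' decrease to K. -}

module Defs where

open import Data.Bool using (Bool; true; false; not; _∧_; _xor_; if_then_else_)
open import Data.Nat as ℕ using (ℕ; zero; suc)
open import Data.Nat.Properties using (m^n≢0)
open import Data.Fin using (Fin)
open import Data.Vec using (Vec; []; _∷_; updateAt; lookup)
open import Data.List using (List; _∷_; []; map; _++_; allFin)
open import Data.Nat.ListAction using (sum)
open import Data.Integer using (ℤ; +_; -[1+_])
open import Data.Rational using (ℚ; ½; 1ℚ; _*_; _≤_; ↥_; ↧ₙ_; _/_)

Cube : ℕ → Set
Cube n = Vec Bool n

cube : (n : ℕ) → List (Cube n)
cube zero    = [] ∷ []
cube (suc n) = map (true ∷_) (cube n) ++ map (false ∷_) (cube n)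

Family : ℕ → Set
Family n = Cube n → Bool

flipAt : {n : ℕ} → Fin n → Cube n → Cube n
flipAt i x = updateAt x i not

count : {n : ℕ} → (Cube n → Bool) → ℕ
count {n} P = sum (map (λ x → if P x then 1 else 0) (cube n))

card : {n : ℕ} → Family n → ℕ
card A = count A

-- |∂_e(𝒜)| : each edge {x, x ⊕ e_i} of Q_n is listed once, via its
-- direction i and its endpoint x with x_i = 0; it is counted when
-- exactly one endpoint lies in 𝒜.
edgeBoundary : {n : ℕ} → Family n → ℕ
edgeBoundary {n} A =
  sum (map (λ i → count (λ x → not (lookup x i) ∧ (A x xor A (flipAt i x)))) (allFin n))

influence : {n : ℕ} → (Cube n → Bool) → Fin n → ℚ
influence {n} f i =
  _/_ (+ count (λ x → f x xor f (flipAt i x))) (2 ℕ.^ n) {{m^n≢0 2 n}}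

density : {n : ℕ} → Family n → ℚ
density {n} A = _/_ (+ card A) (2 ℕ.^ n) {{m^n≢0 2 n}}

_^ℚ_ : ℚ → ℕ → ℚ
q ^ℚ zero  = 1ℚ
q ^ℚ suc k = q * (q ^ℚ k)

pow2ℤ : ℤ → ℚ
pow2ℤ (+ k)      = (+ 2 / 1) ^ℚ k
pow2ℤ -[1+ k ]   = ½ ^ℚ suc k

-- "2^x · b ≤ y" for rational x = p/q (q ≥ 1) and b, y ≥ 0 :
-- since t ↦ t^q is strictly increasing on [0,∞), this is equivalent to
-- 2^p · b^q ≤ y^q.
2^[_]·_≤_ : ℚ → ℚ → ℚ → Set
2^[ x ]· b ≤ y = pow2ℤ (↥ x) * (b ^ℚ (↧ₙ x)) ≤ y ^ℚ (↧ₙ x)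

_≤log₂_ : ℚ → ℚ → Set
x ≤log₂ y = 2^[ x ]· 1ℚ ≤ y

infix 4 2^[_]·_≤_ _≤log₂_

{-# OPTIONS --safe #-}
-- Write α for the density of A, η i for half the influence in direction i, 2⁻ᵗ ≈ α,
-- and suppose that every η i is at most 2^{-M} α with M a large multiple of K + 1.
--
-- If t = O(K + 1), this contradicts the Kahn–Kalai–Linial theorem.
--
-- If t is larger, fix coordinates greedily as long as the excess of A over the
-- edge-isoperimetric bound, averaged over the fibres, drops by ¼ η i. This stops at a
-- set R of coordinates with Σ_{i∈R} η i = O(K α) such that each i ∉ R is strongly
-- biased on fibres carrying a constant proportion of its influence. Hence a typical
-- fibre has about t biased coordinates, while a given i is biased only on a subset Wᵢ
-- of A of relative size O(2^{-M}). By edge isoperimetry the Wᵢ have average boundary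
-- degree at least t + M. But boundary edges of Wᵢ either leave A, which accounts for
-- only t + O(K) of them because the excess is small, or go in a direction of R between
-- fibres with different biases, and there are few such edges as Σ_{i∈R} η i is small.
-- Summing over i gives M = O(K + 1), a contradiction.
module Submission where

open import Defs
import Data.Bool.Properties as Boolₚ
open import Data.Bool using (Bool; true; false; not; _∧_; _xor_; if_then_else_)
open import Data.Nat as ℕ using (ℕ; zero; suc; _>_)
open import Data.Nat.Base using (>-nonZero)
import Data.Nat.Properties as ℕₚ
open import Data.Fin using (Fin; zero; suc)
import Data.Fin.Properties as Finₚ
open import Data.Product using (Σ; ∃; _×_; _,_; proj₁; proj₂)
open import Data.Sum using (_⊎_; inj₁; inj₂)
open import Data.Empty using (⊥; ⊥-elim)
open import Data.Maybe using (Maybe; just; nothing)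
open import Data.List using (List) renaming ([] to []ₗ; _∷_ to _∷ₗ_)
import Data.List as List
open import Data.Vec using (Vec; []; _∷_; lookup; replicate; _[_]≔_)
import Data.Vec.Properties as Vecₚ
open import Data.Integer using (ℤ; +_; -[1+_])
import Data.Integer as ℤ
open import Data.Rational using (ℚ; 0ℚ; 1ℚ; ½; _<_; _≤_; _+_; _*_; _-_; -_; _/_; _⊓_; _⊔_; ∣_∣; NonNegative; nonNegative; positive; ↥_; ↧ₙ_; 1/_; ≢-nonZero)
open import Data.Rational.Properties hiding (_≟_)
import Data.Rational.Properties as ℚₚ
open import Data.Rational.Unnormalised using (mkℚᵘ; *≡*)
import Data.Rational.Unnormalised as ℚᵘ
import Data.Rational.Unnormalised.Properties as ℚᵘₚ
import Data.Integer.Tactic.RingSolver as ℤSolver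
import Data.Nat.Tactic.RingSolver as ℕSolver
import Data.List.Properties as Listₚ
import Data.Nat.ListAction as ListAction
import Data.Nat.ListAction.Properties as ListActionₚ
open import Function using (_∘_; id)
open import Relation.Nullary using (¬_; Dec; yes; no; does)
open import Relation.Nullary.Decidable using (_×-dec_)
open import Relation.Binary.PropositionalEquality hiding (J)
import Tactic.RingSolver.Core.AlmostCommutativeRing as ACR
open import Tactic.RingSolver using (solve; solve-∀)

-- Rational arithmetic, finite sums and averages over the cube

-- Logarithms are replaced throughout by the piecewise linear `q`, so that every estimate is a
-- polynomial inequality over ℚ. The price is an error O(α) in the excess, which the bound (κ + 2) α
-- on `Ψ ∅` absorbs. The greedy step gains because the Jensen gap of `q` in a direction whose two
-- half-fibres have densities within a factor 2 is at most half of what the boundary in that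
-- direction may contribute. A direction that cannot be fixed profitably must therefore often split
-- fibres more unevenly than that. The Wᵢ cannot be plain sets: with a sharp cutoff, adjacent fibres
-- of almost equal bias could fall on different sides of it and create uncontrolled boundary. They
-- are weights instead, Lipschitz in the relative bias and truncated so that few coordinates are
-- active on each fibre. Relative biases are quotients by fibre densities, which may be tiny or
-- zero; hence all Lipschitz estimates are stated after multiplication by a density common to both
-- fibres.

ℚ-ring : ACR.AlmostCommutativeRing _ _
ℚ-ring = ACR.fromCommutativeRing +-*-commutativeRing isZero
  where
  isZero : ∀ p → Maybe (0ℚ ≡ p)
  isZero p with 0ℚ ℚₚ.≟ p
  ... | yes 0≡p = just 0≡p
  ... | no _    = nothing

0≤q-p⇒p≤q : ∀ {p q} → 0ℚ ≤ q - p → p ≤ q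
0≤q-p⇒p≤q {p} {q} h = ≤-trans (≤-reflexive (sym (+-identityˡ p)))
  (≤-trans (+-monoˡ-≤ p h) (≤-reflexive (cancel q p)))
  where
  cancel : ∀ q p → (q - p) + p ≡ q
  cancel = solve-∀ ℚ-ring

p≤q⇒0≤q-p : ∀ {p q} → p ≤ q → 0ℚ ≤ q - p
p≤q⇒0≤q-p {p} h = ≤-trans (≤-reflexive (sym (+-inverseʳ p))) (+-monoˡ-≤ (- p) h)

-- Farkas-style step: the conclusion c ≤ d holds because d - c equals the
-- slack b - a of a combination of known inequalities.
linear : ∀ {a b c d} → a ≤ b → d - c ≡ b - a → c ≤ d
linear a≤b eq = 0≤q-p⇒p≤q (≤-trans (p≤q⇒0≤q-p a≤b) (≤-reflexive (sym eq)))

infixr 5 _⊕_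
infixr 6 _⊙_ _⊡_

_⊕_ : ∀ {a b c d} → a ≤ b → c ≤ d → a + c ≤ b + d
_⊕_ = +-mono-≤

_⊙_ : ∀ {a b} r .{{_ : NonNegative r}} → a ≤ b → r * a ≤ r * b
r ⊙ a≤b = *-monoˡ-≤-nonNeg r a≤b

_⊡_ : ∀ {r a b} → 0ℚ ≤ r → a ≤ b → r * a ≤ r * b
_⊡_ {r} 0≤r a≤b = *-monoˡ-≤-nonNeg r {{nonNegative 0≤r}} a≤b

*-nonNeg : ∀ {p q} → 0ℚ ≤ p → 0ℚ ≤ q → 0ℚ ≤ p * q
*-nonNeg {p} {q} 0≤p 0≤q = ≤-trans (≤-reflexive (sym (*-zeroʳ p))) (0≤p ⊡ 0≤q)

*-pos : ∀ {p q} → 0ℚ < p → 0ℚ < q → 0ℚ < p * q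
*-pos {p} {q} 0<p 0<q = subst (_< p * q) (*-zeroʳ p) (*-monoʳ-<-pos p {{positive 0<p}} 0<q)

0≤½ : 0ℚ ≤ ½
0≤½ = nonNegative⁻¹ ½

0≤1 : 0ℚ ≤ 1ℚ
0≤1 = nonNegative⁻¹ 1ℚ

neg-nonNeg : ∀ {p} → p ≤ 0ℚ → 0ℚ ≤ - p
neg-nonNeg = neg-antimono-≤

sq-nonNeg : ∀ p → 0ℚ ≤ p * p
sq-nonNeg p with ≤-total 0ℚ p
... | inj₁ 0≤p = *-nonNeg 0≤p 0≤p
... | inj₂ p≤0 = ≤-trans (*-nonNeg (neg-nonNeg p≤0) (neg-nonNeg p≤0)) (≤-reflexive (neg*neg p))
  where
  neg*neg : ∀ p → (- p) * (- p) ≡ p * p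
  neg*neg = solve-∀ ℚ-ring

p≤∣p∣ : ∀ p → p ≤ ∣ p ∣
p≤∣p∣ p with ≤-total 0ℚ p
... | inj₁ 0≤p = ≤-reflexive (sym (0≤p⇒∣p∣≡p 0≤p))
... | inj₂ p≤0 = ≤-trans p≤0 (0≤∣p∣ p)

-p≤∣p∣ : ∀ p → - p ≤ ∣ p ∣
-p≤∣p∣ p = ≤-trans (p≤∣p∣ (- p)) (≤-reflexive (∣-p∣≡∣p∣ p))

∣∣-lub : ∀ {p r} → p ≤ r → - p ≤ r → ∣ p ∣ ≤ r
∣∣-lub {p} {r} p≤r -p≤r with ∣p∣≡p∨∣p∣≡-p p
... | inj₁ eq = subst (_≤ r) (sym eq) p≤r
... | inj₂ eq = subst (_≤ r) (sym eq) -p≤r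

∣p-q∣≡∣q-p∣ : ∀ p q → ∣ p - q ∣ ≡ ∣ q - p ∣
∣p-q∣≡∣q-p∣ p q = trans (sym (∣-p∣≡∣p∣ (p - q))) (cong ∣_∣ (swap p q))
  where
  swap : ∀ p q → - (p - q) ≡ q - p
  swap = solve-∀ ℚ-ring

fromℕ : ℕ → ℚ
fromℕ zero    = 0ℚ
fromℕ (suc n) = 1ℚ + fromℕ n

fromℕ-nonNeg : ∀ n → 0ℚ ≤ fromℕ n
fromℕ-nonNeg zero    = ≤-refl
fromℕ-nonNeg (suc n) = +-mono-≤ 0≤1 (fromℕ-nonNeg n)

fromℕ-+ : ∀ m n → fromℕ (m ℕ.+ n) ≡ fromℕ m + fromℕ n
fromℕ-+ zero    n = sym (+-identityˡ (fromℕ n))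
fromℕ-+ (suc m) n = trans (cong (λ z → 1ℚ + z) (fromℕ-+ m n)) (sym (+-assoc 1ℚ (fromℕ m) (fromℕ n)))

fromℕ-* : ∀ m n → fromℕ (m ℕ.* n) ≡ fromℕ m * fromℕ n
fromℕ-* zero    n = sym (*-zeroˡ (fromℕ n))
fromℕ-* (suc m) n = trans (fromℕ-+ n (m ℕ.* n))
  (trans (cong (λ z → fromℕ n + z) (fromℕ-* m n)) (distrib (fromℕ m) (fromℕ n)))
  where
  distrib : ∀ p q → q + p * q ≡ (1ℚ + p) * q
  distrib = solve-∀ ℚ-ring

fromℕ-mono : ∀ {m n} → m ℕ.≤ n → fromℕ m ≤ fromℕ n
fromℕ-mono {n = n} ℕ.z≤n = fromℕ-nonNeg n
fromℕ-mono (ℕ.s≤s m≤n)   = +-monoʳ-≤ 1ℚ (fromℕ-mono m≤n)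

½^-pos : ∀ s → 0ℚ < ½ ^ℚ s
½^-pos zero    = positive⁻¹ 1ℚ
½^-pos (suc s) = *-pos (positive⁻¹ ½) (½^-pos s)

½^-nonNeg : ∀ s → 0ℚ ≤ ½ ^ℚ s
½^-nonNeg s = <⇒≤ (½^-pos s)

Σᶠ : ∀ {n} → (Fin n → ℚ) → ℚ
Σᶠ {zero}  g = 0ℚ
Σᶠ {suc n} g = g zero + Σᶠ (g ∘ suc)

Σᶠ-cong : ∀ {n} {g h : Fin n → ℚ} → (∀ i → g i ≡ h i) → Σᶠ g ≡ Σᶠ h
Σᶠ-cong {zero}  eq = refl
Σᶠ-cong {suc n} eq = cong₂ _+_ (eq zero) (Σᶠ-cong (eq ∘ suc))

Σᶠ-mono : ∀ {n} {g h : Fin n → ℚ} → (∀ i → g i ≤ h i) → Σᶠ g ≤ Σᶠ h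
Σᶠ-mono {zero}  le = ≤-refl
Σᶠ-mono {suc n} le = +-mono-≤ (le zero) (Σᶠ-mono (le ∘ suc))

Σᶠ-0 : ∀ n → Σᶠ {n} (λ _ → 0ℚ) ≡ 0ℚ
Σᶠ-0 zero    = refl
Σᶠ-0 (suc n) = trans (+-identityˡ _) (Σᶠ-0 n)

Σᶠ-nonNeg : ∀ {n} {g : Fin n → ℚ} → (∀ i → 0ℚ ≤ g i) → 0ℚ ≤ Σᶠ g
Σᶠ-nonNeg {n} 0≤g = ≤-trans (≤-reflexive (sym (Σᶠ-0 n))) (Σᶠ-mono 0≤g)

Σᶠ-+ : ∀ {n} (g h : Fin n → ℚ) → Σᶠ (λ i → g i + h i) ≡ Σᶠ g + Σᶠ h
Σᶠ-+ {zero}  g h = refl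
Σᶠ-+ {suc n} g h = trans (cong (λ z → g zero + h zero + z) (Σᶠ-+ (g ∘ suc) (h ∘ suc)))
  (interchange (g zero) (h zero) (Σᶠ (g ∘ suc)) (Σᶠ (h ∘ suc)))
  where
  interchange : ∀ a b c d → a + b + (c + d) ≡ a + c + (b + d)
  interchange = solve-∀ ℚ-ring

Σᶠ-* : ∀ {n} r (g : Fin n → ℚ) → Σᶠ (λ i → r * g i) ≡ r * Σᶠ g
Σᶠ-* {zero}  r g = sym (*-zeroʳ r)
Σᶠ-* {suc n} r g = trans (cong (λ z → r * g zero + z) (Σᶠ-* r (g ∘ suc))) (sym (*-distribˡ-+ r _ _))

Σᶠ-swap : ∀ {m n} (g : Fin m → Fin n → ℚ) → Σᶠ (λ i → Σᶠ (g i)) ≡ Σᶠ (λ j → Σᶠ (λ i → g i j))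
Σᶠ-swap {zero}  {n} g = sym (Σᶠ-0 n)
Σᶠ-swap {suc m} {n} g = trans (cong (λ z → Σᶠ (g zero) + z) (Σᶠ-swap (g ∘ suc)))
  (sym (Σᶠ-+ (g zero) (λ j → Σᶠ (λ i → g (suc i) j))))

E : ∀ {n} → (Cube n → ℚ) → ℚ
E {zero}  f = f []
E {suc n} f = ½ * (E (f ∘ (true ∷_)) + E (f ∘ (false ∷_)))

E-cong : ∀ {n} {f g : Cube n → ℚ} → (∀ x → f x ≡ g x) → E f ≡ E g
E-cong {zero}  eq = eq []
E-cong {suc n} eq = cong (½ *_) (cong₂ _+_ (E-cong (eq ∘ (true ∷_))) (E-cong (eq ∘ (false ∷_))))

E-mono : ∀ {n} {f g : Cube n → ℚ} → (∀ x → f x ≤ g x) → E f ≤ E g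
E-mono {zero}  le = le []
E-mono {suc n} le = ½ ⊙ (E-mono (le ∘ (true ∷_)) ⊕ E-mono (le ∘ (false ∷_)))

½*p+p≡p : ∀ p → ½ * (p + p) ≡ p
½*p+p≡p = solve-∀ ℚ-ring

E-const : ∀ n r → E {n} (λ _ → r) ≡ r
E-const zero    r = refl
E-const (suc n) r = trans (cong (½ *_) (cong₂ _+_ (E-const n r) (E-const n r))) (½*p+p≡p r)

E-nonNeg : ∀ {n} {f : Cube n → ℚ} → (∀ x → 0ℚ ≤ f x) → 0ℚ ≤ E f
E-nonNeg {n} 0≤f = ≤-trans (≤-reflexive (sym (E-const n 0ℚ))) (E-mono 0≤f)

E-+ : ∀ {n} (f g : Cube n → ℚ) → E (λ x → f x + g x) ≡ E f + E g
E-+ {zero}  f g = refl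
E-+ {suc n} f g = trans
  (cong (½ *_) (cong₂ _+_ (E-+ (f ∘ (true ∷_)) (g ∘ (true ∷_))) (E-+ (f ∘ (false ∷_)) (g ∘ (false ∷_)))))
  (interchange (E (f ∘ (true ∷_))) (E (g ∘ (true ∷_))) (E (f ∘ (false ∷_))) (E (g ∘ (false ∷_))))
  where
  interchange : ∀ a b c d → ½ * (a + b + (c + d)) ≡ ½ * (a + c) + ½ * (b + d)
  interchange = solve-∀ ℚ-ring

E-* : ∀ {n} r (f : Cube n → ℚ) → E (λ x → r * f x) ≡ r * E f
E-* {zero}  r f = refl
E-* {suc n} r f = trans (cong (½ *_) (cong₂ _+_ (E-* r (f ∘ (true ∷_))) (E-* r (f ∘ (false ∷_)))))
  (factor r (E (f ∘ (true ∷_))) (E (f ∘ (false ∷_))))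
  where
  factor : ∀ r a b → ½ * (r * a + r * b) ≡ r * (½ * (a + b))
  factor = solve-∀ ℚ-ring

E-neg : ∀ {n} (f : Cube n → ℚ) → E (λ x → - f x) ≡ - E f
E-neg f = trans (E-cong (λ x → neg (f x))) (trans (E-* (- 1ℚ) f) (sym (neg (E f))))
  where
  neg : ∀ p → - p ≡ - 1ℚ * p
  neg = solve-∀ ℚ-ring

E-- : ∀ {n} (f g : Cube n → ℚ) → E (λ x → f x - g x) ≡ E f - E g
E-- f g = trans (E-+ f (λ x → - g x)) (cong (λ z → E f + z) (E-neg g))

E-Σᶠ : ∀ {n k} (g : Fin k → Cube n → ℚ) → E (λ x → Σᶠ (λ i → g i x)) ≡ Σᶠ (λ i → E (g i))
E-Σᶠ {n} {zero}  g = E-const n 0ℚ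
E-Σᶠ {n} {suc k} g = trans (E-+ (g zero) (λ x → Σᶠ (λ i → g (suc i) x)))
  (cong (λ z → E (g zero) + z) (E-Σᶠ (g ∘ suc)))

E-flip : ∀ {n} (i : Fin n) (f : Cube n → ℚ) → E (f ∘ flipAt i) ≡ E f
E-flip zero    f = cong (½ *_) (+-comm (E (f ∘ (false ∷_))) (E (f ∘ (true ∷_))))
E-flip (suc i) f = cong (½ *_) (cong₂ _+_ (E-flip i (f ∘ (true ∷_))) (E-flip i (f ∘ (false ∷_))))

-- A dyadic entropy function

mid : ℚ → ℚ → ℚ
mid u v = ½ * (u + v)

-- A piecewise linear stand-in for β ↦ β log₂(1/β), exact up to O(β):
-- q N β = (Σ_{j=1}^{N} min(β, 2⁻ʲ)) - β.
q : ℕ → ℚ → ℚ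
q zero    β = - β
q (suc N) β = (β ⊓ ½) + ½ * q N (β + β)

q-zero : ∀ N → q N 0ℚ ≡ 0ℚ
q-zero zero    = refl
q-zero (suc N) = cong (λ z → 0ℚ + ½ * z) (q-zero N)

private
  combine-gaps : ∀ m a b m′ a′ b′ g g′ → m ≤ ½ * (a + b) + g → m′ ≤ ½ * (a′ + b′) + g′ →
    m + ½ * m′ ≤ ½ * ((a + ½ * a′) + (b + ½ * b′)) + (g + ½ * g′)
  combine-gaps m a b m′ a′ b′ g g′ p p′ = linear (p ⊕ ½ ⊙ p′)
    (solve (m ∷ₗ a ∷ₗ b ∷ₗ m′ ∷ₗ a′ ∷ₗ b′ ∷ₗ g ∷ₗ g′ ∷ₗ []ₗ) ℚ-ring)

  mid-double : ∀ u v → mid u v + mid u v ≡ mid (u + u) (v + v)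
  mid-double u v = double u v
    where
    double : ∀ u v → ½ * (u + v) + ½ * (u + v) ≡ ½ * ((u + u) + (v + v))
    double = solve-∀ ℚ-ring

-- `g` bounds the Jensen gap of `q N` at the midpoint. The bound ½ |u - v| is the two-point form of
-- edge isoperimetry.
GapBound : ℕ → ℚ → ℚ → ℚ → Set
GapBound N u v g = q N (mid u v) ≤ ½ * (q N u + q N v) + g

private
  gap-suc : ∀ N u v {g g′} → (mid u v ⊓ ½) ≤ ½ * ((u ⊓ ½) + (v ⊓ ½)) + g →
    GapBound N (u + u) (v + v) g′ → GapBound (suc N) u v (g + ½ * g′)
  gap-suc N u v {g} {g′} p p′ = combine-gaps (mid u v ⊓ ½) (u ⊓ ½) (v ⊓ ½)
    (q N (mid u v + mid u v)) (q N (u + u)) (q N (v + v)) g g′ p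
    (subst (λ z → q N z ≤ ½ * (q N (u + u) + q N (v + v)) + g′) (sym (mid-double u v)) p′)

  gap-zero : ∀ u v g → 0ℚ ≤ g → GapBound zero u v g
  gap-zero u v g 0≤g = linear 0≤g (eq u v g)
    where
    eq : ∀ u v g → ½ * (- u + - v) + g - - (½ * (u + v)) ≡ g - 0ℚ
    eq = solve-∀ ℚ-ring

  weaken : ∀ N u v {g g′} → g ≤ g′ → GapBound N u v g → GapBound N u v g′
  weaken N u v g≤g′ p = ≤-trans p (+-monoʳ-≤ (½ * (q N u + q N v)) g≤g′)

  min-gap-low : ∀ {u v} → u ≤ ½ → v ≤ ½ → (mid u v ⊓ ½) ≤ ½ * ((u ⊓ ½) + (v ⊓ ½)) + 0ℚ
  min-gap-low {u} {v} u≤½ v≤½ = ≤-trans (p⊓q≤p (mid u v) ½)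
    (≤-reflexive (trans (cong₂ (λ a b → ½ * (a + b)) (sym (p≤q⇒p⊓q≡p u≤½)) (sym (p≤q⇒p⊓q≡p v≤½)))
      (sym (+-identityʳ (½ * ((u ⊓ ½) + (v ⊓ ½)))))))

  min-gap-high : ∀ {u v} → ½ ≤ u → ½ ≤ v → (mid u v ⊓ ½) ≤ ½ * ((u ⊓ ½) + (v ⊓ ½)) + 0ℚ
  min-gap-high {u} {v} ½≤u ½≤v = ≤-trans (p⊓q≤q (mid u v) ½)
    (≤-reflexive (cong₂ (λ a b → ½ * (a + b) + 0ℚ) (sym (p≥q⇒p⊓q≡q ½≤u)) (sym (p≥q⇒p⊓q≡q ½≤v))))

  min-gap-left : ∀ {u v} → u ≤ ½ → ½ ≤ v →
    (mid u v ⊓ ½) ≤ ½ * ((u ⊓ ½) + (v ⊓ ½)) + ½ * (½ - u)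
  min-gap-left {u} {v} u≤½ ½≤v = ≤-trans (p⊓q≤q (mid u v) ½)
    (≤-reflexive (trans (eq u)
      (cong₂ (λ a b → ½ * (a + b) + ½ * (½ - u)) (sym (p≤q⇒p⊓q≡p u≤½)) (sym (p≥q⇒p⊓q≡q ½≤v)))))
    where
    eq : ∀ u → ½ ≡ ½ * (u + ½) + ½ * (½ - u)
    eq = solve-∀ ℚ-ring

  min-gap-right : ∀ {u v} → u ≤ ½ → ½ ≤ v →
    (mid u v ⊓ ½) ≤ ½ * ((u ⊓ ½) + (v ⊓ ½)) + ½ * (v - ½)
  min-gap-right {u} {v} u≤½ ½≤v = ≤-trans (p⊓q≤p (mid u v) ½)
    (≤-reflexive (trans (eq u v)
      (cong₂ (λ a b → ½ * (a + b) + ½ * (v - ½)) (sym (p≤q⇒p⊓q≡p u≤½)) (sym (p≥q⇒p⊓q≡q ½≤v)))))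
    where
    eq : ∀ u v → ½ * (u + v) ≡ ½ * (u + ½) + ½ * (v - ½)
    eq = solve-∀ ℚ-ring

  double-mono : ∀ {u v} → u ≤ v → u + u ≤ v + v
  double-mono u≤v = u≤v ⊕ u≤v

  double-nonNeg : ∀ {u} → 0ℚ ≤ u → 0ℚ ≤ u + u
  double-nonNeg 0≤u = 0≤u ⊕ 0≤u

  ½≤double : ∀ u → ½ ≤ u → ½ ≤ u + u
  ½≤double u ½≤u = ≤-trans ½≤u (linear (≤-trans 0≤½ ½≤u) (solve (u ∷ₗ []ₗ) ℚ-ring))

  double≤1 : ∀ u → u ≤ ½ → u + u ≤ 1ℚ
  double≤1 u u≤½ = u≤½ ⊕ u≤½

gap-high : ∀ N {u v} → ½ ≤ u → ½ ≤ v → GapBound N u v 0ℚ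
gap-high zero    {u} {v} _ _ = gap-zero u v 0ℚ ≤-refl
gap-high (suc N) {u} {v} ½≤u ½≤v = gap-suc N u v (min-gap-high ½≤u ½≤v)
  (gap-high N {u + u} {v + v} (½≤double u ½≤u) (½≤double v ½≤v))

private
  -- A bound free of `v`: once `v` has passed ½ it stays at the cap at all later scales, and only
  -- the distance of `u` from the cap still costs. This settles the crossing case of `gap≤½[v-u]`.
  gap≤½[1-u] : ∀ N u v → 0ℚ ≤ u → u ≤ v → u ≤ 1ℚ → GapBound N u v (½ * (1ℚ - u))
  gap≤½[1-u] zero    u v 0≤u u≤v u≤1 = gap-zero u v _ (*-nonNeg 0≤½ (p≤q⇒0≤q-p u≤1))
  gap≤½[1-u] (suc N) u v 0≤u u≤v u≤1 with ≤-total u ½ | ≤-total v ½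
  ... | inj₂ ½≤u | _ = weaken (suc N) u v (*-nonNeg 0≤½ (p≤q⇒0≤q-p u≤1))
    (gap-high (suc N) {u} {v} ½≤u (≤-trans ½≤u u≤v))
  ... | inj₁ u≤½ | inj₁ v≤½ = weaken (suc N) u v (arith u 0≤u)
    (gap-suc N u v (min-gap-low u≤½ v≤½)
      (gap≤½[1-u] N (u + u) (v + v) (double-nonNeg 0≤u) (double-mono u≤v) (double≤1 u u≤½)))
    where
    arith : ∀ u → 0ℚ ≤ u → 0ℚ + ½ * (½ * (1ℚ - (u + u))) ≤ ½ * (1ℚ - u)
    arith u 0≤u = linear (nonNegative⁻¹ (½ * ½)) (solve (u ∷ₗ []ₗ) ℚ-ring)
  ... | inj₁ u≤½ | inj₂ ½≤v = weaken (suc N) u v (arith u 0≤u)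
    (gap-suc N u v (min-gap-left u≤½ ½≤v)
      (gap≤½[1-u] N (u + u) (v + v) (double-nonNeg 0≤u) (double-mono u≤v) (double≤1 u u≤½)))
    where
    arith : ∀ u → 0ℚ ≤ u → ½ * (½ - u) + ½ * (½ * (1ℚ - (u + u))) ≤ ½ * (1ℚ - u)
    arith u 0≤u = linear (½ ⊙ 0≤u) (solve (u ∷ₗ []ₗ) ℚ-ring)

gap≤½[v-u] : ∀ N u v → 0ℚ ≤ u → u ≤ v → GapBound N u v (½ * (v - u))
gap≤½[v-u] zero    u v 0≤u u≤v = gap-zero u v _ (*-nonNeg 0≤½ (p≤q⇒0≤q-p u≤v))
gap≤½[v-u] (suc N) u v 0≤u u≤v with ≤-total u ½ | ≤-total v ½
... | inj₂ ½≤u | _ = weaken (suc N) u v (*-nonNeg 0≤½ (p≤q⇒0≤q-p u≤v))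
  (gap-high (suc N) {u} {v} ½≤u (≤-trans ½≤u u≤v))
... | inj₁ u≤½ | inj₁ v≤½ = weaken (suc N) u v (≤-reflexive (arith u v))
  (gap-suc N u v (min-gap-low u≤½ v≤½)
    (gap≤½[v-u] N (u + u) (v + v) (double-nonNeg 0≤u) (double-mono u≤v)))
  where
  arith : ∀ u v → 0ℚ + ½ * (½ * (v + v - (u + u))) ≡ ½ * (v - u)
  arith = solve-∀ ℚ-ring
... | inj₁ u≤½ | inj₂ ½≤v = weaken (suc N) u v (≤-reflexive (arith u v))
  (gap-suc N u v (min-gap-right u≤½ ½≤v)
    (gap≤½[1-u] N (u + u) (v + v) (double-nonNeg 0≤u) (double-mono u≤v) (double≤1 u u≤½)))
  where
  arith : ∀ u v → ½ * (v - ½) + ½ * (½ * (1ℚ - (u + u))) ≡ ½ * (v - u)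
  arith = solve-∀ ℚ-ring

-- When v ≤ 2u, at most one threshold 2⁻ʲ lies strictly between `u` and `v`, so only one summand of
-- `q` has a gap. With that threshold scaled to ½, both ½ (½ - u) and ½ (v - ½) bound it, and their
-- mean is ¼ (v - u).
gap≤¼[v-u] : ∀ N u v → 0ℚ ≤ u → u ≤ v → v ≤ u + u → GapBound N u v (½ * (½ * (v - u)))
gap≤¼[v-u] zero    u v 0≤u u≤v _ = gap-zero u v _ (*-nonNeg 0≤½ (*-nonNeg 0≤½ (p≤q⇒0≤q-p u≤v)))
gap≤¼[v-u] (suc N) u v 0≤u u≤v v≤2u with ≤-total u ½ | ≤-total v ½
... | inj₂ ½≤u | _ = weaken (suc N) u v (*-nonNeg 0≤½ (*-nonNeg 0≤½ (p≤q⇒0≤q-p u≤v)))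
  (gap-high (suc N) {u} {v} ½≤u (≤-trans ½≤u u≤v))
... | inj₁ u≤½ | inj₁ v≤½ = weaken (suc N) u v (≤-reflexive (arith u v))
  (gap-suc N u v (min-gap-low u≤½ v≤½)
    (gap≤¼[v-u] N (u + u) (v + v) (double-nonNeg 0≤u) (double-mono u≤v) (double-mono v≤2u)))
  where
  arith : ∀ u v → 0ℚ + ½ * (½ * (½ * (v + v - (u + u)))) ≡ ½ * (½ * (v - u))
  arith = solve-∀ ℚ-ring
... | inj₁ u≤½ | inj₂ ½≤v = average (gap-suc N u v (min-gap-left u≤½ ½≤v) rest)
    (gap-suc N u v (min-gap-right u≤½ ½≤v) rest)
  where
  rest : GapBound N (u + u) (v + v) 0ℚ
  rest = gap-high N {u + u} {v + v} (≤-trans ½≤v v≤2u) (½≤double v ½≤v)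
  combine : ∀ x y u v → x ≤ y + (½ * (½ - u) + ½ * 0ℚ) → x ≤ y + (½ * (v - ½) + ½ * 0ℚ) →
    x ≤ y + ½ * (½ * (v - u))
  combine x y u v p p′ = linear (½ ⊙ (p ⊕ p′)) (solve (x ∷ₗ y ∷ₗ u ∷ₗ v ∷ₗ []ₗ) ℚ-ring)
  average : GapBound (suc N) u v (½ * (½ - u) + ½ * 0ℚ) → GapBound (suc N) u v (½ * (v - ½) + ½ * 0ℚ) →
    GapBound (suc N) u v (½ * (½ * (v - u)))
  average = combine (q (suc N) (mid u v)) (½ * (q (suc N) u + q (suc N) v)) u v

private
  GapBound-sym : ∀ N {u v g} → GapBound N v u g → GapBound N u v g
  GapBound-sym N {u} {v} {g} = subst₂ _≤_ (cong (λ z → q N (½ * z)) (+-comm v u))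
    (cong (λ z → ½ * z + g) (+-comm (q N v) (q N u)))

  ∣-∣-of-≤ : ∀ {u v} → u ≤ v → v - u ≡ ∣ u - v ∣
  ∣-∣-of-≤ {u} {v} u≤v = trans (sym (0≤p⇒∣p∣≡p (p≤q⇒0≤q-p u≤v))) (∣p-q∣≡∣q-p∣ v u)

gap≤½∣u-v∣ : ∀ N {u v} → 0ℚ ≤ u → 0ℚ ≤ v → GapBound N u v (½ * ∣ u - v ∣)
gap≤½∣u-v∣ N {u} {v} 0≤u 0≤v with ≤-total u v
... | inj₁ u≤v = subst (λ z → GapBound N u v (½ * z)) (∣-∣-of-≤ u≤v) (gap≤½[v-u] N u v 0≤u u≤v)
... | inj₂ v≤u = GapBound-sym N {u} {v} (subst (λ z → GapBound N v u (½ * z))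
  (trans (∣-∣-of-≤ v≤u) (∣p-q∣≡∣q-p∣ v u)) (gap≤½[v-u] N v u 0≤v v≤u))

gap≤¼∣u-v∣ : ∀ N {u v} → 0ℚ ≤ u → 0ℚ ≤ v → u ≤ v + v → v ≤ u + u → GapBound N u v (½ * (½ * ∣ u - v ∣))
gap≤¼∣u-v∣ N {u} {v} 0≤u 0≤v u≤2v v≤2u with ≤-total u v
... | inj₁ u≤v = subst (λ z → GapBound N u v (½ * (½ * z))) (∣-∣-of-≤ u≤v) (gap≤¼[v-u] N u v 0≤u u≤v v≤2u)
... | inj₂ v≤u = GapBound-sym N {u} {v} (subst (λ z → GapBound N v u (½ * (½ * z)))
  (trans (∣-∣-of-≤ v≤u) (∣p-q∣≡∣q-p∣ v u)) (gap≤¼[v-u] N v u 0≤v v≤u u≤2v))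

-- Replace the first `s` summands min(β, 2⁻ʲ) by β and the others by 2⁻ʲ. The bound is affine in β
-- for every fixed `s`, so one scale can serve all fibres at once, whatever their densities.
q-upper : ∀ N s {β} → 0ℚ ≤ β → q N β ≤ (fromℕ s - 1ℚ) * β + ½ ^ℚ s
q-upper zero zero {β} 0≤β = linear 0≤1 (eq β)
  where
  eq : ∀ β → (0ℚ - 1ℚ) * β + 1ℚ - - β ≡ 1ℚ - 0ℚ
  eq = solve-∀ ℚ-ring
q-upper zero (suc s) {β} 0≤β = arith β (fromℕ s) (½ ^ℚ s) (*-nonNeg (fromℕ-nonNeg s) 0≤β) 0≤β (½^-nonNeg s)
  where
  arith : ∀ β s h → 0ℚ ≤ s * β → 0ℚ ≤ β → 0ℚ ≤ h → - β ≤ (1ℚ + s - 1ℚ) * β + ½ * h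
  arith β s h p p′ p″ = linear (p ⊕ p′ ⊕ ½ ⊙ p″) (solve (β ∷ₗ s ∷ₗ h ∷ₗ []ₗ) ℚ-ring)
q-upper (suc N) zero {β} 0≤β = arith β (β ⊓ ½) (q N (β + β)) (p⊓q≤q β ½) (q-upper N zero (double-nonNeg 0≤β))
  where
  arith : ∀ β m r → m ≤ ½ → r ≤ (0ℚ - 1ℚ) * (β + β) + 1ℚ → m + ½ * r ≤ (0ℚ - 1ℚ) * β + 1ℚ
  arith β m r p p′ = linear (p ⊕ ½ ⊙ p′) (solve (β ∷ₗ m ∷ₗ r ∷ₗ []ₗ) ℚ-ring)
q-upper (suc N) (suc s) {β} 0≤β = arith β (β ⊓ ½) (q N (β + β)) (fromℕ s) (½ ^ℚ s) (p⊓q≤p β ½)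
  (q-upper N s (double-nonNeg 0≤β))
  where
  arith : ∀ β m r s h → m ≤ β → r ≤ (s - 1ℚ) * (β + β) + h → m + ½ * r ≤ (1ℚ + s - 1ℚ) * β + ½ * h
  arith β m r s h p p′ = linear (p ⊕ ½ ⊙ p′) (solve (β ∷ₗ m ∷ₗ r ∷ₗ s ∷ₗ h ∷ₗ []ₗ) ℚ-ring)

½^≤1 : ∀ s → ½ ^ℚ s ≤ 1ℚ
½^≤1 zero    = ≤-refl
½^≤1 (suc s) = ≤-trans (½ ⊙ ½^≤1 s) (≤ᵇ⇒≤ _)

private
  double≤½^ : ∀ s β → β ≤ ½ * ½ ^ℚ s → β + β ≤ ½ ^ℚ s
  double≤½^ s β p = ≤-trans (p ⊕ p) (≤-reflexive (eq (½ ^ℚ s)))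
    where
    eq : ∀ h → ½ * h + ½ * h ≡ h
    eq = solve-∀ ℚ-ring

  ½^suc≤½ : ∀ s → ½ ^ℚ suc s ≤ ½
  ½^suc≤½ s = ≤-trans (½ ⊙ ½^≤1 s) (≤-reflexive (*-identityʳ ½))

-- For β ≤ 2⁻ˢ the first `s` summands equal β and the remaining ones are nonnegative.
q-lower : ∀ {N} s {β} → s ℕ.≤ N → 0ℚ ≤ β → β ≤ ½ ^ℚ s → (fromℕ s - 1ℚ) * β ≤ q N β
q-lower {zero} zero {β} _ 0≤β _ = ≤-reflexive (eq β)
  where
  eq : ∀ β → (0ℚ - 1ℚ) * β ≡ - β
  eq = solve-∀ ℚ-ring
q-lower {suc N} zero {β} _ 0≤β β≤1 = arith β (β ⊓ ½) (q N (β + β)) (⊓-glb 0≤β 0≤½) (q-lower′ N (β + β) (double-nonNeg 0≤β))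
  where
  q-lower′ : ∀ N β → 0ℚ ≤ β → - β ≤ q N β
  q-lower′ zero    β 0≤β = ≤-refl
  q-lower′ (suc N) β 0≤β = step β (β ⊓ ½) (q N (β + β)) (⊓-glb 0≤β 0≤½) (q-lower′ N (β + β) (double-nonNeg 0≤β))
    where
    step : ∀ β m r → 0ℚ ≤ m → - (β + β) ≤ r → - β ≤ m + ½ * r
    step β m r p p′ = linear (p ⊕ ½ ⊙ p′) (solve (β ∷ₗ m ∷ₗ r ∷ₗ []ₗ) ℚ-ring)
  arith : ∀ β m r → 0ℚ ≤ m → - (β + β) ≤ r → (0ℚ - 1ℚ) * β ≤ m + ½ * r
  arith β m r p p′ = linear (p ⊕ ½ ⊙ p′) (solve (β ∷ₗ m ∷ₗ r ∷ₗ []ₗ) ℚ-ring)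
q-lower {suc N} (suc s) {β} (ℕ.s≤s s≤N) 0≤β β≤ = arith β (q N (β + β)) (β ⊓ ½) (fromℕ s)
  (p≤q⇒p⊓q≡p (≤-trans β≤ (½^suc≤½ s)))
  (q-lower s s≤N (double-nonNeg 0≤β) (double≤½^ s β β≤))
  where
  arith : ∀ β r m s → m ≡ β → (s - 1ℚ) * (β + β) ≤ r → (1ℚ + s - 1ℚ) * β ≤ m + ½ * r
  arith β r .β s refl p = linear (½ ⊙ p) (solve (β ∷ₗ r ∷ₗ s ∷ₗ []ₗ) ℚ-ring)

-- On a single dyadic interval every summand is known: `s` copies of β, then 2⁻ʲ for s < j ≤ N,
-- which add up to 2⁻ˢ - 2⁻ᴺ.
q-lower-sharp : ∀ {N} s {β} → s ℕ.≤ N → ½ ^ℚ suc s ≤ β → β ≤ ½ ^ℚ s →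
  (fromℕ s - 1ℚ) * β + ½ ^ℚ s - ½ ^ℚ N ≤ q N β
q-lower-sharp {N} zero {β} _ ½≤β _ = go N β ½≤β
  where
  base : ∀ β → (0ℚ - 1ℚ) * β + 1ℚ - 1ℚ ≡ - β
  base = solve-∀ ℚ-ring
  arith : ∀ β m r h → m ≡ ½ → (0ℚ - 1ℚ) * (β + β) + 1ℚ - h ≤ r →
    (0ℚ - 1ℚ) * β + 1ℚ - ½ * h ≤ m + ½ * r
  arith β .½ r h refl p = linear (½ ⊙ p) (solve (β ∷ₗ r ∷ₗ h ∷ₗ []ₗ) ℚ-ring)
  go : ∀ N β → ½ ≤ β → (0ℚ - 1ℚ) * β + 1ℚ - ½ ^ℚ N ≤ q N β
  go zero    β ½≤β = ≤-reflexive (base β)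
  go (suc N) β ½≤β = arith β (β ⊓ ½) (q N (β + β)) (½ ^ℚ N) (p≥q⇒p⊓q≡q ½≤β) (go N (β + β) (½≤double β ½≤β))
q-lower-sharp {suc N} (suc s) {β} (ℕ.s≤s s≤N) ≤β β≤ = arith β (β ⊓ ½) (q N (β + β)) (fromℕ s) (½ ^ℚ s) (½ ^ℚ N)
  (p≤q⇒p⊓q≡p (≤-trans β≤ (½^suc≤½ s)))
  (q-lower-sharp s s≤N (½^≤double s β ≤β) (double≤½^ s β β≤))
  where
  ½^≤double : ∀ s β → ½ * (½ * ½ ^ℚ s) ≤ β → ½ * ½ ^ℚ s ≤ β + β
  ½^≤double s β p = ≤-trans (≤-reflexive (eq (½ ^ℚ s))) (p ⊕ p)
    where
    eq : ∀ h → ½ * h ≡ ½ * (½ * h) + ½ * (½ * h)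
    eq = solve-∀ ℚ-ring
  arith : ∀ β m r s h h′ → m ≡ β → (s - 1ℚ) * (β + β) + h - h′ ≤ r →
    (1ℚ + s - 1ℚ) * β + ½ * h - ½ * h′ ≤ m + ½ * r
  arith β .β r s h h′ refl p = linear (½ ⊙ p) (solve (β ∷ₗ r ∷ₗ s ∷ₗ h ∷ₗ h′ ∷ₗ []ₗ) ℚ-ring)

-- Conditional expectations and edge isoperimetry

Mask : ℕ → Set
Mask = Vec Bool

Σ∉ Σ∈ : ∀ {n} → Mask n → (Fin n → ℚ) → ℚ
Σ∉ m g = Σᶠ (λ i → if lookup m i then 0ℚ else g i)
Σ∈ m g = Σᶠ (λ i → if lookup m i then g i else 0ℚ)

if-mono : ∀ (b : Bool) {p q r s : ℚ} → p ≤ r → q ≤ s → (if b then p else q) ≤ (if b then r else s)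
if-mono true  p≤r _ = p≤r
if-mono false _ q≤s = q≤s

Σ∈-mono : ∀ {n} (m : Mask n) {g h : Fin n → ℚ} → (∀ i → g i ≤ h i) → Σ∈ m g ≤ Σ∈ m h
Σ∈-mono m le = Σᶠ-mono (λ i → if-mono (lookup m i) (le i) ≤-refl)

Σ∈+Σ∉ : ∀ {n} (m : Mask n) (g : Fin n → ℚ) → Σ∈ m g + Σ∉ m g ≡ Σᶠ g
Σ∈+Σ∉ m g = trans (sym (Σᶠ-+ (λ i → if lookup m i then g i else 0ℚ) (λ i → if lookup m i then 0ℚ else g i)))
  (Σᶠ-cong (λ i → split (lookup m i) (g i)))
  where
  split : ∀ b p → (if b then p else 0ℚ) + (if b then 0ℚ else p) ≡ p
  split true  p = +-identityʳ p
  split false p = +-identityˡ p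

-- C m f is the conditional expectation of f given the coordinates i with
-- lookup m i = true; the remaining ("free") coordinates are averaged out.
C : ∀ {n} → Mask n → (Cube n → ℚ) → Cube n → ℚ
C []          f []      = f []
C (true  ∷ m) f (b ∷ x) = C m (f ∘ (b ∷_)) x
C (false ∷ m) f (b ∷ x) = mid (C m (f ∘ (true ∷_)) x) (C m (f ∘ (false ∷_)) x)

mid-mono : ∀ {u v u′ v′} → u ≤ u′ → v ≤ v′ → mid u v ≤ mid u′ v′
mid-mono p p′ = ½ ⊙ (p ⊕ p′)

C-cong : ∀ {n} (m : Mask n) {f g : Cube n → ℚ} → (∀ x → f x ≡ g x) → ∀ x → C m f x ≡ C m g x
C-cong []          eq []      = eq []
C-cong (true  ∷ m) eq (b ∷ x) = C-cong m (λ y → eq (b ∷ y)) x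
C-cong (false ∷ m) eq (b ∷ x) = cong₂ mid (C-cong m (λ y → eq (true ∷ y)) x) (C-cong m (λ y → eq (false ∷ y)) x)

C-mono : ∀ {n} (m : Mask n) {f g : Cube n → ℚ} → (∀ x → f x ≤ g x) → ∀ x → C m f x ≤ C m g x
C-mono []          le []      = le []
C-mono (true  ∷ m) le (b ∷ x) = C-mono m (λ y → le (b ∷ y)) x
C-mono (false ∷ m) le (b ∷ x) = mid-mono (C-mono m (λ y → le (true ∷ y)) x) (C-mono m (λ y → le (false ∷ y)) x)

C-const : ∀ {n} (m : Mask n) r x → C m (λ _ → r) x ≡ r
C-const []          r []      = refl
C-const (true  ∷ m) r (b ∷ x) = C-const m r x
C-const (false ∷ m) r (b ∷ x) = trans (cong₂ mid (C-const m r x) (C-const m r x)) (½*p+p≡p r)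

C-nonNeg : ∀ {n} (m : Mask n) {f : Cube n → ℚ} → (∀ x → 0ℚ ≤ f x) → ∀ x → 0ℚ ≤ C m f x
C-nonNeg m 0≤f x = ≤-trans (≤-reflexive (sym (C-const m 0ℚ x))) (C-mono m 0≤f x)

private
  mid-+ : ∀ a b c d → mid (a + b) (c + d) ≡ mid a c + mid b d
  mid-+ a b c d = eq a b c d
    where
    eq : ∀ a b c d → ½ * ((a + b) + (c + d)) ≡ ½ * (a + c) + ½ * (b + d)
    eq = solve-∀ ℚ-ring

  mid-* : ∀ r a c → mid (r * a) (r * c) ≡ r * mid a c
  mid-* r a c = eq r a c
    where
    eq : ∀ r a c → ½ * (r * a + r * c) ≡ r * (½ * (a + c))
    eq = solve-∀ ℚ-ring

C-+ : ∀ {n} (m : Mask n) (f g : Cube n → ℚ) x → C m (λ y → f y + g y) x ≡ C m f x + C m g x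
C-+ []          f g []      = refl
C-+ (true  ∷ m) f g (b ∷ x) = C-+ m (f ∘ (b ∷_)) (g ∘ (b ∷_)) x
C-+ (false ∷ m) f g (b ∷ x) = trans
  (cong₂ mid (C-+ m (f ∘ (true ∷_)) (g ∘ (true ∷_)) x) (C-+ m (f ∘ (false ∷_)) (g ∘ (false ∷_)) x))
  (mid-+ (C m (f ∘ (true ∷_)) x) (C m (g ∘ (true ∷_)) x) (C m (f ∘ (false ∷_)) x) (C m (g ∘ (false ∷_)) x))

C-* : ∀ {n} (m : Mask n) r (f : Cube n → ℚ) x → C m (λ y → r * f y) x ≡ r * C m f x
C-* []          r f []      = refl
C-* (true  ∷ m) r f (b ∷ x) = C-* m r (f ∘ (b ∷_)) x
C-* (false ∷ m) r f (b ∷ x) = trans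
  (cong₂ mid (C-* m r (f ∘ (true ∷_)) x) (C-* m r (f ∘ (false ∷_)) x))
  (mid-* r (C m (f ∘ (true ∷_)) x) (C m (f ∘ (false ∷_)) x))

private
  -p≡-1*p : ∀ p → - p ≡ - 1ℚ * p
  -p≡-1*p = solve-∀ ℚ-ring

C-neg : ∀ {n} (m : Mask n) (f : Cube n → ℚ) x → C m (λ y → - f y) x ≡ - C m f x
C-neg m f x = trans (C-cong m (λ y → -p≡-1*p (f y)) x) (trans (C-* m (- 1ℚ) f x) (sym (-p≡-1*p (C m f x))))

C-- : ∀ {n} (m : Mask n) (f g : Cube n → ℚ) x → C m (λ y → f y - g y) x ≡ C m f x - C m g x
C-- m f g x = trans (C-+ m f (λ y → - g y) x) (cong (λ z → C m f x + z) (C-neg m g x))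

∣C-C∣≤C∣-∣ : ∀ {n} (m : Mask n) (f g : Cube n → ℚ) x → ∣ C m f x - C m g x ∣ ≤ C m (λ y → ∣ f y - g y ∣) x
∣C-C∣≤C∣-∣ m f g x = ∣∣-lub
  (≤-trans (≤-reflexive (sym (C-- m f g x))) (C-mono m (λ y → p≤∣p∣ (f y - g y)) x))
  (≤-trans (≤-reflexive (trans (cong -_ (sym (C-- m f g x))) (sym (C-neg m (λ y → f y - g y) x))))
    (C-mono m (λ y → -p≤∣p∣ (f y - g y)) x))

E-C : ∀ {n} (m : Mask n) (f : Cube n → ℚ) → E (C m f) ≡ E f
E-C []          f = refl
E-C (true  ∷ m) f = cong₂ mid (E-C m (f ∘ (true ∷_))) (E-C m (f ∘ (false ∷_)))
E-C (false ∷ m) f = trans (½*p+p≡p _) (trans (E-* ½ (λ x → C m (f ∘ (true ∷_)) x + C m (f ∘ (false ∷_)) x))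
  (cong (½ *_) (trans (E-+ (C m (f ∘ (true ∷_))) (C m (f ∘ (false ∷_))))
    (cong₂ _+_ (E-C m (f ∘ (true ∷_))) (E-C m (f ∘ (false ∷_)))))))

C-flip : ∀ {n} (m : Mask n) i (f : Cube n → ℚ) x → C m (f ∘ flipAt i) x ≡ C m f (flipAt i x)
C-flip (true  ∷ m) zero    f (b ∷ x) = refl
C-flip (false ∷ m) zero    f (b ∷ x) = cong (½ *_) (+-comm (C m (f ∘ (false ∷_)) x) (C m (f ∘ (true ∷_)) x))
C-flip (true  ∷ m) (suc i) f (b ∷ x) = C-flip m i (f ∘ (b ∷_)) x
C-flip (false ∷ m) (suc i) f (b ∷ x) = cong₂ mid (C-flip m i (f ∘ (true ∷_)) x) (C-flip m i (f ∘ (false ∷_)) x)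

FreeInvariant : ∀ {n} → Mask n → (Cube n → ℚ) → Set
FreeInvariant m w = ∀ i → lookup m i ≡ false → ∀ x → w (flipAt i x) ≡ w x

C-invariant : ∀ {n} (m : Mask n) (f : Cube n → ℚ) → FreeInvariant m (C m f)
C-invariant (false ∷ m) f zero    _  (b ∷ x) = refl
C-invariant (true  ∷ m) f (suc i) eq (b ∷ x) = C-invariant m (f ∘ (b ∷_)) i eq x
C-invariant (false ∷ m) f (suc i) eq (b ∷ x) =
  cong₂ mid (C-invariant m (f ∘ (true ∷_)) i eq x) (C-invariant m (f ∘ (false ∷_)) i eq x)

-- The weight is constant along each fibre, so `f` may first be averaged over the fibre (tower
-- property).
E-pull-out : ∀ {n} (m : Mask n) (f w : Cube n → ℚ) → FreeInvariant m w →
  E (λ x → f x * w x) ≡ E (λ x → C m f x * w x)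
E-pull-out []          f w inv = refl
E-pull-out (true  ∷ m) f w inv = cong₂ mid
  (E-pull-out m (f ∘ (true ∷_)) (w ∘ (true ∷_)) (λ i eq x → inv (suc i) eq (true ∷ x)))
  (E-pull-out m (f ∘ (false ∷_)) (w ∘ (false ∷_)) (λ i eq x → inv (suc i) eq (false ∷ x)))
E-pull-out (false ∷ m) f w inv = begin
  mid (E (λ x → f₁ x * w₁ x)) (E (λ x → f₀ x * w₀ x))
    ≡⟨ cong₂ mid (E-pull-out m f₁ w₁ (λ i eq x → inv (suc i) eq (true ∷ x)))
         (trans (E-cong (λ x → cong (f₀ x *_) (w₀≡w₁ x))) (E-pull-out m f₀ w₁ (λ i eq x → inv (suc i) eq (true ∷ x)))) ⟩
  mid (E (λ x → C m f₁ x * w₁ x)) (E (λ x → C m f₀ x * w₁ x))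
    ≡⟨ cong (½ *_) (E-+ (λ x → C m f₁ x * w₁ x) (λ x → C m f₀ x * w₁ x)) ⟨
  ½ * E (λ x → C m f₁ x * w₁ x + C m f₀ x * w₁ x)
    ≡⟨ E-* ½ (λ x → C m f₁ x * w₁ x + C m f₀ x * w₁ x) ⟨
  E (λ x → ½ * (C m f₁ x * w₁ x + C m f₀ x * w₁ x))
    ≡⟨ E-cong (λ x → factor (C m f₁ x) (C m f₀ x) (w₁ x)) ⟩
  E (λ x → mid (C m f₁ x) (C m f₀ x) * w₁ x)
    ≡⟨ ½*p+p≡p _ ⟨
  mid (E (λ x → mid (C m f₁ x) (C m f₀ x) * w₁ x)) (E (λ x → mid (C m f₁ x) (C m f₀ x) * w₁ x))
    ≡⟨ cong (λ z → mid (E (λ x → mid (C m f₁ x) (C m f₀ x) * w₁ x)) z)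
         (E-cong (λ x → cong (mid (C m f₁ x) (C m f₀ x) *_) (sym (w₀≡w₁ x)))) ⟩
  mid (E (λ x → mid (C m f₁ x) (C m f₀ x) * w₁ x)) (E (λ x → mid (C m f₁ x) (C m f₀ x) * w₀ x)) ∎
  where
  open ≡-Reasoning
  f₁ = f ∘ (true ∷_)
  f₀ = f ∘ (false ∷_)
  w₁ = w ∘ (true ∷_)
  w₀ = w ∘ (false ∷_)
  w₀≡w₁ : ∀ x → w₀ x ≡ w₁ x
  w₀≡w₁ x = inv zero refl (true ∷ x)
  factor : ∀ a b c → ½ * (a * c + b * c) ≡ ½ * (a + b) * c
  factor = solve-∀ ℚ-ring

C-split : ∀ {n} (m : Mask n) i (f : Cube n → ℚ) → lookup m i ≡ false → ∀ x →
  C m f x ≡ mid (C (m [ i ]≔ true) f x) (C (m [ i ]≔ true) f (flipAt i x))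
C-split (false ∷ m) zero    f _  (true  ∷ x) = refl
C-split (false ∷ m) zero    f _  (false ∷ x) = cong (½ *_) (+-comm (C m (f ∘ (true ∷_)) x) (C m (f ∘ (false ∷_)) x))
C-split (true  ∷ m) (suc i) f eq (b ∷ x) = C-split m i (f ∘ (b ∷_)) eq x
C-split (false ∷ m) (suc i) f eq (b ∷ x) = trans
  (cong₂ mid (C-split m i (f ∘ (true ∷_)) eq x) (C-split m i (f ∘ (false ∷_)) eq x))
  (interchange (C (m [ i ]≔ true) (f ∘ (true ∷_)) x) (C (m [ i ]≔ true) (f ∘ (true ∷_)) (flipAt i x))
    (C (m [ i ]≔ true) (f ∘ (false ∷_)) x) (C (m [ i ]≔ true) (f ∘ (false ∷_)) (flipAt i x)))
  where
  interchange : ∀ a b c d → ½ * (½ * (a + b) + ½ * (c + d)) ≡ ½ * (½ * (a + c) + ½ * (b + d))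
  interchange = solve-∀ ℚ-ring

∅ : ∀ {n} → Mask n
∅ {n} = replicate n false

C-∅ : ∀ {n} (f : Cube n → ℚ) x → C ∅ f x ≡ E f
C-∅ f []      = refl
C-∅ f (b ∷ x) = cong₂ mid (C-∅ (f ∘ (true ∷_)) x) (C-∅ (f ∘ (false ∷_)) x)

-- The factor ½ compensates for meeting each edge at both ends: for an indicator, `E (D i f)` is the
-- number of boundary edges in direction `i` divided by 2ⁿ.
D : ∀ {n} → Fin n → (Cube n → ℚ) → Cube n → ℚ
D i f x = ½ * ∣ f x - f (flipAt i x) ∣

D-nonNeg : ∀ {n} i (f : Cube n → ℚ) x → 0ℚ ≤ D i f x
D-nonNeg i f x = *-nonNeg 0≤½ (0≤∣p∣ (f x - f (flipAt i x)))

private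
  Σ∉-mid : ∀ {n} (m : Mask n) (g h : Fin n → ℚ) → Σ∉ m (λ i → mid (g i) (h i)) ≡ mid (Σ∉ m g) (Σ∉ m h)
  Σ∉-mid m g h = trans (Σᶠ-cong (λ i → push (lookup m i) (g i) (h i)))
    (trans (Σᶠ-* ½ (λ i → (if lookup m i then 0ℚ else g i) + (if lookup m i then 0ℚ else h i)))
      (cong (½ *_) (Σᶠ-+ (λ i → if lookup m i then 0ℚ else g i) (λ i → if lookup m i then 0ℚ else h i))))
    where
    push : ∀ b p p′ → (if b then 0ℚ else mid p p′) ≡ mid (if b then 0ℚ else p) (if b then 0ℚ else p′)
    push true  p p′ = refl
    push false p p′ = refl

-- For indicator functions this is the edge-isoperimetric inequality (fibrewise);
-- it tensorises the two-point inequality gap≤½∣u-v∣.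
q-C-edge : ∀ {n} N (m : Mask n) (f : Cube n → ℚ) → (∀ x → 0ℚ ≤ f x) → ∀ x →
  q N (C m f x) ≤ C m (q N ∘ f) x + Σ∉ m (λ i → C m (D i f) x)
q-C-edge N []          f 0≤f []      = ≤-reflexive (sym (+-identityʳ (q N (f []))))
q-C-edge N (true  ∷ m) f 0≤f (b ∷ x) = ≤-trans (q-C-edge N m (f ∘ (b ∷_)) (λ y → 0≤f (b ∷ y)) x)
  (≤-reflexive (cong (λ z → C m (q N ∘ f ∘ (b ∷_)) x + z) (sym (+-identityˡ (Σ∉ m (λ i → C m (D i (f ∘ (b ∷_))) x))))))
q-C-edge {suc n} N (false ∷ m) f 0≤f (b ∷ x) = ≤-trans
  (combine (q N (mid u v)) (q N u) (q N v) ∣ u - v ∣ (C m (q N ∘ f₁) x) (C m (q N ∘ f₀) x)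
    (Σ∉ m (λ i → C m (D i f₁) x)) (Σ∉ m (λ i → C m (D i f₀) x)) d
    (gap≤½∣u-v∣ N (C-nonNeg m (λ y → 0≤f (true ∷ y)) x) (C-nonNeg m (λ y → 0≤f (false ∷ y)) x))
    (q-C-edge N m f₁ (λ y → 0≤f (true ∷ y)) x) (q-C-edge N m f₀ (λ y → 0≤f (false ∷ y)) x)
    ½∣u-v∣≤d)
  (≤-reflexive (cong (λ z → C (false ∷ m) (q N ∘ f) (b ∷ x) + (d + z))
    (sym (Σ∉-mid m (λ i → C m (D i f₁) x) (λ i → C m (D i f₀) x)))))
  where
  f₁ f₀ : Cube n → ℚ
  f₁ = f ∘ (true ∷_)
  f₀ = f ∘ (false ∷_)
  u v d : ℚ
  u = C m f₁ x
  v = C m f₀ x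
  d = C (false ∷ m) (D zero f) (b ∷ x)
  ½∣u-v∣≤d : ½ * ∣ u - v ∣ ≤ d
  ½∣u-v∣≤d = ≤-trans (½ ⊙ ∣C-C∣≤C∣-∣ m f₁ f₀ x)
    (≤-reflexive (trans (sym (C-* m ½ (λ y → ∣ f₁ y - f₀ y ∣) x))
      (trans (sym (½*p+p≡p (C m (λ y → ½ * ∣ f₁ y - f₀ y ∣) x)))
        (cong (λ z → mid (C m (λ y → ½ * ∣ f₁ y - f₀ y ∣) x) z)
          (C-cong m (λ y → cong (½ *_) (∣p-q∣≡∣q-p∣ (f₁ y) (f₀ y))) x)))))
  combine : ∀ qm qu qv g a b s s′ d → qm ≤ ½ * (qu + qv) + ½ * g → qu ≤ a + s → qv ≤ b + s′ → ½ * g ≤ d →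
    qm ≤ ½ * (a + b) + (d + ½ * (s + s′))
  combine qm qu qv g a b s s′ d p₁ p₂ p₃ p₄ = linear (p₁ ⊕ ½ ⊙ (p₂ ⊕ p₃) ⊕ p₄)
    (solve (qm ∷ₗ qu ∷ₗ qv ∷ₗ g ∷ₗ a ∷ₗ b ∷ₗ s ∷ₗ s′ ∷ₗ d ∷ₗ []ₗ) ℚ-ring)

-- Saturated masks

#free : ∀ {n} → Mask n → ℕ
#free []          = 0
#free (true  ∷ m) = #free m
#free (false ∷ m) = suc (#free m)

#free-fix : ∀ {n} (m : Mask n) i → lookup m i ≡ false → suc (#free (m [ i ]≔ true)) ≡ #free m
#free-fix (false ∷ m) zero    _  = refl
#free-fix (true  ∷ m) (suc i) eq = #free-fix m i eq
#free-fix (false ∷ m) (suc i) eq = cong suc (#free-fix m i eq)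

Σ∉-fix : ∀ {n} (m : Mask n) i (g : Fin n → ℚ) → lookup m i ≡ false → Σ∉ m g ≡ g i + Σ∉ (m [ i ]≔ true) g
Σ∉-fix (false ∷ m) zero    g _  = cong (λ z → g zero + z) (sym (+-identityˡ (Σ∉ m (g ∘ suc))))
Σ∉-fix (b ∷ m) (suc i) g eq = trans
  (cong (λ z → (if b then 0ℚ else g zero) + z) (Σ∉-fix m i (g ∘ suc) eq))
  (exchange (if b then 0ℚ else g zero) (g (suc i)) (Σ∉ (m [ i ]≔ true) (g ∘ suc)))
  where
  exchange : ∀ a b c → a + (b + c) ≡ b + (a + c)
  exchange = solve-∀ ℚ-ring

Σ∈-fix : ∀ {n} (m : Mask n) i (g : Fin n → ℚ) → lookup m i ≡ false → Σ∈ (m [ i ]≔ true) g ≡ Σ∈ m g + g i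
Σ∈-fix m i g eq = solve-for (Σ∈ m g) (Σ∉ m g) (Σ∈ (m [ i ]≔ true) g) (Σ∉ (m [ i ]≔ true) g) (g i)
  (trans (Σ∈+Σ∉ m g) (sym (Σ∈+Σ∉ (m [ i ]≔ true) g))) (Σ∉-fix m i g eq)
  where
  rearrange : ∀ a d e → a + (e + d) - d ≡ a + e
  rearrange = solve-∀ ℚ-ring
  cancel : ∀ c d → c ≡ c + d - d
  cancel = solve-∀ ℚ-ring
  solve-for : ∀ a b c d e → a + b ≡ c + d → b ≡ e + d → c ≡ a + e
  solve-for a b c d e p refl = trans (cancel c d) (trans (cong (_- d) (sym p)) (rearrange a d e))

IsBoolean : ∀ {n} → (Cube n → ℚ) → Set
IsBoolean f = ∀ x → f x ≡ 0ℚ ⊎ f x ≡ 1ℚ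

boolean-nonNeg : ∀ {n} {f : Cube n → ℚ} → IsBoolean f → ∀ x → 0ℚ ≤ f x
boolean-nonNeg f01 x with f01 x
... | inj₁ eq = ≤-reflexive (sym eq)
... | inj₂ eq = ≤-trans 0≤1 (≤-reflexive (sym eq))

η : ∀ {n} → (Cube n → ℚ) → Fin n → ℚ
η f i = E (D i f)

η-nonNeg : ∀ {n} (f : Cube n → ℚ) i → 0ℚ ≤ η f i
η-nonNeg f i = E-nonNeg (D-nonNeg i f)

-- Boundary density, in the free directions, of the fibre through x.
J : ∀ {n} → (Cube n → ℚ) → Mask n → Cube n → ℚ
J f m x = Σ∉ m (λ i → C m (D i f) x)

E-Σ∉ : ∀ {n k} (m : Mask k) (g : Fin k → Cube n → ℚ) → E (λ x → Σ∉ m (λ i → g i x)) ≡ Σ∉ m (λ i → E (g i))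
E-Σ∉ {n} m g = trans (E-Σᶠ (λ i x → if lookup m i then 0ℚ else g i x)) (Σᶠ-cong (λ i → push (lookup m i) i))
  where
  push : ∀ b i → E (λ x → if b then 0ℚ else g i x) ≡ (if b then 0ℚ else E (g i))
  push true  i = E-const n 0ℚ
  push false i = refl

E-J : ∀ {n} (f : Cube n → ℚ) m → E (J f m) ≡ Σ∉ m (η f)
E-J f m = trans (E-Σ∉ m (λ i → C m (D i f)))
  (Σᶠ-cong (λ i → cong (λ z → if lookup m i then 0ℚ else z) (E-C m (D i f))))

-- |E[f χᵢ | coordinates of m]|, where χᵢ = ±1 according to coordinate i.
bias : ∀ {n} → (Cube n → ℚ) → Mask n → Fin n → Cube n → ℚ
bias f m i x = ½ * ∣ C (m [ i ]≔ true) f x - C (m [ i ]≔ true) f (flipAt i x) ∣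

bias-nonNeg : ∀ {n} (f : Cube n → ℚ) m i x → 0ℚ ≤ bias f m i x
bias-nonNeg f m i x = *-nonNeg 0≤½ (0≤∣p∣ (C (m [ i ]≔ true) f x - C (m [ i ]≔ true) f (flipAt i x)))

flip-involutive : ∀ {n} (i : Fin n) x → flipAt i (flipAt i x) ≡ x
flip-involutive zero    (b ∷ x) = cong (_∷ x) (Boolₚ.not-involutive b)
flip-involutive (suc i) (b ∷ x) = cong (b ∷_) (flip-involutive i x)

D-flip : ∀ {n} i (f : Cube n → ℚ) x → D i f (flipAt i x) ≡ D i f x
D-flip i f x = cong (½ *_) (trans (cong (λ z → ∣ f (flipAt i x) - f z ∣) (flip-involutive i x))
  (∣p-q∣≡∣q-p∣ (f (flipAt i x)) (f x)))

D-C≤C-D : ∀ {n} i (m : Mask n) (f : Cube n → ℚ) x → D i (C m f) x ≤ C m (D i f) x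
D-C≤C-D i m f x = ≤-trans
  (½ ⊙ ≤-trans (≤-reflexive (cong (λ z → ∣ C m f x - z ∣) (sym (C-flip m i f x)))) (∣C-C∣≤C∣-∣ m f (f ∘ flipAt i) x))
  (≤-reflexive (sym (C-* m ½ (λ y → ∣ f y - f (flipAt i y) ∣) x)))

E-bias≤η : ∀ {n} (f : Cube n → ℚ) m i → E (bias f m i) ≤ η f i
E-bias≤η f m i = ≤-trans (E-mono (D-C≤C-D i (m [ i ]≔ true) f)) (≤-reflexive (E-C (m [ i ]≔ true) (D i f)))

bias≤C-D : ∀ {n} (f : Cube n → ℚ) m i → lookup m i ≡ false → ∀ x → bias f m i x ≤ C m (D i f) x
bias≤C-D f m i free x = ≤-trans
  (≤-trans (≤-reflexive (trans (sym (½*p+p≡p (bias f m i x))) (cong (mid (bias f m i x)) (sym (D-flip i (C (m [ i ]≔ true) f) x)))))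
    (mid-mono (D-C≤C-D i (m [ i ]≔ true) f x) (D-C≤C-D i (m [ i ]≔ true) f (flipAt i x))))
  (≤-reflexive (sym (C-split m i (D i f) free x)))

_when_<_ : ℚ → ℚ → ℚ → ℚ
p when a < b = if does (a ℚₚ.<? b) then p else 0ℚ

when-cases : ∀ p a b → (a < b × (p when a < b) ≡ p) ⊎ (b ≤ a × (p when a < b) ≡ 0ℚ)
when-cases p a b = go (a ℚₚ.<? b)
  where
  go : (d : Dec (a < b)) → (a < b × (if does d then p else 0ℚ) ≡ p) ⊎ (b ≤ a × (if does d then p else 0ℚ) ≡ 0ℚ)
  go (yes a<b) = inj₁ (a<b , refl)
  go (no  a≮b) = inj₂ (≮⇒≥ a≮b , refl)

-- The half-fibres have densities a + b and a - b, with a the fibre density and b the bias. Their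
-- ratio exceeds 2 exactly when 3b > a, which is where `gap≤¼∣u-v∣` stops applying.
farBias : ∀ {n} → (Cube n → ℚ) → Mask n → Fin n → Cube n → ℚ
farBias f m i x = bias f m i x when C m f x < (fromℕ 3 * bias f m i x)

module Potential {n : ℕ} (f : Cube n → ℚ) (f01 : IsBoolean f) (N : ℕ) where

  0≤f : ∀ x → 0ℚ ≤ f x
  0≤f = boolean-nonNeg f01

  -- Ψ m is the average excess of the fibres of m in the edge-isoperimetric
  -- inequality. Fixing a coordinate whose bias is rarely large lowers Ψ by at least
  -- ¼ η, so a maximal Light mask is cheap and all its free coordinates are Saturated.
  Φ Ψ : Mask n → ℚ
  Φ m = E (λ x → q N (C m f x))
  Ψ m = Σ∉ m (η f) - Φ m

  q≤J : ∀ m x → q N (C m f x) ≤ J f m x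
  q≤J m x = ≤-trans (q-C-edge N m f 0≤f x)
    (≤-trans (+-monoˡ-≤ (J f m x) C-q∘f≤0) (≤-reflexive (+-identityˡ (J f m x))))
    where
    q-boolean≤0 : ∀ {β} → β ≡ 0ℚ ⊎ β ≡ 1ℚ → q N β ≤ 0ℚ
    q-boolean≤0 (inj₁ refl) = ≤-reflexive (q-zero N)
    q-boolean≤0 (inj₂ refl) = q-upper N 0 0≤1
    C-q∘f≤0 : C m (q N ∘ f) x ≤ 0ℚ
    C-q∘f≤0 = ≤-trans (C-mono m (λ y → q-boolean≤0 (f01 y)) x) (≤-reflexive (C-const m 0ℚ x))

  Φ≤Σ∉η : ∀ m → Φ m ≤ Σ∉ m (η f)
  Φ≤Σ∉η m = ≤-trans (E-mono (q≤J m)) (≤-reflexive (E-J f m))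

  Ψ-nonNeg : ∀ m → 0ℚ ≤ Ψ m
  Ψ-nonNeg m = p≤q⇒0≤q-p (Φ≤Σ∉η m)

  private
    close : ∀ a b u v → a ≡ ½ * (u + v) → b ≡ ½ * ∣ u - v ∣ → fromℕ 3 * b ≤ a → u ≤ v + v
    close a b u v refl refl p = linear (p ⊕ fromℕ 3 ⊙ ½ ⊙ p≤∣p∣ (u - v)) (eq u v ∣ u - v ∣)
      where
      eq : ∀ u v w → v + v - u ≡ ½ * (u + v) + fromℕ 3 * (½ * w) - (fromℕ 3 * (½ * w) + fromℕ 3 * (½ * (u - v)))
      eq = solve-∀ ℚ-ring

    double-half : ∀ p → ½ * p ≡ ½ * (½ * p) + ½ * (½ * p)
    double-half = solve-∀ ℚ-ring

    half-zero : ∀ p → ½ * (½ * p) ≡ ½ * (½ * p) + ½ * 0ℚ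
    half-zero = solve-∀ ℚ-ring

    -- Half-fibres within a factor 2 cost half the bias, the others the full bias; the term with
    -- `farBias` merges the two cases.
    q-C-gap : ∀ m i → lookup m i ≡ false → ∀ x →
      q N (C m f x) ≤ ½ * (q N (C (m [ i ]≔ true) f x) + q N (C (m [ i ]≔ true) f (flipAt i x)))
        + (½ * bias f m i x + ½ * farBias f m i x)
    q-C-gap m i free x = go (when-cases (bias f m i x) (C m f x) (fromℕ 3 * bias f m i x))
      where
      u v : ℚ
      u = C (m [ i ]≔ true) f x
      v = C (m [ i ]≔ true) f (flipAt i x)
      0≤u : 0ℚ ≤ u
      0≤u = C-nonNeg (m [ i ]≔ true) 0≤f x
      0≤v : 0ℚ ≤ v
      0≤v = C-nonNeg (m [ i ]≔ true) 0≤f (flipAt i x)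
      conclude : ∀ {g} → q N (mid u v) ≤ ½ * (q N u + q N v) + g → g ≡ ½ * bias f m i x + ½ * farBias f m i x →
        q N (C m f x) ≤ ½ * (q N u + q N v) + (½ * bias f m i x + ½ * farBias f m i x)
      conclude p eq = subst₂ _≤_ (cong (q N) (sym (C-split m i f free x))) (cong (λ z → ½ * (q N u + q N v) + z) eq) p
      go : (C m f x < fromℕ 3 * bias f m i x × farBias f m i x ≡ bias f m i x) ⊎
        (fromℕ 3 * bias f m i x ≤ C m f x × farBias f m i x ≡ 0ℚ) →
        q N (C m f x) ≤ ½ * (q N u + q N v) + (½ * bias f m i x + ½ * farBias f m i x)
      go (inj₁ (_ , eq)) = conclude (gap≤½∣u-v∣ N 0≤u 0≤v)
        (trans (double-half ∣ u - v ∣) (cong (λ z → ½ * bias f m i x + ½ * z) (sym eq)))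
      go (inj₂ (3b≤a , eq)) = conclude
        (gap≤¼∣u-v∣ N 0≤u 0≤v
          (close (C m f x) (bias f m i x) u v (C-split m i f free x) refl 3b≤a)
          (close (C m f x) (bias f m i x) v u (trans (C-split m i f free x) (cong (½ *_) (+-comm u v)))
            (cong (½ *_) (∣p-q∣≡∣q-p∣ u v)) 3b≤a))
        (trans (half-zero ∣ u - v ∣) (cong (λ z → ½ * bias f m i x + ½ * z) (sym eq)))

  Φ-fix : ∀ m i → lookup m i ≡ false → Φ m ≤ Φ (m [ i ]≔ true) + (½ * η f i + ½ * E (farBias f m i))
  Φ-fix m i free = ≤-trans (E-mono (q-C-gap m i free)) (≤-trans (≤-reflexive expand)
    (+-monoʳ-≤ (Φ m′) (+-monoˡ-≤ (½ * E (farBias f m i)) (½ ⊙ E-bias≤η f m i))))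
    where
    m′ = m [ i ]≔ true
    qg : Cube n → ℚ
    qg x = q N (C m′ f x)
    expand : E (λ x → ½ * (qg x + qg (flipAt i x)) + (½ * bias f m i x + ½ * farBias f m i x))
      ≡ Φ m′ + (½ * E (bias f m i) + ½ * E (farBias f m i))
    expand = trans (E-+ (λ x → ½ * (qg x + qg (flipAt i x))) (λ x → ½ * bias f m i x + ½ * farBias f m i x))
      (cong₂ _+_
        (trans (E-* ½ (λ x → qg x + qg (flipAt i x)))
          (trans (cong (½ *_) (trans (E-+ qg (qg ∘ flipAt i)) (cong (λ z → E qg + z) (E-flip i qg)))) (½*p+p≡p (E qg))))
        (trans (E-+ (λ x → ½ * bias f m i x) (λ x → ½ * farBias f m i x))
          (cong₂ _+_ (E-* ½ (bias f m i)) (E-* ½ (farBias f m i)))))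

  Light Saturated : Mask n → Set
  Light m     = Ψ m + ½ * (½ * Σ∈ m (η f)) ≤ Ψ ∅
  Saturated m = ∀ i → lookup m i ≡ false → ½ * η f i ≤ E (farBias f m i)

  private
    -- Fixing `i` removes η i from the boundary sum, while `Φ-fix` lets Φ lose at most ½ η i + ½ · ½
    -- η i. The remaining ¼ η i is what `Light` records.
    light-fix : ∀ m i → lookup m i ≡ false → E (farBias f m i) ≤ ½ * η f i → Light m → Light (m [ i ]≔ true)
    light-fix m i free small = arith (Σ∉ m (η f)) (Σ∉ m′ (η f)) (Σ∈ m (η f)) (Σ∈ m′ (η f)) (Φ m) (Φ m′)
        (η f i) (E (farBias f m i)) (Ψ ∅)
        (Σ∉-fix m i (η f) free) (Σ∈-fix m i (η f) free) (Φ-fix m i free) small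
      where
      m′ = m [ i ]≔ true
      arith : ∀ s s′ t t′ p p′ e F r → s ≡ e + s′ → t′ ≡ t + e → p ≤ p′ + (½ * e + ½ * F) → F ≤ ½ * e →
        s - p + ½ * (½ * t) ≤ r → s′ - p′ + ½ * (½ * t′) ≤ r
      arith _ s′ t _ p p′ e F r refl refl p₁ p₂ p₃ = linear (p₁ ⊕ ½ ⊙ p₂ ⊕ p₃)
        (solve (s′ ∷ₗ t ∷ₗ p ∷ₗ p′ ∷ₗ e ∷ₗ F ∷ₗ r ∷ₗ []ₗ) ℚ-ring)

    grow : ∀ k m → #free m ≡ k → Light m → ∃ λ m → Light m × Saturated m
    grow k m eq light with Finₚ.any? (λ i → (lookup m i Boolₚ.≟ false) ×-dec (E (farBias f m i) ℚₚ.≤? ½ * η f i))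
    grow k m eq light | no none = m , light , λ i free → <⇒≤ (≰⇒> (λ small → none (i , free , small)))
    grow zero    m eq light | yes (i , free , small) with () ← trans (#free-fix m i free) eq
    grow (suc k) m eq light | yes (i , free , small) =
      grow k (m [ i ]≔ true) (ℕₚ.suc-injective (trans (#free-fix m i free) eq)) (light-fix m i free small light)

    Σ∈-∅ : ∀ {k} (g : Fin k → ℚ) → Σ∈ ∅ g ≡ 0ℚ
    Σ∈-∅ {zero}  g = refl
    Σ∈-∅ {suc k} g = trans (+-identityˡ (Σ∈ ∅ (g ∘ suc))) (Σ∈-∅ (g ∘ suc))

  saturated-mask : ∃ λ m → Light m × Saturated m
  saturated-mask = grow (#free {n} ∅) ∅ refl (≤-reflexive
    (trans (cong (λ z → Ψ ∅ + ½ * (½ * z)) (Σ∈-∅ (η f))) (eq (Ψ ∅))))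
    where
    eq : ∀ p → p + ½ * (½ * 0ℚ) ≡ p
    eq = solve-∀ ℚ-ring

-- Order statistics

-- The (k+1)-st largest value of g (0 if there is none).
kth : ℕ → ∀ {n} → (Fin n → ℚ) → ℚ
kth k       {zero}  g = 0ℚ
kth zero    {suc n} g = g zero ⊔ kth zero (g ∘ suc)
kth (suc k) {suc n} g = (g zero ⊓ kth k (g ∘ suc)) ⊔ kth (suc k) (g ∘ suc)

kth-cong : ∀ k {n} {g h : Fin n → ℚ} → (∀ i → g i ≡ h i) → kth k g ≡ kth k h
kth-cong k       {zero}  eq = refl
kth-cong zero    {suc n} eq = cong₂ _⊔_ (eq zero) (kth-cong zero (eq ∘ suc))
kth-cong (suc k) {suc n} eq =
  cong₂ _⊔_ (cong₂ _⊓_ (eq zero) (kth-cong k (eq ∘ suc))) (kth-cong (suc k) (eq ∘ suc))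

scaled-⊔-lub : ∀ c a b {z} → c * a ≤ z → c * b ≤ z → c * (a ⊔ b) ≤ z
scaled-⊔-lub c a b {z} p p′ with ⊔-sel a b
... | inj₁ eq = subst (λ s → c * s ≤ z) (sym eq) p
... | inj₂ eq = subst (λ s → c * s ≤ z) (sym eq) p′

scaled-⊔-mono : ∀ {c ε} a b a′ b′ → 0ℚ ≤ c → c * a ≤ c * a′ + ε → c * b ≤ c * b′ + ε →
  c * (a ⊔ b) ≤ c * (a′ ⊔ b′) + ε
scaled-⊔-mono {c} {ε} a b a′ b′ 0≤c p p′ = scaled-⊔-lub c a b
  (≤-trans p (+-monoˡ-≤ ε (0≤c ⊡ p≤p⊔q a′ b′)))
  (≤-trans p′ (+-monoˡ-≤ ε (0≤c ⊡ p≤q⊔p a′ b′)))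

scaled-⊓-mono : ∀ {c ε} a b a′ b′ → 0ℚ ≤ c → c * a ≤ c * a′ + ε → c * b ≤ c * b′ + ε →
  c * (a ⊓ b) ≤ c * (a′ ⊓ b′) + ε
scaled-⊓-mono {c} {ε} a b a′ b′ 0≤c p p′ with ⊓-sel a′ b′
... | inj₁ eq = subst (λ s → c * (a ⊓ b) ≤ c * s + ε) (sym eq) (≤-trans (0≤c ⊡ p⊓q≤p a b) p)
... | inj₂ eq = subst (λ s → c * (a ⊓ b) ≤ c * s + ε) (sym eq) (≤-trans (0≤c ⊡ p⊓q≤q a b) p′)

-- Order statistics are composed of minima and maxima, hence 1-Lipschitz in the supremum norm. The
-- factor `c` stays on both sides because in the application it is a density that may vanish.
kth-lipschitz : ∀ k {n} {g h : Fin n → ℚ} {c ε} → 0ℚ ≤ c → 0ℚ ≤ ε →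
  (∀ i → c * g i ≤ c * h i + ε) → c * kth k g ≤ c * kth k h + ε
kth-lipschitz k {zero} {c = c} {ε} 0≤c 0≤ε le =
  ≤-trans (≤-reflexive (sym (+-identityʳ (c * 0ℚ)))) (+-monoʳ-≤ (c * 0ℚ) 0≤ε)
kth-lipschitz zero {suc n} {g} {h} 0≤c 0≤ε le =
  scaled-⊔-mono (g zero) (kth zero (g ∘ suc)) (h zero) (kth zero (h ∘ suc)) 0≤c (le zero)
    (kth-lipschitz zero 0≤c 0≤ε (le ∘ suc))
kth-lipschitz (suc k) {suc n} {g} {h} 0≤c 0≤ε le =
  scaled-⊔-mono (g zero ⊓ kth k (g ∘ suc)) (kth (suc k) (g ∘ suc)) (h zero ⊓ kth k (h ∘ suc)) (kth (suc k) (h ∘ suc)) 0≤c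
    (scaled-⊓-mono (g zero) (kth k (g ∘ suc)) (h zero) (kth k (h ∘ suc)) 0≤c (le zero) (kth-lipschitz k 0≤c 0≤ε (le ∘ suc)))
    (kth-lipschitz (suc k) 0≤c 0≤ε (le ∘ suc))

kth-markov : ∀ k {n} {g : Fin n → ℚ} → (∀ i → 0ℚ ≤ g i) → fromℕ (suc k) * kth k g ≤ Σᶠ g
kth-markov k {zero} 0≤g = ≤-reflexive (*-zeroʳ (fromℕ (suc k)))
kth-markov zero {suc n} {g} 0≤g = scaled-⊔-lub (fromℕ 1) (g zero) (kth zero (g ∘ suc))
  (head (g zero) (Σᶠ (g ∘ suc)) (Σᶠ-nonNeg (0≤g ∘ suc)))
  (≤-trans (kth-markov zero (0≤g ∘ suc)) (tail (g zero) (Σᶠ (g ∘ suc)) (0≤g zero)))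
  where
  head : ∀ p s → 0ℚ ≤ s → fromℕ 1 * p ≤ p + s
  head p s 0≤s = linear 0≤s (solve (p ∷ₗ s ∷ₗ []ₗ) ℚ-ring)
  tail : ∀ p s → 0ℚ ≤ p → s ≤ p + s
  tail p s 0≤p = linear 0≤p (solve (p ∷ₗ s ∷ₗ []ₗ) ℚ-ring)
kth-markov (suc k) {suc n} {g} 0≤g =
  scaled-⊔-lub (fromℕ (suc (suc k))) (g zero ⊓ kth k (g ∘ suc)) (kth (suc k) (g ∘ suc))
    (both (g zero ⊓ kth k (g ∘ suc)) (g zero) (kth k (g ∘ suc)) (Σᶠ (g ∘ suc)) (fromℕ k) (fromℕ-nonNeg k)
      (p⊓q≤p (g zero) (kth k (g ∘ suc))) (p⊓q≤q (g zero) (kth k (g ∘ suc))) (kth-markov k (0≤g ∘ suc)))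
    (≤-trans (kth-markov (suc k) (0≤g ∘ suc)) (tail (g zero) (Σᶠ (g ∘ suc)) (0≤g zero)))
  where
  tail : ∀ p s → 0ℚ ≤ p → s ≤ p + s
  tail p s 0≤p = linear 0≤p (solve (p ∷ₗ s ∷ₗ []ₗ) ℚ-ring)
  both : ∀ r p p′ s k → 0ℚ ≤ k → r ≤ p → r ≤ p′ → (1ℚ + k) * p′ ≤ s → (1ℚ + (1ℚ + k)) * r ≤ p + s
  both r p p′ s k 0≤k r≤p r≤p′ le = linear (r≤p ⊕ r≤p′ ⊕ 0≤k ⊡ r≤p′ ⊕ le) (solve (r ∷ₗ p ∷ₗ p′ ∷ₗ s ∷ₗ k ∷ₗ []ₗ) ℚ-ring)

when-nonNeg : ∀ {p a b} → 0ℚ ≤ p → 0ℚ ≤ p when a < b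
when-nonNeg {p} {a} {b} 0≤p with when-cases p a b
... | inj₁ (_ , eq) = ≤-trans 0≤p (≤-reflexive (sym eq))
... | inj₂ (_ , eq) = ≤-reflexive (sym eq)

when≤ : ∀ {p a b} → 0ℚ ≤ p → p when a < b ≤ p
when≤ {p} {a} {b} 0≤p with when-cases p a b
... | inj₁ (_ , eq) = ≤-reflexive eq
... | inj₂ (_ , eq) = ≤-trans (≤-reflexive eq) 0≤p

when-≡0 : ∀ {p a b} → b ≤ a → p when a < b ≡ 0ℚ
when-≡0 {p} {a} {b} b≤a with when-cases p a b
... | inj₁ (a<b , _) = ⊥-elim (<-irrefl refl (<-≤-trans a<b b≤a))
... | inj₂ (_ , eq)  = eq

kth-count : ∀ k {n} {g : Fin n → ℚ} θ → kth k g ≤ θ → Σᶠ (λ i → 1ℚ when θ < g i) ≤ fromℕ k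
kth-count k       {zero}  θ le = fromℕ-nonNeg k
kth-count zero    {suc n} {g} θ le = ≤-trans
  (≤-reflexive (cong (λ z → z + Σᶠ (λ i → 1ℚ when θ < g (suc i))) (when-≡0 {1ℚ} (≤-trans (p≤p⊔q (g zero) (kth zero (g ∘ suc))) le))))
  (≤-trans (≤-reflexive (+-identityˡ (Σᶠ (λ i → 1ℚ when θ < g (suc i)))))
    (kth-count zero {g = g ∘ suc} θ (≤-trans (p≤q⊔p (g zero) (kth zero (g ∘ suc))) le)))
kth-count (suc k) {suc n} {g} θ le with ⊓-sel (g zero) (kth k (g ∘ suc))
... | inj₁ eq = ≤-trans
  (≤-reflexive (cong (λ z → z + Σᶠ (λ i → 1ℚ when θ < g (suc i)))
    (when-≡0 {1ℚ} (≤-trans (≤-reflexive (sym eq)) (≤-trans (p≤p⊔q _ (kth (suc k) (g ∘ suc))) le)))))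
  (≤-trans (≤-reflexive (+-identityˡ (Σᶠ (λ i → 1ℚ when θ < g (suc i)))))
    (kth-count (suc k) {g = g ∘ suc} θ (≤-trans (p≤q⊔p (g zero ⊓ kth k (g ∘ suc)) (kth (suc k) (g ∘ suc))) le)))
... | inj₂ eq = +-mono-≤ (when≤ {1ℚ} {θ} {g zero} 0≤1)
  (kth-count k {g = g ∘ suc} θ (≤-trans (≤-reflexive (sym eq)) (≤-trans (p≤p⊔q _ (kth (suc k) (g ∘ suc))) le)))

-- p / a, with value 0 when a = 0.
ratio : ℚ → ℚ → ℚ
ratio p a = go (a ℚₚ.≟ 0ℚ)
  where
  go : Dec (a ≡ 0ℚ) → ℚ
  go (yes _)   = 0ℚ
  go (no a≢0) = p * (1/ a) {{≢-nonZero a≢0}}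

-- The default value at a = 0 is consistent, since then `p ≤ a` forces p = 0.
ratio-spec : ∀ {p a} → 0ℚ ≤ p → p ≤ a → 0ℚ ≤ ratio p a × ratio p a ≤ 1ℚ × a * ratio p a ≡ p
ratio-spec {p} {a} 0≤p p≤a with a ℚₚ.≟ 0ℚ
... | yes refl = ≤-refl , 0≤1 , ≤-antisym 0≤p p≤a
... | no a≢0 = *-nonNeg 0≤p 0≤1/a , r≤1 , a*r≡p
  where
  instance
    a-nonZero = ≢-nonZero a≢0
  0<a : 0ℚ < a
  0<a = ≰⇒> (λ a≤0 → a≢0 (≤-antisym a≤0 (≤-trans 0≤p p≤a)))
  0≤1/a : 0ℚ ≤ 1/ a
  0≤1/a = <⇒≤ (*-cancelˡ-<-nonNeg a {{nonNegative (<⇒≤ 0<a)}}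
    (subst₂ _<_ (sym (*-zeroʳ a)) (sym (*-inverseʳ a)) (positive⁻¹ 1ℚ)))
  a*r≡p : a * (p * 1/ a) ≡ p
  a*r≡p = trans (eq a p (1/ a)) (trans (cong (p *_) (*-inverseʳ a)) (*-identityʳ p))
    where
    eq : ∀ a p r → a * (p * r) ≡ p * (a * r)
    eq = solve-∀ ℚ-ring
  r≤1 : p * 1/ a ≤ 1ℚ
  r≤1 = ≤-trans (*-monoʳ-≤-nonNeg (1/ a) {{nonNegative 0≤1/a}} p≤a) (≤-reflexive (*-inverseʳ a))

-- Concentration of biases

flip-comm : ∀ {n} (i j : Fin n) x → flipAt i (flipAt j x) ≡ flipAt j (flipAt i x)
flip-comm zero    zero    x       = refl
flip-comm zero    (suc j) (b ∷ x) = refl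
flip-comm (suc i) zero    (b ∷ x) = refl
flip-comm (suc i) (suc j) (b ∷ x) = cong (b ∷_) (flip-comm i j x)

bias-invariant : ∀ {n} (f : Cube n → ℚ) m i → FreeInvariant m (bias f m i)
bias-invariant f m i j free x with i Finₚ.≟ j
... | yes refl = D-flip i (C (m [ i ]≔ true) f) x
... | no i≢j = cong₂ (λ u v → ½ * ∣ u - v ∣) (C-inv x)
  (trans (cong (C (m [ i ]≔ true) f) (flip-comm i j x)) (C-inv (flipAt i x)))
  where
  free′ : lookup (m [ i ]≔ true) j ≡ false
  free′ = trans (Vecₚ.lookup∘updateAt′ j i (λ j≡i → i≢j (sym j≡i)) m) free
  C-inv : ∀ y → C (m [ i ]≔ true) f (flipAt j y) ≡ C (m [ i ]≔ true) f y
  C-inv = C-invariant (m [ i ]≔ true) f j free′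

-- Triangle inequality around the square spanned by directions `i` and `j`: one `i`-edge is reached
-- from the opposite one along the two `j`-edges.
D≤D+D+D : ∀ {n} i j (g : Cube n → ℚ) x → D i g x ≤ D i g (flipAt j x) + (D j g x + D j g (flipAt i x))
D≤D+D+D i j g x = ≤-trans
  (½ ⊙ triangle (g x) (g (flipAt i x)) (g (flipAt j x)) (g (flipAt i (flipAt j x))))
  (≤-reflexive (trans (distrib (∣ g (flipAt j x) - g (flipAt i (flipAt j x)) ∣) (∣ g x - g (flipAt j x) ∣)
      (∣ g (flipAt i x) - g (flipAt i (flipAt j x)) ∣))
    (cong (λ y → D i g (flipAt j x) + (D j g x + ½ * ∣ g (flipAt i x) - g y ∣)) (flip-comm i j x))))
  where
  distrib : ∀ a b c → ½ * (a + (b + c)) ≡ ½ * a + (½ * b + ½ * c)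
  distrib = solve-∀ ℚ-ring
  regroup : ∀ a b c d → (c - d) + ((a - c) + - (b - d)) ≡ a - b
  regroup = solve-∀ ℚ-ring
  triangle : ∀ a b c d → ∣ a - b ∣ ≤ ∣ c - d ∣ + (∣ a - c ∣ + ∣ b - d ∣)
  triangle a b c d = ≤-trans (≤-reflexive (cong ∣_∣ (sym (regroup a b c d))))
    (≤-trans (∣p+q∣≤∣p∣+∣q∣ (c - d) ((a - c) + - (b - d)))
      (+-monoʳ-≤ (∣ c - d ∣) (≤-trans (∣p+q∣≤∣p∣+∣q∣ (a - c) (- (b - d)))
        (+-monoʳ-≤ (∣ a - c ∣) (≤-reflexive (∣-p∣≡∣p∣ (b - d)))))))

-- The two `j`-edges of the square are charged to the boundary densities on the two halves of the
-- fibre. Their mean is `C m (D j f) x`, hence the factor 2.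
bias-lipschitz : ∀ {n} (f : Cube n → ℚ) m i j → lookup m i ≡ false → ∀ x →
  bias f m i x ≤ bias f m i (flipAt j x) + fromℕ 2 * C m (D j f) x
bias-lipschitz f m i j free x = ≤-trans (D≤D+D+D i j g x)
  (+-monoʳ-≤ (bias f m i (flipAt j x)) (≤-trans (D-C≤C-D j m′ f x ⊕ D-C≤C-D j m′ f (flipAt i x))
    (≤-reflexive (trans (unhalve (C m′ (D j f) x) (C m′ (D j f) (flipAt i x)))
      (cong (fromℕ 2 *_) (sym (C-split m i (D j f) free x)))))))
  where
  m′ = m [ i ]≔ true
  g = C m′ f
  unhalve : ∀ a b → a + b ≡ fromℕ 2 * (½ * (a + b))
  unhalve = solve-∀ ℚ-ring

-- Half of the cutoff ⅓ implicit in `farBias`: a far coordinate has relative bias g > ⅓, so that g -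
-- ⅙ ≥ ½ g.
⅙ : ℚ
⅙ = + 1 / 6

q-edge : ∀ {n} N (f : Cube n → ℚ) → (∀ x → 0ℚ ≤ f x) → q N (E f) ≤ E (q N ∘ f) + Σᶠ (η f)
q-edge {n} N f 0≤f = subst₂ _≤_ (cong (q N) (C-∅ f ∅)) (cong₂ _+_ (C-∅ (q N ∘ f) ∅) (Σᶠ-cong {n} term)) (q-C-edge N ∅ f 0≤f ∅)
  where
  lookup-∅ : ∀ {n} (i : Fin n) → lookup ∅ i ≡ false
  lookup-∅ zero    = refl
  lookup-∅ (suc i) = lookup-∅ i
  term : ∀ i → (if lookup ∅ i then 0ℚ else C ∅ (D i f) ∅) ≡ η f i
  term i = trans (cong (λ b → if b then 0ℚ else C ∅ (D i f) ∅) (lookup-∅ i)) (C-∅ (D i f) ∅)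

module Concentration {n : ℕ} (f : Cube n → ℚ) (f01 : IsBoolean f) (N : ℕ) (m : Mask n) (k : ℕ) where

  open Potential f f01 N

  a : Cube n → ℚ
  a = C m f

  0≤a : ∀ x → 0ℚ ≤ a x
  0≤a = C-nonNeg m 0≤f

  freeBias : Cube n → Fin n → ℚ
  freeBias x i = if lookup m i then 0ℚ else bias f m i x

  -- The relative bias of the free coordinates on the fibre through x.
  g : Cube n → Fin n → ℚ
  g x i = ratio (freeBias x i) (a x)

  private
    bias≤a : ∀ i x → lookup m i ≡ false → bias f m i x ≤ a x
    bias≤a i x free = ≤-trans (arith (C (m [ i ]≔ true) f x) (C (m [ i ]≔ true) f (flipAt i x))
        (C-nonNeg (m [ i ]≔ true) 0≤f x) (C-nonNeg (m [ i ]≔ true) 0≤f (flipAt i x)))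
      (≤-reflexive (sym (C-split m i f free x)))
      where
      left : ∀ u v → 0ℚ ≤ v → u - v ≤ u + v
      left u v 0≤v = linear (0≤v ⊕ 0≤v) (solve (u ∷ₗ v ∷ₗ []ₗ) ℚ-ring)
      right : ∀ u v → 0ℚ ≤ u → - (u - v) ≤ u + v
      right u v 0≤u = linear (0≤u ⊕ 0≤u) (solve (u ∷ₗ v ∷ₗ []ₗ) ℚ-ring)
      arith : ∀ u v → 0ℚ ≤ u → 0ℚ ≤ v → ½ * ∣ u - v ∣ ≤ ½ * (u + v)
      arith u v 0≤u 0≤v = ½ ⊙ ∣∣-lub (left u v 0≤v) (right u v 0≤u)

    freeBias-nonNeg : ∀ x i → 0ℚ ≤ freeBias x i
    freeBias-nonNeg x i = go (lookup m i)
      where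
      go : ∀ b → 0ℚ ≤ (if b then 0ℚ else bias f m i x)
      go true  = ≤-refl
      go false = bias-nonNeg f m i x

    freeBias≤a : ∀ x i → freeBias x i ≤ a x
    freeBias≤a x i = go (lookup m i) refl
      where
      go : ∀ b → lookup m i ≡ b → (if b then 0ℚ else bias f m i x) ≤ a x
      go true  _    = 0≤a x
      go false free = bias≤a i x free

    g-spec : ∀ x i → 0ℚ ≤ g x i × g x i ≤ 1ℚ × a x * g x i ≡ freeBias x i
    g-spec x i = ratio-spec (freeBias-nonNeg x i) (freeBias≤a x i)

    g-nonNeg : ∀ x i → 0ℚ ≤ g x i
    g-nonNeg x i = proj₁ (g-spec x i)

    g≤1 : ∀ x i → g x i ≤ 1ℚ
    g≤1 x i = proj₁ (proj₂ (g-spec x i))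

    a*g : ∀ x i → a x * g x i ≡ freeBias x i
    a*g x i = proj₂ (proj₂ (g-spec x i))

    g-invariant : ∀ i → FreeInvariant m (λ x → g x i)
    g-invariant i j free x = cong₂ ratio (cong (λ z → if lookup m i then 0ℚ else z) (bias-invariant f m i j free x))
      (C-invariant m f j free x)

  -- At most k coordinates of a fibre get positive weight w. Truncating at an order
  -- statistic, rather than discarding fibres with many biased coordinates, keeps w
  -- Lipschitz in g.
  θ : Cube n → ℚ
  θ x = ⅙ ⊔ kth k (g x)

  w : Cube n → Fin n → ℚ
  w x i = (g x i - θ x) ⊔ 0ℚ

  V : Cube n → ℚ
  V x = Σᶠ (w x)

  private
    θ-invariant : FreeInvariant m θ
    θ-invariant j free x = cong (λ z → ⅙ ⊔ z) (kth-cong k (λ i → g-invariant i j free x))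

    w-invariant : ∀ i → FreeInvariant m (λ x → w x i)
    w-invariant i j free x = cong₂ (λ p r → (p - r) ⊔ 0ℚ) (g-invariant i j free x) (θ-invariant j free x)

    V-invariant : FreeInvariant m V
    V-invariant j free x = Σᶠ-cong (λ i → w-invariant i j free x)

    0≤w : ∀ x i → 0ℚ ≤ w x i
    0≤w x i = p≤q⊔p (g x i - θ x) 0ℚ

    0≤θ : ∀ x → 0ℚ ≤ θ x
    0≤θ x = ≤-trans (nonNegative⁻¹ ⅙) (p≤p⊔q ⅙ (kth k (g x)))

    w≡0 : ∀ x i → g x i ≤ θ x → w x i ≡ 0ℚ
    w≡0 x i le = p≤q⇒p⊔q≡q (shift (g x i) (θ x) le)
      where
      shift : ∀ p r → p ≤ r → p - r ≤ 0ℚ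
      shift p r le = linear le (solve (p ∷ₗ r ∷ₗ []ₗ) ℚ-ring)

    w≤g : ∀ x i → w x i ≤ g x i
    w≤g x i = ⊔-lub (shift (g x i) (θ x) (0≤θ x)) (g-nonNeg x i)
      where
      shift : ∀ p r → 0ℚ ≤ r → p - r ≤ p
      shift p r le = linear le (solve (p ∷ₗ r ∷ₗ []ₗ) ℚ-ring)

    active : Cube n → Fin n → ℚ
    active x i = 1ℚ when θ x < g x i

    active-cases : ∀ x i → active x i ≡ 1ℚ ⊎ g x i ≤ θ x
    active-cases x i with when-cases 1ℚ (θ x) (g x i)
    ... | inj₁ (_ , eq) = inj₁ eq
    ... | inj₂ (le , _) = inj₂ le

    active-nonNeg : ∀ x i → 0ℚ ≤ active x i
    active-nonNeg x i = when-nonNeg {1ℚ} {θ x} {g x i} 0≤1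

    Σactive≤k : ∀ x → Σᶠ (active x) ≤ fromℕ k
    Σactive≤k x = kth-count k {g = g x} (θ x) (p≤q⊔p ⅙ (kth k (g x)))

    w≤active : ∀ x i → w x i ≤ active x i
    w≤active x i = go (active-cases x i)
      where
      go : active x i ≡ 1ℚ ⊎ g x i ≤ θ x → w x i ≤ active x i
      go (inj₁ eq) = ≤-trans (w≤g x i) (≤-trans (g≤1 x i) (≤-reflexive (sym eq)))
      go (inj₂ le) = ≤-trans (≤-reflexive (w≡0 x i le)) (active-nonNeg x i)

  V≤k : ∀ x → V x ≤ fromℕ k
  V≤k x = ≤-trans (Σᶠ-mono (w≤active x)) (Σactive≤k x)

  V-nonNeg : ∀ x → 0ℚ ≤ V x
  V-nonNeg x = Σᶠ-nonNeg (0≤w x)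

  -- These weighted copies of `f` play the role of the sets Wᵢ.
  W : Fin n → Cube n → ℚ
  W i x = f x * w x i

  W-nonNeg : ∀ i x → 0ℚ ≤ W i x
  W-nonNeg i x = *-nonNeg (0≤f x) (0≤w x i)

  -- `c j x` measures the direction-`j` edges at the fibre of `x` with both ends in the support of
  -- `f`. It is at most the density of either adjacent fibre, and it is the factor left over when
  -- fibre-constant functions are pulled out in `E-ff*U≤`, so Lipschitz bounds multiplied by it are
  -- just what is needed.
  c d : Fin n → Cube n → ℚ
  c j = C m (λ y → f y * f (flipAt j y))
  d j = C m (D j f)

  private
    c-nonNeg : ∀ j x → 0ℚ ≤ c j x
    c-nonNeg j = C-nonNeg m (λ y → *-nonNeg (0≤f y) (0≤f (flipAt j y)))

    d-nonNeg : ∀ j x → 0ℚ ≤ d j x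
    d-nonNeg j = C-nonNeg m (D-nonNeg j f)

    c-flip : ∀ j x → c j (flipAt j x) ≡ c j x
    c-flip j x = trans (sym (C-flip m j (λ y → f y * f (flipAt j y)) x))
      (C-cong m (λ y → trans (cong (λ z → f (flipAt j y) * f z) (flip-involutive j y)) (*-comm (f (flipAt j y)) (f y))) x)

    d-flip : ∀ j x → d j (flipAt j x) ≡ d j x
    d-flip j x = trans (sym (C-flip m j (D j f) x)) (C-cong m (D-flip j f) x)

    product≤left : ∀ {p r} → p ≡ 0ℚ ⊎ p ≡ 1ℚ → r ≡ 0ℚ ⊎ r ≡ 1ℚ → p * r ≤ p
    product≤left (inj₁ refl) (inj₁ refl) = ≤ᵇ⇒≤ _
    product≤left (inj₁ refl) (inj₂ refl) = ≤ᵇ⇒≤ _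
    product≤left (inj₂ refl) (inj₁ refl) = ≤ᵇ⇒≤ _
    product≤left (inj₂ refl) (inj₂ refl) = ≤ᵇ⇒≤ _

    right≤product : ∀ {p r} → p ≡ 0ℚ ⊎ p ≡ 1ℚ → r ≡ 0ℚ ⊎ r ≡ 1ℚ → r ≤ p * r + fromℕ 2 * (½ * ∣ p - r ∣)
    right≤product (inj₁ refl) (inj₁ refl) = ≤ᵇ⇒≤ _
    right≤product (inj₁ refl) (inj₂ refl) = ≤ᵇ⇒≤ _
    right≤product (inj₂ refl) (inj₁ refl) = ≤ᵇ⇒≤ _
    right≤product (inj₂ refl) (inj₂ refl) = ≤ᵇ⇒≤ _

    c≤a : ∀ j x → c j x ≤ a x
    c≤a j = C-mono m (λ y → product≤left (f01 y) (f01 (flipAt j y)))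

    c≤a-flip : ∀ j x → c j x ≤ a (flipAt j x)
    c≤a-flip j x = ≤-trans (≤-reflexive (sym (c-flip j x))) (c≤a j (flipAt j x))

    a-flip≤c+2d : ∀ j x → a (flipAt j x) ≤ c j x + fromℕ 2 * d j x
    a-flip≤c+2d j x = ≤-trans (≤-reflexive (sym (C-flip m j f x)))
      (≤-trans (C-mono m (λ y → right≤product (f01 y) (f01 (flipAt j y))) x)
        (≤-reflexive (trans (C-+ m (λ y → f y * f (flipAt j y)) (λ y → fromℕ 2 * D j f y) x)
          (cong (λ z → c j x + z) (C-* m (fromℕ 2) (D j f) x)))))

    freeBias-lipschitz : ∀ i j x → freeBias x i ≤ freeBias (flipAt j x) i + fromℕ 2 * d j x
    freeBias-lipschitz i j x = go (lookup m i) refl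
      where
      go : ∀ b → lookup m i ≡ b → (if b then 0ℚ else bias f m i x) ≤
        (if b then 0ℚ else bias f m i (flipAt j x)) + fromℕ 2 * d j x
      go true  _    = ≤-refl ⊕ *-nonNeg (fromℕ-nonNeg 2) (d-nonNeg j x)
      go false free = bias-lipschitz f m i j free x

    -- Crossing direction `j` changes the bias by at most 2d, and the density of the new fibre
    -- exceeds `c` by at most 2d. As relative biases are at most 1, the second effect costs another
    -- 2d.
    g-lipschitz : ∀ i j x → c j x * g x i ≤ c j x * g (flipAt j x) i + fromℕ 4 * d j x
    g-lipschitz i j x = arith (a x) (a (flipAt j x)) (g x i) (g (flipAt j x) i) (freeBias x i) (freeBias (flipAt j x) i)
      (c j x) (d j x) (a*g x i) (a*g (flipAt j x) i) (freeBias-lipschitz i j x) (c≤a j x) (c≤a-flip j x) (a-flip≤c+2d j x)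
      (g-nonNeg x i) (g≤1 (flipAt j x) i)
      where
      arith : ∀ a a′ b b′ β β′ c d → a * b ≡ β → a′ * b′ ≡ β′ → β ≤ β′ + fromℕ 2 * d → c ≤ a → c ≤ a′ →
        a′ ≤ c + fromℕ 2 * d → 0ℚ ≤ b → b′ ≤ 1ℚ → c * b ≤ c * b′ + fromℕ 4 * d
      arith a a′ b b′ _ _ c d refl refl p₁ p₂ p₃ p₄ p₅ p₆ = linear
        (*-nonNeg (p≤q⇒0≤q-p p₂) p₅ ⊕ *-nonNeg (p≤q⇒0≤q-p p₃) (p≤q⇒0≤q-p p₆) ⊕ p₁ ⊕ p₄)
        (solve (a ∷ₗ a′ ∷ₗ b ∷ₗ b′ ∷ₗ c ∷ₗ d ∷ₗ []ₗ) ℚ-ring)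

    g-lipschitz′ : ∀ i j x → c j x * g (flipAt j x) i ≤ c j x * g x i + fromℕ 4 * d j x
    g-lipschitz′ i j x = subst₂ _≤_ (cong (λ z → z * g (flipAt j x) i) (c-flip j x))
      (trans (cong (λ z → c j (flipAt j x) * g z i + fromℕ 4 * d j (flipAt j x)) (flip-involutive j x))
        (cong₂ (λ z z′ → z * g x i + fromℕ 4 * z′) (c-flip j x) (d-flip j x)))
      (g-lipschitz i j (flipAt j x))

    w-lipschitz : ∀ x y {r ε} → 0ℚ ≤ r → 0ℚ ≤ ε → (∀ i → r * g x i ≤ r * g y i + ε) → (∀ i → r * g y i ≤ r * g x i + ε) →
      ∀ i → r * w x i ≤ r * w y i + (ε + ε)
    w-lipschitz x y {r} {ε} 0≤r 0≤ε le ge i = scaled-⊔-mono (g x i - θ x) 0ℚ (g y i - θ y) 0ℚ 0≤r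
      (arith r (g x i) (g y i) (θ x) (θ y) ε (le i)
        (scaled-⊔-mono ⅙ (kth k (g y)) ⅙ (kth k (g x)) 0≤r (grow (r * ⅙) ε 0≤ε) (kth-lipschitz k 0≤r 0≤ε ge)))
      (grow (r * 0ℚ) (ε + ε) (0≤ε ⊕ 0≤ε))
      where
      grow : ∀ p e → 0ℚ ≤ e → p ≤ p + e
      grow p e 0≤e = linear 0≤e (solve (p ∷ₗ e ∷ₗ []ₗ) ℚ-ring)
      arith : ∀ r p p′ t t′ e → r * p ≤ r * p′ + e → r * t′ ≤ r * t + e → r * (p - t) ≤ r * (p′ - t′) + (e + e)
      arith r p p′ t t′ e h h′ = linear (h ⊕ h′) (solve (r ∷ₗ p ∷ₗ p′ ∷ₗ t ∷ₗ t′ ∷ₗ e ∷ₗ []ₗ) ℚ-ring)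

    -- The activity factor is what makes the sum over `i` affordable: at most `k` coordinates are
    -- active on each of the two fibres, so the sum costs 2k instead of n.
    ∣w-w∣≤active : ∀ x y {r ε} → 0ℚ ≤ r → 0ℚ ≤ ε → (∀ i → r * g x i ≤ r * g y i + ε) →
      (∀ i → r * g y i ≤ r * g x i + ε) → ∀ i → r * ∣ w x i - w y i ∣ ≤ (ε + ε) * (active x i + active y i)
    ∣w-w∣≤active x y {r} {ε} 0≤r 0≤ε le ge i = cases (active-cases x i) (active-cases y i)
      where
      scaled : ∀ r p p′ e → r * p ≤ r * p′ + e → r * p′ ≤ r * p + e → r * ∣ p - p′ ∣ ≤ e
      scaled r p p′ e h h′ = go (∣p∣≡p∨∣p∣≡-p (p - p′))
        where
        pos : ∀ r p p′ e → r * p ≤ r * p′ + e → r * (p - p′) ≤ e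
        pos r p p′ e h = linear h (solve (r ∷ₗ p ∷ₗ p′ ∷ₗ e ∷ₗ []ₗ) ℚ-ring)
        neg : ∀ r p p′ e → r * p′ ≤ r * p + e → r * (- (p - p′)) ≤ e
        neg r p p′ e h = linear h (solve (r ∷ₗ p ∷ₗ p′ ∷ₗ e ∷ₗ []ₗ) ℚ-ring)
        go : ∣ p - p′ ∣ ≡ p - p′ ⊎ ∣ p - p′ ∣ ≡ - (p - p′) → r * ∣ p - p′ ∣ ≤ e
        go (inj₁ eq) = ≤-trans (≤-reflexive (cong (r *_) eq)) (pos r p p′ e h)
        go (inj₂ eq) = ≤-trans (≤-reflexive (cong (r *_) eq)) (neg r p p′ e h′)
      bound : r * ∣ w x i - w y i ∣ ≤ ε + ε
      bound = scaled r (w x i) (w y i) (ε + ε) (w-lipschitz x y 0≤r 0≤ε le ge i) (w-lipschitz y x 0≤r 0≤ε ge le i)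
      left : ∀ e s s′ → 0ℚ ≤ e → s ≡ 1ℚ → 0ℚ ≤ s′ → e ≤ e * (s + s′)
      left e _ s′ 0≤e refl 0≤s′ = linear (*-nonNeg 0≤e 0≤s′) (solve (e ∷ₗ s′ ∷ₗ []ₗ) ℚ-ring)
      right : ∀ e s s′ → 0ℚ ≤ e → 0ℚ ≤ s → s′ ≡ 1ℚ → e ≤ e * (s + s′)
      right e s _ 0≤e 0≤s refl = linear (*-nonNeg 0≤e 0≤s) (solve (e ∷ₗ s ∷ₗ []ₗ) ℚ-ring)
      vanish : ∀ p p′ → p ≡ 0ℚ → p′ ≡ 0ℚ → r * ∣ p - p′ ∣ ≡ 0ℚ
      vanish _ _ refl refl = *-zeroʳ r
      0≤2ε : 0ℚ ≤ ε + ε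
      0≤2ε = 0≤ε ⊕ 0≤ε
      cases : active x i ≡ 1ℚ ⊎ g x i ≤ θ x → active y i ≡ 1ℚ ⊎ g y i ≤ θ y →
        r * ∣ w x i - w y i ∣ ≤ (ε + ε) * (active x i + active y i)
      cases (inj₁ eq) _ = ≤-trans bound (left (ε + ε) (active x i) (active y i) 0≤2ε eq (active-nonNeg y i))
      cases (inj₂ _) (inj₁ eq) = ≤-trans bound (right (ε + ε) (active x i) (active y i) 0≤2ε (active-nonNeg x i) eq)
      cases (inj₂ gx≤θ) (inj₂ gy≤θ) = ≤-trans (≤-reflexive (vanish (w x i) (w y i) (w≡0 x i gx≤θ) (w≡0 y i gy≤θ)))
        (*-nonNeg 0≤2ε (active-nonNeg x i ⊕ active-nonNeg y i))

  U : Fin n → Cube n → ℚ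
  U j x = Σᶠ (λ i → ∣ w x i - w (flipAt j x) i ∣)

  private
    c*U≤ : ∀ j x → c j x * U j x ≤ fromℕ 16 * fromℕ k * d j x
    c*U≤ j x = ≤-trans (≤-reflexive (sym (Σᶠ-* (c j x) (λ i → ∣ w x i - w (flipAt j x) i ∣))))
      (≤-trans (Σᶠ-mono (∣w-w∣≤active x (flipAt j x) (c-nonNeg j x) (*-nonNeg (fromℕ-nonNeg 4) (d-nonNeg j x))
          (λ i → g-lipschitz i j x) (λ i → g-lipschitz′ i j x)))
        (≤-trans (≤-reflexive (trans (Σᶠ-* (ε + ε) (λ i → active x i + active (flipAt j x) i))
            (cong ((ε + ε) *_) (Σᶠ-+ (active x) (active (flipAt j x))))))
          (arith (Σᶠ (active x)) (Σᶠ (active (flipAt j x))) (fromℕ k) (d j x) (d-nonNeg j x) (Σactive≤k x) (Σactive≤k (flipAt j x)))))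
      where
      ε = fromℕ 4 * d j x
      arith : ∀ s s′ k d → 0ℚ ≤ d → s ≤ k → s′ ≤ k → (fromℕ 4 * d + fromℕ 4 * d) * (s + s′) ≤ fromℕ 16 * k * d
      arith s s′ k d 0≤d p p′ = linear (fromℕ 8 ⊙ 0≤d ⊡ (p ⊕ p′)) (solve (s ∷ₗ s′ ∷ₗ k ∷ₗ d ∷ₗ []ₗ) ℚ-ring)

    U-invariant : ∀ j → FreeInvariant m (U j)
    U-invariant j l free x = Σᶠ-cong (λ i → cong₂ (λ p r → ∣ p - r ∣) (w-invariant i l free x)
      (trans (cong (λ y → w y i) (flip-comm j l x)) (w-invariant i l free (flipAt j x))))

    E-ff*U≤ : ∀ j → E (λ x → f x * f (flipAt j x) * U j x) ≤ fromℕ 16 * fromℕ k * η f j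
    E-ff*U≤ j = ≤-trans (≤-reflexive (E-pull-out m (λ x → f x * f (flipAt j x)) (U j) (U-invariant j)))
      (≤-trans (E-mono (c*U≤ j)) (≤-reflexive (trans (E-* (fromℕ 16 * fromℕ k) (d j))
        (cong (fromℕ 16 * fromℕ k *_) (E-C m (D j f))))))

    -- The first term accounts for edges leaving the support of `f`, the second for edges inside it
    -- along which the weight varies.
    boolean-product-rule : ∀ {p p′} r r′ → p ≡ 0ℚ ⊎ p ≡ 1ℚ → p′ ≡ 0ℚ ⊎ p′ ≡ 1ℚ → 0ℚ ≤ r → 0ℚ ≤ r′ →
      ∣ p * r - p′ * r′ ∣ ≤ ∣ p - p′ ∣ * (r + r′) + p * p′ * ∣ r - r′ ∣
    boolean-product-rule {p} {p′} r r′ p01 p′01 0≤r 0≤r′ = ∣∣-lub (one-sided r r′ (∣ r - r′ ∣) p01 p′01 0≤r 0≤r′ (p≤∣p∣ (r - r′)))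
      (subst₂ _≤_ (swap (p′ * r′) (p * r)) (cong₂ _+_ (cong₂ _*_ (∣p-q∣≡∣q-p∣ p′ p) (+-comm r′ r))
          (cong₂ _*_ (*-comm p′ p) (∣p-q∣≡∣q-p∣ r′ r)))
        (one-sided r′ r (∣ r′ - r ∣) p′01 p01 0≤r′ 0≤r (p≤∣p∣ (r′ - r))))
      where
      swap : ∀ s t → s - t ≡ - (t - s)
      swap = solve-∀ ℚ-ring
      one-sided : ∀ {p p′} r r′ z → p ≡ 0ℚ ⊎ p ≡ 1ℚ → p′ ≡ 0ℚ ⊎ p′ ≡ 1ℚ → 0ℚ ≤ r → 0ℚ ≤ r′ → r - r′ ≤ z →
        p * r - p′ * r′ ≤ ∣ p - p′ ∣ * (r + r′) + p * p′ * z
      one-sided r r′ z (inj₁ refl) (inj₁ refl) _ _ _ = linear (≤-refl {0ℚ}) (solve (r ∷ₗ r′ ∷ₗ z ∷ₗ []ₗ) ℚ-ring)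
      one-sided r r′ z (inj₁ refl) (inj₂ refl) h h′ _ = linear (h ⊕ h′ ⊕ h′) (solve (r ∷ₗ r′ ∷ₗ z ∷ₗ []ₗ) ℚ-ring)
      one-sided r r′ z (inj₂ refl) (inj₁ refl) h h′ _ = linear h′ (solve (r ∷ₗ r′ ∷ₗ z ∷ₗ []ₗ) ℚ-ring)
      one-sided r r′ z (inj₂ refl) (inj₂ refl) _ _ h = linear h (solve (r ∷ₗ r′ ∷ₗ z ∷ₗ []ₗ) ℚ-ring)

  ΣηW : Fin n → ℚ
  ΣηW j = Σᶠ (λ i → η (W i) j)

  -- 10 = 2 + 8: at a boundary edge of `f` the weights of both ends add up to at most 2k, and the
  -- edges inside the support contribute half of the 16k in `E-ff*U≤`.
  ΣηW-fixed : ∀ j → ΣηW j ≤ fromℕ 10 * fromℕ k * η f j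
  ΣηW-fixed j = ≤-trans (≤-reflexive (sym (E-Σᶠ (λ i → D j (W i)))))
    (≤-trans (E-mono pointwise) (≤-trans (≤-reflexive expand)
      (arith (η f j) (fromℕ k) (E (λ x → f x * f (flipAt j x) * U j x)) (E-ff*U≤ j))))
    where
    F : Cube n → ℚ
    F x = f x * f (flipAt j x) * U j x
    pointwise : ∀ x → Σᶠ (λ i → D j (W i) x) ≤ fromℕ 2 * fromℕ k * D j f x + ½ * F x
    pointwise x = ≤-trans (Σᶠ-mono (λ i → ½ ⊙ boolean-product-rule (w x i) (w (flipAt j x) i) (f01 x) (f01 (flipAt j x))
        (0≤w x i) (0≤w (flipAt j x) i)))
      (≤-trans (≤-reflexive sum) (arith (∣ f x - f (flipAt j x) ∣) (V x) (V (flipAt j x)) (fromℕ k) (F x)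
        (0≤∣p∣ (f x - f (flipAt j x))) (V≤k x) (V≤k (flipAt j x))))
      where
      e = ∣ f x - f (flipAt j x) ∣
      s = f x * f (flipAt j x)
      sum : Σᶠ (λ i → ½ * (e * (w x i + w (flipAt j x) i) + s * ∣ w x i - w (flipAt j x) i ∣)) ≡
        ½ * (e * (V x + V (flipAt j x)) + F x)
      sum = trans (Σᶠ-* ½ (λ i → e * (w x i + w (flipAt j x) i) + s * ∣ w x i - w (flipAt j x) i ∣)) (cong (½ *_)
        (trans (Σᶠ-+ (λ i → e * (w x i + w (flipAt j x) i)) (λ i → s * ∣ w x i - w (flipAt j x) i ∣))
          (cong₂ _+_ (trans (Σᶠ-* e (λ i → w x i + w (flipAt j x) i)) (cong (e *_) (Σᶠ-+ (w x) (w (flipAt j x)))))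
            (Σᶠ-* s (λ i → ∣ w x i - w (flipAt j x) i ∣)))))
      arith : ∀ e v v′ k F → 0ℚ ≤ e → v ≤ k → v′ ≤ k → ½ * (e * (v + v′) + F) ≤ fromℕ 2 * k * (½ * e) + ½ * F
      arith e v v′ k F 0≤e p p′ = linear (½ ⊙ 0≤e ⊡ (p ⊕ p′)) (solve (e ∷ₗ v ∷ₗ v′ ∷ₗ k ∷ₗ F ∷ₗ []ₗ) ℚ-ring)
    expand : E (λ x → fromℕ 2 * fromℕ k * D j f x + ½ * F x) ≡ fromℕ 2 * fromℕ k * η f j + ½ * E F
    expand = trans (E-+ (λ x → fromℕ 2 * fromℕ k * D j f x) (λ x → ½ * F x))
      (cong₂ _+_ (E-* (fromℕ 2 * fromℕ k) (D j f)) (E-* ½ F))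
    arith : ∀ h k z → z ≤ fromℕ 16 * k * h → fromℕ 2 * k * h + ½ * z ≤ fromℕ 10 * k * h
    arith h k z p = linear (½ ⊙ p) (solve (h ∷ₗ k ∷ₗ z ∷ₗ []ₗ) ℚ-ring)

  -- Flipping a free coordinate leaves the weights unchanged, so in this direction `W i` has
  -- boundary only where `f` has.
  ΣηW-free : ∀ j → lookup m j ≡ false → ΣηW j ≡ E (λ x → d j x * V x)
  ΣηW-free j free = trans (sym (E-Σᶠ (λ i → D j (W i)))) (trans (E-cong pointwise) (E-pull-out m (D j f) V V-invariant))
    where
    factor : ∀ i x → D j (W i) x ≡ D j f x * w x i
    factor i x = trans (cong (λ z → ½ * ∣ f x * w x i - f (flipAt j x) * z ∣) (w-invariant i j free x))
      (trans (cong (λ z → ½ * ∣ z ∣) (distrib (f x) (f (flipAt j x)) (w x i)))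
        (trans (cong (½ *_) (trans (∣p*q∣≡∣p∣*∣q∣ (f x - f (flipAt j x)) (w x i))
            (cong (∣ f x - f (flipAt j x) ∣ *_) (0≤p⇒∣p∣≡p (0≤w x i)))))
          (sym (*-assoc ½ ∣ f x - f (flipAt j x) ∣ (w x i)))))
      where
      distrib : ∀ a b c → a * c - b * c ≡ (a - b) * c
      distrib = solve-∀ ℚ-ring
    pointwise : ∀ x → Σᶠ (λ i → D j (W i) x) ≡ D j f x * V x
    pointwise x = trans (Σᶠ-cong (λ i → factor i x)) (Σᶠ-* (D j f x) (w x))

  v : ℚ
  v = E (λ x → a x * V x)

  private
    Σ∈-ΣηW : Σ∈ m ΣηW ≤ fromℕ 10 * fromℕ k * Σ∈ m (η f)
    Σ∈-ΣηW = ≤-trans (Σ∈-mono m ΣηW-fixed) (≤-reflexive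
      (trans (Σᶠ-cong (λ i → push (lookup m i) (η f i))) (Σᶠ-* (fromℕ 10 * fromℕ k) (λ i → if lookup m i then η f i else 0ℚ))))
      where
      push : ∀ b p → (if b then fromℕ 10 * fromℕ k * p else 0ℚ) ≡ fromℕ 10 * fromℕ k * (if b then p else 0ℚ)
      push true  p = refl
      push false p = sym (*-zeroʳ (fromℕ 10 * fromℕ k))

    Σ∉-ΣηW : Σ∉ m ΣηW ≡ E (λ x → J f m x * V x)
    Σ∉-ΣηW = trans (Σᶠ-cong (λ j → push (lookup m j) j refl)) (trans
      (sym (E-Σᶠ (λ j x → (if lookup m j then 0ℚ else d j x) * V x)))
      (E-cong (λ x → trans (Σᶠ-cong (λ j → *-comm (if lookup m j then 0ℚ else d j x) (V x)))
        (trans (Σᶠ-* (V x) (λ j → if lookup m j then 0ℚ else d j x)) (*-comm (V x) (J f m x))))))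
      where
      push : ∀ b j → lookup m j ≡ b → (if b then 0ℚ else ΣηW j) ≡ E (λ x → (if b then 0ℚ else d j x) * V x)
      push true  j _    = sym (trans (E-cong (λ x → *-zeroˡ (V x))) (E-const n 0ℚ))
      push false j free = ΣηW-free j free

    -- Split J into J - q and q. The excess J - q is nonnegative, so V ≤ k bounds its share by k Ψ;
    -- the share of q is bounded by the affine estimate `q-upper` at scale `t`.
    E-JV≤ : ∀ t → E (λ x → J f m x * V x) ≤ fromℕ k * Ψ m + (fromℕ t - 1ℚ) * v + fromℕ k * ½ ^ℚ t
    E-JV≤ t = ≤-trans (E-mono (λ x → arith (J f m x) (q N (a x)) (a x) (V x) (fromℕ k) (fromℕ t) (½ ^ℚ t)
        (q≤J m x) (V-nonNeg x) (V≤k x) (q-upper N t (0≤a x)) (½^-nonNeg t)))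
      (≤-reflexive expand)
      where
      arith : ∀ j q a V k t h → q ≤ j → 0ℚ ≤ V → V ≤ k → q ≤ (t - 1ℚ) * a + h → 0ℚ ≤ h →
        j * V ≤ k * (j - q) + (t - 1ℚ) * (a * V) + k * h
      arith j q a V k t h p₁ p₂ p₃ p₄ p₅ = linear
        (*-nonNeg (p≤q⇒0≤q-p p₁) (p≤q⇒0≤q-p p₃) ⊕ p₂ ⊡ p₄ ⊕ *-nonNeg p₅ (p≤q⇒0≤q-p p₃))
        (solve (j ∷ₗ q ∷ₗ a ∷ₗ V ∷ₗ k ∷ₗ t ∷ₗ h ∷ₗ []ₗ) ℚ-ring)
      expand : E (λ x → fromℕ k * (J f m x - q N (a x)) + (fromℕ t - 1ℚ) * (a x * V x) + fromℕ k * ½ ^ℚ t) ≡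
        fromℕ k * Ψ m + (fromℕ t - 1ℚ) * v + fromℕ k * ½ ^ℚ t
      expand = trans (E-+ (λ x → fromℕ k * (J f m x - q N (a x)) + (fromℕ t - 1ℚ) * (a x * V x)) (λ _ → fromℕ k * ½ ^ℚ t))
        (cong₂ _+_
          (trans (E-+ (λ x → fromℕ k * (J f m x - q N (a x))) (λ x → (fromℕ t - 1ℚ) * (a x * V x)))
            (cong₂ _+_
              (trans (E-* (fromℕ k) (λ x → J f m x - q N (a x))) (cong (fromℕ k *_)
                (trans (E-- (J f m) (λ x → q N (a x))) (cong (_- Φ m) (E-J f m)))))
              (E-* (fromℕ t - 1ℚ) (λ x → a x * V x))))
          (E-const n (fromℕ k * ½ ^ℚ t)))

    fg : Fin n → Cube n → ℚ
    fg i x = f x * g x i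

    E-fg≤η : ∀ i → E (fg i) ≤ η f i
    E-fg≤η i = ≤-trans (≤-reflexive (trans (E-pull-out m f (λ x → g x i) (g-invariant i)) (E-cong (λ x → a*g x i))))
      (≤-trans (E-mono (λ x → go (lookup m i) x)) (E-bias≤η f m i))
      where
      go : ∀ b x → (if b then 0ℚ else bias f m i x) ≤ bias f m i x
      go true  x = bias-nonNeg f m i x
      go false x = ≤-refl

    E-W≤η : ∀ i → E (W i) ≤ η f i
    E-W≤η i = ≤-trans (E-mono (λ x → 0≤f x ⊡ w≤g x i)) (E-fg≤η i)

    -- Wherever the weight is nonzero, g ≥ ⅙, and hence q ≤ ½ ≤ 3g. This charges the entropy of the
    -- values of `W i` to the bias, whose mean is at most η.
    E-q∘W≤ : ∀ i → E (q N ∘ W i) ≤ fromℕ 3 * η f i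
    E-q∘W≤ i = ≤-trans (E-mono (λ x → pointwise (w x i) (g x i) (f01 x) (0≤w x i) (support x) (g-nonNeg x i)))
      (≤-trans (≤-reflexive (E-* (fromℕ 3) (fg i))) (fromℕ-nonNeg 3 ⊡ E-fg≤η i))
      where
      support : ∀ x → w x i ≡ 0ℚ ⊎ ⅙ ≤ g x i
      support x with ≤-total (g x i) (θ x)
      ... | inj₁ g≤θ = inj₁ (w≡0 x i g≤θ)
      ... | inj₂ θ≤g = inj₂ (≤-trans (p≤p⊔q ⅙ (kth k (g x))) θ≤g)
      pointwise : ∀ {p} w g → p ≡ 0ℚ ⊎ p ≡ 1ℚ → 0ℚ ≤ w → w ≡ 0ℚ ⊎ ⅙ ≤ g → 0ℚ ≤ g → q N (p * w) ≤ fromℕ 3 * (p * g)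
      pointwise w g (inj₁ refl) _ _ _ = ≤-trans (≤-reflexive (trans (cong (q N) (*-zeroˡ w)) (q-zero N)))
        (≤-reflexive (sym (trans (cong (fromℕ 3 *_) (*-zeroˡ g)) (*-zeroʳ (fromℕ 3)))))
      pointwise .0ℚ g (inj₂ refl) _ (inj₁ refl) 0≤g = ≤-trans (≤-reflexive (q-zero N))
        (*-nonNeg (fromℕ-nonNeg 3) (*-nonNeg 0≤1 0≤g))
      pointwise w g (inj₂ refl) 0≤w (inj₂ ⅙≤g) _ = ≤-trans (≤-reflexive (cong (q N) (*-identityˡ w)))
        (≤-trans (q-upper N 1 0≤w) (≤-trans (≤-reflexive (eq w)) (linear (fromℕ 3 ⊙ ⅙≤g) (solve (g ∷ₗ []ₗ) ℚ-ring))))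
        where
        eq : ∀ w → (fromℕ 1 - 1ℚ) * w + ½ ^ℚ 1 ≡ ½
        eq = solve-∀ ℚ-ring

    Σ-E-W : Σᶠ (λ i → E (W i)) ≡ v
    Σ-E-W = trans (sym (E-Σᶠ W)) (trans (E-cong (λ x → Σᶠ-* (f x) (w x))) (E-pull-out m f V V-invariant))

  -- q-edge applied to every W i and summed: their densities are below 2⁻ˢ, whereas
  -- boundary edges of W i are either boundary edges of f or lie in fixed directions.
  v-upper : ∀ S t → S ℕ.≤ N → (∀ i → η f i ≤ ½ ^ℚ S) →
    (fromℕ S - 1ℚ) * v ≤ fromℕ 3 * Σᶠ (η f) +
      ((fromℕ k * Ψ m + (fromℕ t - 1ℚ) * v + fromℕ k * ½ ^ℚ t) + fromℕ 10 * fromℕ k * Σ∈ m (η f))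
  v-upper S t S≤N small = ≤-trans (≤-reflexive lhs) (≤-trans (Σᶠ-mono each) (≤-trans (≤-reflexive rhs)
    (+-monoʳ-≤ (fromℕ 3 * Σᶠ (η f)) (≤-trans (≤-reflexive total) (E-JV≤ t ⊕ Σ∈-ΣηW)))))
    where
    each : ∀ i → (fromℕ S - 1ℚ) * E (W i) ≤ fromℕ 3 * η f i + Σᶠ (η (W i))
    each i = ≤-trans (q-lower S S≤N (E-nonNeg (W-nonNeg i)) (≤-trans (E-W≤η i) (small i)))
      (≤-trans (q-edge N (W i) (W-nonNeg i)) (+-monoˡ-≤ (Σᶠ (η (W i))) (E-q∘W≤ i)))
    lhs : (fromℕ S - 1ℚ) * v ≡ Σᶠ (λ i → (fromℕ S - 1ℚ) * E (W i))
    lhs = trans (cong ((fromℕ S - 1ℚ) *_) (sym Σ-E-W)) (sym (Σᶠ-* (fromℕ S - 1ℚ) (λ i → E (W i))))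
    rhs : Σᶠ (λ i → fromℕ 3 * η f i + Σᶠ (η (W i))) ≡ fromℕ 3 * Σᶠ (η f) + Σᶠ ΣηW
    rhs = trans (Σᶠ-+ (λ i → fromℕ 3 * η f i) (λ i → Σᶠ (η (W i))))
      (cong₂ _+_ (Σᶠ-* (fromℕ 3) (η f)) (Σᶠ-swap (λ i → η (W i))))
    total : Σᶠ ΣηW ≡ E (λ x → J f m x * V x) + Σ∈ m ΣηW
    total = trans (sym (Σ∈+Σ∉ m ΣηW)) (trans (+-comm (Σ∈ m ΣηW) (Σ∉ m ΣηW)) (cong (_+ Σ∈ m ΣηW) Σ∉-ΣηW))

  private
    Σ-freeBias : ∀ x → a x * Σᶠ (g x) ≡ Σᶠ (freeBias x)
    Σ-freeBias x = trans (sym (Σᶠ-* (a x) (g x))) (Σᶠ-cong (a*g x))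

    Σ-freeBias≤J : ∀ x → Σᶠ (freeBias x) ≤ J f m x
    Σ-freeBias≤J x = Σᶠ-mono (λ i → go (lookup m i) i refl)
      where
      go : ∀ b i → lookup m i ≡ b → (if b then 0ℚ else bias f m i x) ≤ (if b then 0ℚ else C m (D i f) x)
      go true  i _    = ≤-refl
      go false i free = bias≤C-D f m i free x

    freeFarBias : Cube n → Fin n → ℚ
    freeFarBias x i = if lookup m i then 0ℚ else farBias f m i x

    freeFarBias≤freeBias : ∀ x i → freeFarBias x i ≤ freeBias x i
    freeFarBias≤freeBias x i = if-mono (lookup m i) ≤-refl (when≤ {bias f m i x} {a x} {fromℕ 3 * bias f m i x} (bias-nonNeg f m i x))

    freeFarBias≤2aw : ∀ x i → θ x ≡ ⅙ → freeFarBias x i ≤ fromℕ 2 * (a x * w x i)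
    freeFarBias≤2aw x i θ≡⅙ = go (lookup m i) refl (when-cases (bias f m i x) (a x) (fromℕ 3 * bias f m i x))
      where
      0≤aw : 0ℚ ≤ fromℕ 2 * (a x * w x i)
      0≤aw = *-nonNeg (fromℕ-nonNeg 2) (*-nonNeg (0≤a x) (0≤w x i))
      g-⅙≤w : g x i - ⅙ ≤ w x i
      g-⅙≤w = ≤-trans (≤-reflexive (cong (λ z → g x i - z) (sym θ≡⅙))) (p≤p⊔q (g x i - θ x) 0ℚ)
      arith : ∀ a b g w → a * g ≡ b → a < fromℕ 3 * b → g - ⅙ ≤ w → 0ℚ ≤ a → b ≤ fromℕ 2 * (a * w)
      arith a _ g w refl p p′ p″ = linear ((+ 1 / 3) ⊙ <⇒≤ p ⊕ fromℕ 2 ⊙ p″ ⊡ p′) (solve (a ∷ₗ g ∷ₗ w ∷ₗ []ₗ) ℚ-ring)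
      go : ∀ b → lookup m i ≡ b →
        (a x < fromℕ 3 * bias f m i x × farBias f m i x ≡ bias f m i x) ⊎ (fromℕ 3 * bias f m i x ≤ a x × farBias f m i x ≡ 0ℚ) →
        (if b then 0ℚ else farBias f m i x) ≤ fromℕ 2 * (a x * w x i)
      go true  _ _                = 0≤aw
      go false _ (inj₂ (_ , eq))  = ≤-trans (≤-reflexive eq) 0≤aw
      go false free (inj₁ (far , eq)) = ≤-trans (≤-reflexive eq) (arith (a x) (bias f m i x) (g x i) (w x i)
        (trans (a*g x i) (cong (λ b → if b then 0ℚ else bias f m i x) free)) far g-⅙≤w (0≤a x))

    -- If the order statistic is at most ⅙, then θ = ⅙ and the weights dominate the far biases.
    -- Otherwise k + 1 coordinates have relative bias at least ⅙ and force J ≥ (k + 1) a / 6 ≥ 2 (t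
    -- - 1) a, twice the entropy up to 2⁻ᵗ. Then J is at most twice the excess plus 2 · 2⁻ᵗ, and J
    -- bounds the far biases. The 12 is 2 · 6.
    Σ-freeFarBias≤ : ∀ t → fromℕ 12 * (fromℕ t - 1ℚ) ≤ fromℕ (suc k) → ∀ x →
      Σᶠ (freeFarBias x) ≤ fromℕ 2 * (a x * V x) + fromℕ 2 * (J f m x - q N (a x)) + fromℕ 2 * ½ ^ℚ t
    Σ-freeFarBias≤ t t≤k x = go (≤-total (kth k (g x)) ⅙)
      where
      few : ∀ s aV j q h → s ≤ fromℕ 2 * aV → q ≤ j → 0ℚ ≤ h → s ≤ fromℕ 2 * aV + fromℕ 2 * (j - q) + fromℕ 2 * h
      few s aV j q h p₁ p₂ p₃ = linear (p₁ ⊕ fromℕ 2 ⊙ p₂ ⊕ fromℕ 2 ⊙ p₃) (solve (s ∷ₗ aV ∷ₗ j ∷ₗ q ∷ₗ h ∷ₗ []ₗ) ℚ-ring)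
      many : ∀ s aV j q h a t k κ G → s ≤ j → 0ℚ ≤ aV → q ≤ (t - 1ℚ) * a + h → 0ℚ ≤ a → fromℕ 12 * (t - 1ℚ) ≤ k →
        0ℚ ≤ k → ⅙ ≤ κ → k * κ ≤ G → a * G ≤ j → s ≤ fromℕ 2 * aV + fromℕ 2 * (j - q) + fromℕ 2 * h
      many s aV j q h a t k κ G p₁ p₂ p₃ p₄ p₅ p₆ p₇ p₈ p₉ = linear
        (p₁ ⊕ fromℕ 2 ⊙ p₂ ⊕ fromℕ 2 ⊙ p₃ ⊕ ⅙ ⊙ p₄ ⊡ p₅ ⊕ *-nonNeg p₄ p₆ ⊡ p₇ ⊕ p₄ ⊡ p₈ ⊕ p₉)
        (solve (s ∷ₗ aV ∷ₗ j ∷ₗ q ∷ₗ h ∷ₗ a ∷ₗ t ∷ₗ k ∷ₗ κ ∷ₗ G ∷ₗ []ₗ) ℚ-ring)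
      go : kth k (g x) ≤ ⅙ ⊎ ⅙ ≤ kth k (g x) →
        Σᶠ (freeFarBias x) ≤ fromℕ 2 * (a x * V x) + fromℕ 2 * (J f m x - q N (a x)) + fromℕ 2 * ½ ^ℚ t
      go (inj₁ le) = few (Σᶠ (freeFarBias x)) (a x * V x) (J f m x) (q N (a x)) (½ ^ℚ t)
        (≤-trans (Σᶠ-mono (λ i → freeFarBias≤2aw x i (p≥q⇒p⊔q≡p le)))
          (≤-reflexive (trans (Σᶠ-* (fromℕ 2) (λ i → a x * w x i)) (cong (fromℕ 2 *_) (Σᶠ-* (a x) (w x))))))
        (q≤J m x) (½^-nonNeg t)
      go (inj₂ ge) = many (Σᶠ (freeFarBias x)) (a x * V x) (J f m x) (q N (a x)) (½ ^ℚ t) (a x) (fromℕ t) (fromℕ (suc k))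
        (kth k (g x)) (Σᶠ (g x))
        (≤-trans (Σᶠ-mono (freeFarBias≤freeBias x)) (Σ-freeBias≤J x))
        (*-nonNeg (0≤a x) (V-nonNeg x)) (q-upper N t (0≤a x)) (0≤a x) t≤k (fromℕ-nonNeg (suc k)) ge
        (kth-markov k (g-nonNeg x)) (≤-trans (≤-reflexive (Σ-freeBias x)) (Σ-freeBias≤J x))

  -- Saturation gives far biases at least half of the free influence; they must show up as total
  -- weight unless the excess is large.
  v-lower : ∀ t → fromℕ 12 * (fromℕ t - 1ℚ) ≤ fromℕ (suc k) → Saturated m →
    ½ * Σ∉ m (η f) ≤ fromℕ 2 * v + fromℕ 2 * Ψ m + fromℕ 2 * ½ ^ℚ t
  v-lower t t≤k saturated = ≤-trans (≤-reflexive lhs) (≤-trans (Σᶠ-mono (λ i → go (lookup m i) i refl))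
    (≤-trans (≤-reflexive (sym (E-Σ∉ m (farBias f m)))) (≤-trans (E-mono (Σ-freeFarBias≤ t t≤k)) (≤-reflexive expand))))
    where
    push : ∀ b p → ½ * (if b then 0ℚ else p) ≡ (if b then 0ℚ else ½ * p)
    push true  p = refl
    push false p = refl
    lhs : ½ * Σ∉ m (η f) ≡ Σ∉ m (λ i → ½ * η f i)
    lhs = trans (sym (Σᶠ-* ½ (λ i → if lookup m i then 0ℚ else η f i))) (Σᶠ-cong (λ i → push (lookup m i) (η f i)))
    go : ∀ b i → lookup m i ≡ b → (if b then 0ℚ else ½ * η f i) ≤ (if b then 0ℚ else E (farBias f m i))
    go true  i _    = ≤-refl
    go false i free = saturated i free
    expand : E (λ x → fromℕ 2 * (a x * V x) + fromℕ 2 * (J f m x - q N (a x)) + fromℕ 2 * ½ ^ℚ t) ≡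
      fromℕ 2 * v + fromℕ 2 * Ψ m + fromℕ 2 * ½ ^ℚ t
    expand = trans (E-+ (λ x → fromℕ 2 * (a x * V x) + fromℕ 2 * (J f m x - q N (a x))) (λ _ → fromℕ 2 * ½ ^ℚ t))
      (cong₂ _+_
        (trans (E-+ (λ x → fromℕ 2 * (a x * V x)) (λ x → fromℕ 2 * (J f m x - q N (a x))))
          (cong₂ _+_ (E-* (fromℕ 2) (λ x → a x * V x))
            (trans (E-* (fromℕ 2) (λ x → J f m x - q N (a x))) (cong (fromℕ 2 *_)
              (trans (E-- (J f m) (λ x → q N (a x))) (cong (_- Φ m) (E-J f m)))))))
        (E-const n (fromℕ 2 * ½ ^ℚ t)))

-- The contradiction for sparse sets

Σ∉-∅ : ∀ {n} (g : Fin n → ℚ) → Σ∉ ∅ g ≡ Σᶠ g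
Σ∉-∅ {zero}  g = refl
Σ∉-∅ {suc n} g = cong (λ z → g zero + z) (Σ∉-∅ (g ∘ suc))

edge-isoperimetry : ∀ {n} (f : Cube n → ℚ) → IsBoolean f → ∀ N → q N (E f) ≤ Σᶠ (η f)
edge-isoperimetry {n} f f01 N = ≤-trans (≤-reflexive (sym Φ∅≡)) (≤-trans (Φ≤Σ∉η ∅) (≤-reflexive (Σ∉-∅ (η f))))
  where
  open Potential f f01 N
  Φ∅≡ : Φ ∅ ≡ q N (E f)
  Φ∅≡ = trans (E-cong (λ x → cong (q N) (C-∅ f x))) (E-const n (q N (E f)))

½^-+ : ∀ m n → ½ ^ℚ (m ℕ.+ n) ≡ ½ ^ℚ m * ½ ^ℚ n
½^-+ zero    n = sym (*-identityˡ (½ ^ℚ n))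
½^-+ (suc m) n = trans (cong (½ *_) (½^-+ m n)) (sym (*-assoc ½ (½ ^ℚ m) (½ ^ℚ n)))

½^-antimono : ∀ {m n} → m ℕ.≤ n → ½ ^ℚ n ≤ ½ ^ℚ m
½^-antimono {n = n} ℕ.z≤n = ½^≤1 n
½^-antimono (ℕ.s≤s m≤n)   = ½ ⊙ ½^-antimono m≤n

-- 8000 (κ + 1), kept as nested products so that only small numerals pass through the unary `fromℕ`.
-- Given t α ≤ 8 v, it makes M v at least 1000 (κ + 1) t α, whereas the errors amount to at most
-- (990 + 480 κ) t α.
sparse-exponent : ℕ → ℕ
sparse-exponent κ = 20 ℕ.* (20 ℕ.* (20 ℕ.* suc κ))

-- The lower bound on the total weight `v` and the upper bound on M v are both linear in `t`, the
-- latter because k = 12 t. So `t` cancels, and M can depend on κ alone.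
influence-of-sparse : ∀ {n} (f : Cube n → ℚ) → IsBoolean f → ∀ t κ → 0ℚ < E f → E f ≤ ½ ^ℚ t → ½ ^ℚ t ≤ fromℕ 2 * E f →
  Σᶠ (η f) ≤ fromℕ (t ℕ.+ suc κ) * E f → 34 ℕ.+ 8 ℕ.* κ ℕ.≤ t →
  ¬ (∀ i → η f i ≤ ½ ^ℚ (t ℕ.+ sparse-exponent κ))
influence-of-sparse {n} f f01 t κ 0<α α≤½^t ½^t≤2α H≤ t-large small = <-irrefl refl
  (<-≤-trans 0<tα (contradictory α v (fromℕ t) (fromℕ κ) (fromℕ M) M≡ (v-lower-bound) (v-upper-bound) (<⇒≤ 0<tα) (fromℕ-nonNeg κ) κ<t (<⇒≤ 0<α)))
  where
  α = E f
  M = sparse-exponent κ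
  N = t ℕ.+ M
  k = 12 ℕ.* t
  open Potential f f01 N
  m : Mask n
  m = proj₁ saturated-mask
  light : Light m
  light = proj₁ (proj₂ saturated-mask)
  open Concentration f f01 N m k using (v; v-upper; v-lower)
  H σ τ h : ℚ
  H = Σᶠ (η f)
  σ = Σ∈ m (η f)
  τ = Σ∉ m (η f)
  h = ½ ^ℚ t
  [t-1]α≤Φ∅ : (fromℕ t - 1ℚ) * α ≤ Φ ∅
  [t-1]α≤Φ∅ = ≤-trans (q-lower t (ℕₚ.m≤m+n t M) (<⇒≤ 0<α) α≤½^t)
    (≤-reflexive (sym (trans (E-cong (λ x → cong (q N) (C-∅ f x))) (E-const n (q N α)))))
  Ψ∅≤ : Ψ ∅ ≤ (fromℕ κ + fromℕ 2) * α
  Ψ∅≤ = arith (Σ∉ ∅ (η f)) (Φ ∅) (fromℕ t) (fromℕ κ) α H (Σ∉-∅ (η f)) [t-1]α≤Φ∅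
    (≤-trans H≤ (≤-reflexive (cong (_* α) (fromℕ-+ t (suc κ)))))
    where
    arith : ∀ s p t κ α H → s ≡ H → (t - 1ℚ) * α ≤ p → H ≤ (t + (1ℚ + κ)) * α → s - p ≤ (κ + fromℕ 2) * α
    arith _ p t κ α H refl p₁ p₂ = linear (p₁ ⊕ p₂) (solve (p ∷ₗ t ∷ₗ κ ∷ₗ α ∷ₗ H ∷ₗ []ₗ) ℚ-ring)
  k≡ : fromℕ k ≡ fromℕ 12 * fromℕ t
  k≡ = fromℕ-* 12 t
  12[t-1]≤k+1 : fromℕ 12 * (fromℕ t - 1ℚ) ≤ fromℕ (suc k)
  12[t-1]≤k+1 = ≤-trans (arith (fromℕ t)) (≤-reflexive (cong (λ z → 1ℚ + z) (sym k≡)))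
    where
    arith : ∀ t → fromℕ 12 * (t - 1ℚ) ≤ 1ℚ + fromℕ 12 * t
    arith t = linear (fromℕ-nonNeg 13) (solve (t ∷ₗ []ₗ) ℚ-ring)
  t≥ : fromℕ 34 + fromℕ 8 * fromℕ κ ≤ fromℕ t
  t≥ = ≤-trans (≤-reflexive (sym (trans (fromℕ-+ 34 (8 ℕ.* κ)) (cong (λ z → fromℕ 34 + z) (fromℕ-* 8 κ))))) (fromℕ-mono t-large)
  κ<t : 1ℚ + fromℕ κ ≤ fromℕ t
  κ<t = arith (fromℕ κ) (fromℕ t) (fromℕ-nonNeg κ) t≥
    where
    arith : ∀ κ t → 0ℚ ≤ κ → fromℕ 34 + fromℕ 8 * κ ≤ t → 1ℚ + κ ≤ t
    arith κ t p p′ = linear (fromℕ 7 ⊙ p ⊕ p′ ⊕ fromℕ-nonNeg 33) (solve (κ ∷ₗ t ∷ₗ []ₗ) ℚ-ring)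
  0<tα : 0ℚ < fromℕ t * α
  0<tα = *-pos (<-≤-trans (positive⁻¹ 1ℚ) (≤-trans (≤-trans (≤-reflexive (sym (+-identityʳ 1ℚ))) (+-monoʳ-≤ 1ℚ (fromℕ-nonNeg κ))) κ<t)) 0<α
  M≡ : fromℕ M ≡ fromℕ 20 * (fromℕ 20 * (fromℕ 20 * (1ℚ + fromℕ κ)))
  M≡ = trans (fromℕ-* 20 (20 ℕ.* (20 ℕ.* suc κ))) (cong (fromℕ 20 *_)
    (trans (fromℕ-* 20 (20 ℕ.* suc κ)) (cong (fromℕ 20 *_) (fromℕ-* 20 (suc κ)))))
  -- The hypothesis t ≥ 34 + 8 κ is what makes 2 (t - 1) - 8 (κ + 2) - 16 at least t; the 16 comes
  -- from 2⁻ᵗ ≤ 2α.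
  v-lower-bound : fromℕ t * α ≤ fromℕ 8 * v
  v-lower-bound = arith (fromℕ t) (fromℕ κ) α v (Ψ m) (Ψ ∅) h σ τ H
    (v-lower t 12[t-1]≤k+1 (proj₂ (proj₂ saturated-mask))) light Ψ∅≤ ½^t≤2α
    (≤-trans [t-1]α≤Φ∅ (≤-trans (Φ≤Σ∉η ∅) (≤-reflexive (Σ∉-∅ (η f))))) (Σ∈+Σ∉ m (η f)) (<⇒≤ 0<α ⊡ t≥)
    where
    arith : ∀ t κ α v Ψ Ψ₀ h σ τ H → ½ * τ ≤ fromℕ 2 * v + fromℕ 2 * Ψ + fromℕ 2 * h → Ψ + ½ * (½ * σ) ≤ Ψ₀ →
      Ψ₀ ≤ (κ + fromℕ 2) * α → h ≤ fromℕ 2 * α → (t - 1ℚ) * α ≤ H → σ + τ ≡ H → α * (fromℕ 34 + fromℕ 8 * κ) ≤ α * t →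
      t * α ≤ fromℕ 8 * v
    arith t κ α v Ψ Ψ₀ h σ τ _ p₁ p₂ p₃ p₄ p₅ refl p₆ = linear
      (fromℕ 4 ⊙ p₁ ⊕ fromℕ 8 ⊙ p₂ ⊕ fromℕ 8 ⊙ p₃ ⊕ fromℕ 8 ⊙ p₄ ⊕ fromℕ 2 ⊙ p₅ ⊕ p₆)
      (solve (t ∷ₗ κ ∷ₗ α ∷ₗ v ∷ₗ Ψ ∷ₗ Ψ₀ ∷ₗ h ∷ₗ σ ∷ₗ τ ∷ₗ []ₗ) ℚ-ring)
  -- At scale S = t + M the terms (t - 1) v on the two sides of `v-upper` cancel and leave M v.
  -- `Light` gives σ ≤ 4 Ψ ∅, so the coefficient 10 there becomes 40.
  v-upper-bound : fromℕ M * v ≤ fromℕ 3 * ((fromℕ t + (1ℚ + fromℕ κ)) * α) + fromℕ 12 * fromℕ t * ((fromℕ 40 * (fromℕ κ + fromℕ 2) + fromℕ 2) * α)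
  v-upper-bound = arith (fromℕ N) (fromℕ t) (fromℕ κ) (fromℕ M) (fromℕ k) α v (Ψ m) (Ψ ∅) h σ H
    (fromℕ-+ t M) k≡ (v-upper N t ℕₚ.≤-refl small) light Ψ∅≤ ½^t≤2α
    (≤-trans H≤ (≤-reflexive (cong (_* α) (fromℕ-+ t (suc κ))))) (Ψ-nonNeg m) (fromℕ-nonNeg t)
    where
    arith : ∀ S t κ M k α v Ψ Ψ₀ h σ H → S ≡ t + M → k ≡ fromℕ 12 * t →
      (S - 1ℚ) * v ≤ fromℕ 3 * H + ((k * Ψ + (t - 1ℚ) * v + k * h) + fromℕ 10 * k * σ) →
      Ψ + ½ * (½ * σ) ≤ Ψ₀ → Ψ₀ ≤ (κ + fromℕ 2) * α → h ≤ fromℕ 2 * α → H ≤ (t + (1ℚ + κ)) * α → 0ℚ ≤ Ψ → 0ℚ ≤ t →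
      M * v ≤ fromℕ 3 * ((t + (1ℚ + κ)) * α) + fromℕ 12 * t * ((fromℕ 40 * (κ + fromℕ 2) + fromℕ 2) * α)
    arith _ t κ M _ α v Ψ Ψ₀ h σ H refl refl p₁ p₂ p₃ p₄ p₅ p₆ p₇ = linear
      (p₁ ⊕ fromℕ 480 ⊙ p₇ ⊡ p₂ ⊕ fromℕ 480 ⊙ p₇ ⊡ p₃ ⊕ fromℕ 12 ⊙ p₇ ⊡ p₄ ⊕ fromℕ 3 ⊙ p₅ ⊕ fromℕ 468 ⊙ p₇ ⊡ p₆)
      (solve (t ∷ₗ κ ∷ₗ M ∷ₗ α ∷ₗ v ∷ₗ Ψ ∷ₗ Ψ₀ ∷ₗ h ∷ₗ σ ∷ₗ H ∷ₗ []ₗ) ℚ-ring)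
  contradictory : ∀ α v t κ M → M ≡ fromℕ 20 * (fromℕ 20 * (fromℕ 20 * (1ℚ + κ))) → t * α ≤ fromℕ 8 * v →
    M * v ≤ fromℕ 3 * ((t + (1ℚ + κ)) * α) + fromℕ 12 * t * ((fromℕ 40 * (κ + fromℕ 2) + fromℕ 2) * α) →
    0ℚ ≤ t * α → 0ℚ ≤ κ → 1ℚ + κ ≤ t → 0ℚ ≤ α → t * α ≤ 0ℚ
  contradictory α v t κ _ refl p₁ p₂ p₃ p₄ p₅ p₆ = linear
    ((+ 1 / 10) ⊙ (p₂ ⊕ fromℕ 20 ⊙ (+ 50 / 1) ⊙ (p₁ ⊕ p₄ ⊡ p₁) ⊕ fromℕ 3 ⊙ p₆ ⊡ p₅ ⊕ (+ 520 / 1) ⊙ p₄ ⊡ p₃))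
    (solve (α ∷ₗ v ∷ₗ t ∷ₗ κ ∷ₗ []ₗ) ℚ-ring)

-- Fourier weights and hypercontractivity

-- Fourier decomposition in the first coordinate: `even` carries the coefficients of the sets
-- avoiding it, `odd` those of the sets containing it.
even odd : ∀ {n} → (Cube (suc n) → ℚ) → Cube n → ℚ
even f x = ½ * (f (true ∷ x) + f (false ∷ x))
odd  f x = ½ * (f (true ∷ x) - f (false ∷ x))

-- Σ_S λ(|S|) f̂(S)², by recursion on the dimension.
spectral : (ℕ → ℚ) → ∀ {n} → (Cube n → ℚ) → ℚ
spectral l {zero}  f = l 0 * (f [] * f [])
spectral l {suc n} f = spectral l (even f) + spectral (l ∘ suc) (odd f)

spectral-cong : ∀ l {n} {f g : Cube n → ℚ} → (∀ x → f x ≡ g x) → spectral l f ≡ spectral l g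
spectral-cong l {zero}  eq = cong (λ z → l 0 * (z * z)) (eq [])
spectral-cong l {suc n} eq = cong₂ _+_
  (spectral-cong l (λ x → cong₂ (λ a b → ½ * (a + b)) (eq (true ∷ x)) (eq (false ∷ x))))
  (spectral-cong (l ∘ suc) (λ x → cong₂ (λ a b → ½ * (a - b)) (eq (true ∷ x)) (eq (false ∷ x))))

spectral-mono : ∀ {l l′} {n} (f : Cube n → ℚ) → (∀ k → l k ≤ l′ k) → spectral l f ≤ spectral l′ f
spectral-mono {l} {l′} {zero} f le = *-monoʳ-≤-nonNeg (f [] * f []) {{nonNegative (sq-nonNeg (f []))}} (le 0)
spectral-mono {n = suc n} f le = spectral-mono (even f) le ⊕ spectral-mono (odd f) (le ∘ suc)

spectral-+ : ∀ l l′ {n} (f : Cube n → ℚ) → spectral (λ k → l k + l′ k) f ≡ spectral l f + spectral l′ f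
spectral-+ l l′ {zero}  f = *-distribʳ-+ (f [] * f []) (l 0) (l′ 0)
spectral-+ l l′ {suc n} f = trans (cong₂ _+_ (spectral-+ l l′ (even f)) (spectral-+ (l ∘ suc) (l′ ∘ suc) (odd f)))
  (interchange (spectral l (even f)) (spectral l′ (even f)) (spectral (l ∘ suc) (odd f)) (spectral (l′ ∘ suc) (odd f)))
  where
  interchange : ∀ a b c d → a + b + (c + d) ≡ a + c + (b + d)
  interchange = solve-∀ ℚ-ring

spectral-* : ∀ r l {n} (f : Cube n → ℚ) → spectral (λ k → r * l k) f ≡ r * spectral l f
spectral-* r l {zero}  f = *-assoc r (l 0) (f [] * f [])
spectral-* r l {suc n} f = trans (cong₂ _+_ (spectral-* r l (even f)) (spectral-* r (l ∘ suc) (odd f)))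
  (sym (*-distribˡ-+ r (spectral l (even f)) (spectral (l ∘ suc) (odd f))))

spectral-0 : ∀ {n} (f : Cube n → ℚ) → spectral (λ _ → 0ℚ) f ≡ 0ℚ
spectral-0 {zero}  f = *-zeroˡ (f [] * f [])
spectral-0 {suc n} f = trans (cong₂ _+_ (spectral-0 (even f)) (spectral-0 (odd f))) (+-identityʳ 0ℚ)

spectral-zero : ∀ l n → spectral l {n} (λ _ → 0ℚ) ≡ 0ℚ
spectral-zero l zero    = *-zeroʳ (l 0)
spectral-zero l (suc n) = trans (cong₂ _+_ (spectral-zero l n) (spectral-zero (l ∘ suc) n)) (+-identityʳ 0ℚ)

E-*-even-odd : ∀ {n} (f g : Cube (suc n) → ℚ) →
  E (λ x → f x * g x) ≡ E (λ x → even f x * even g x) + E (λ x → odd f x * odd g x)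
E-*-even-odd f g = trans (cong (½ *_) (sym (E-+ (λ x → f₁ x * g₁ x) (λ x → f₀ x * g₀ x))))
  (trans (sym (E-* ½ (λ x → f₁ x * g₁ x + f₀ x * g₀ x)))
    (trans (E-cong (λ x → polarise (f₁ x) (f₀ x) (g₁ x) (g₀ x)))
      (E-+ (λ x → even f x * even g x) (λ x → odd f x * odd g x))))
  where
  f₁ = f ∘ (true ∷_)
  f₀ = f ∘ (false ∷_)
  g₁ = g ∘ (true ∷_)
  g₀ = g ∘ (false ∷_)
  polarise : ∀ a b c d → ½ * (a * c + b * d) ≡ ½ * (a + b) * (½ * (c + d)) + ½ * (a - b) * (½ * (c - d))
  polarise = solve-∀ ℚ-ring

E-even : ∀ {n} (f : Cube (suc n) → ℚ) → E (even f) ≡ E f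
E-even f = trans (E-* ½ (λ x → f (true ∷ x) + f (false ∷ x)))
  (cong (½ *_) (E-+ (f ∘ (true ∷_)) (f ∘ (false ∷_))))

parseval : ∀ {n} (f : Cube n → ℚ) → spectral (λ _ → 1ℚ) f ≡ E (λ x → f x * f x)
parseval {zero}  f = *-identityˡ (f [] * f [])
parseval {suc n} f = trans (cong₂ _+_ (parseval (even f)) (parseval (odd f))) (sym (E-*-even-odd f f))

δ₀ : ℕ → ℚ
δ₀ zero    = 1ℚ
δ₀ (suc k) = 0ℚ

spectral-δ₀ : ∀ {n} (f : Cube n → ℚ) → spectral δ₀ f ≡ E f * E f
spectral-δ₀ {zero}  f = *-identityˡ (f [] * f [])
spectral-δ₀ {suc n} f = trans (cong₂ _+_ (spectral-δ₀ (even f)) (spectral-0 (odd f)))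
  (trans (+-identityʳ (E (even f) * E (even f))) (cong₂ _*_ (E-even f) (E-even f)))

∂ : ∀ {n} → Fin n → (Cube n → ℚ) → Cube n → ℚ
∂ i f x = ½ * (f x - f (flipAt i x))

-- `∂ i` keeps exactly the characters of sets S containing i, so the sum over i counts each S with
-- multiplicity |S|.
Σ-spectral-∂ : ∀ l {n} (f : Cube n → ℚ) → Σᶠ (λ i → spectral l (∂ i f)) ≡ spectral (λ k → fromℕ k * l k) f
Σ-spectral-∂ l {zero}  f = sym (trans (cong (_* (f [] * f [])) (*-zeroˡ (l 0))) (*-zeroˡ (f [] * f [])))
Σ-spectral-∂ l {suc n} f = begin
  spectral l (even (∂ zero f)) + spectral (l ∘ suc) (odd (∂ zero f)) +
    Σᶠ (λ i → spectral l (even (∂ (suc i) f)) + spectral (l ∘ suc) (odd (∂ (suc i) f)))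
    ≡⟨ cong₂ _+_
         (cong₂ _+_ (trans (spectral-cong l (λ x → cancel (f (true ∷ x)) (f (false ∷ x)))) (spectral-zero l n))
           (spectral-cong (l ∘ suc) (λ x → double (f (true ∷ x)) (f (false ∷ x)))))
         (trans (Σᶠ-cong (λ i → cong₂ _+_
             (spectral-cong l (λ x → even-∂ (f (true ∷ x)) (f (true ∷ flipAt i x)) (f (false ∷ x)) (f (false ∷ flipAt i x))))
             (spectral-cong (l ∘ suc) (λ x → odd-∂ (f (true ∷ x)) (f (true ∷ flipAt i x)) (f (false ∷ x)) (f (false ∷ flipAt i x))))))
           (trans (Σᶠ-+ (λ i → spectral l (∂ i (even f))) (λ i → spectral (l ∘ suc) (∂ i (odd f))))
             (cong₂ _+_ (Σ-spectral-∂ l (even f)) (Σ-spectral-∂ (l ∘ suc) (odd f))))) ⟩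
  0ℚ + spectral (l ∘ suc) (odd f) + (spectral (λ k → fromℕ k * l k) (even f) + spectral (λ k → fromℕ k * l (suc k)) (odd f))
    ≡⟨ regroup (spectral (l ∘ suc) (odd f)) (spectral (λ k → fromℕ k * l k) (even f)) (spectral (λ k → fromℕ k * l (suc k)) (odd f)) ⟩
  spectral (λ k → fromℕ k * l k) (even f) + (spectral (l ∘ suc) (odd f) + spectral (λ k → fromℕ k * l (suc k)) (odd f))
    ≡⟨ cong (λ z → spectral (λ k → fromℕ k * l k) (even f) + z) (trans (sym (spectral-+ (l ∘ suc) (λ k → fromℕ k * l (suc k)) (odd f)))
         (spectral-weight (λ k → l (suc k) + fromℕ k * l (suc k)) (λ k → fromℕ (suc k) * l (suc k)) (odd f)
           (λ k → distrib (l (suc k)) (fromℕ k)))) ⟩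
  spectral (λ k → fromℕ k * l k) (even f) + spectral (λ k → fromℕ (suc k) * l (suc k)) (odd f) ∎
  where
  open ≡-Reasoning
  cancel : ∀ a b → ½ * (½ * (a - b) + ½ * (b - a)) ≡ 0ℚ
  cancel = solve-∀ ℚ-ring
  double : ∀ a b → ½ * (½ * (a - b) - ½ * (b - a)) ≡ ½ * (a - b)
  double = solve-∀ ℚ-ring
  even-∂ : ∀ a a′ b b′ → ½ * (½ * (a - a′) + ½ * (b - b′)) ≡ ½ * (½ * (a + b) - ½ * (a′ + b′))
  even-∂ = solve-∀ ℚ-ring
  odd-∂ : ∀ a a′ b b′ → ½ * (½ * (a - a′) - ½ * (b - b′)) ≡ ½ * (½ * (a - b) - ½ * (a′ - b′))
  odd-∂ = solve-∀ ℚ-ring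
  regroup : ∀ a b c → 0ℚ + a + (b + c) ≡ b + (a + c)
  regroup = solve-∀ ℚ-ring
  distrib : ∀ p r → p + r * p ≡ (1ℚ + r) * p
  distrib = solve-∀ ℚ-ring
  spectral-weight : ∀ l l′ {n} (f : Cube n → ℚ) → (∀ k → l k ≡ l′ k) → spectral l f ≡ spectral l′ f
  spectral-weight l l′ {zero}  f eq = cong (_* (f [] * f [])) (eq 0)
  spectral-weight l l′ {suc n} f eq = cong₂ _+_ (spectral-weight l l′ (even f) eq)
    (spectral-weight (l ∘ suc) (l′ ∘ suc) (odd f) (eq ∘ suc))

-- The noise operator f ↦ Σ_S 2^{-|S|} f̂(S) χ_S.
noise : ∀ {n} → (Cube n → ℚ) → Cube n → ℚ
noise f []          = f []
noise f (true  ∷ x) = noise (even f) x + ½ * noise (odd f) x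
noise f (false ∷ x) = noise (even f) x - ½ * noise (odd f) x

private
  even-sum : ∀ a b → ½ * ((a + ½ * b) + (a - ½ * b)) ≡ a
  even-sum = solve-∀ ℚ-ring

  odd-difference : ∀ a b → ½ * ((a + ½ * b) - (a - ½ * b)) ≡ ½ * b
  odd-difference = solve-∀ ℚ-ring

even-noise : ∀ {n} (f : Cube (suc n) → ℚ) x → even (noise f) x ≡ noise (even f) x
even-noise f x = even-sum (noise (even f) x) (noise (odd f) x)

odd-noise : ∀ {n} (f : Cube (suc n) → ℚ) x → odd (noise f) x ≡ ½ * noise (odd f) x
odd-noise f x = odd-difference (noise (even f) x) (noise (odd f) x)

noise-selfAdjoint : ∀ {n} (f g : Cube n → ℚ) → E (λ x → f x * noise g x) ≡ E (λ x → noise f x * g x)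
noise-selfAdjoint {zero}  f g = refl
noise-selfAdjoint {suc n} f g = begin
  E (λ x → f x * noise g x)
    ≡⟨ E-*-even-odd f (noise g) ⟩
  E (λ x → even f x * even (noise g) x) + E (λ x → odd f x * odd (noise g) x)
    ≡⟨ cong₂ _+_ (E-cong (λ x → cong (even f x *_) (even-noise g x)))
         (trans (E-cong (λ x → trans (cong (odd f x *_) (odd-noise g x)) (out (odd f x) (noise (odd g) x))))
           (E-* ½ (λ x → odd f x * noise (odd g) x))) ⟩
  E (λ x → even f x * noise (even g) x) + ½ * E (λ x → odd f x * noise (odd g) x)
    ≡⟨ cong₂ (λ a b → a + ½ * b) (noise-selfAdjoint (even f) (even g)) (noise-selfAdjoint (odd f) (odd g)) ⟩
  E (λ x → noise (even f) x * even g x) + ½ * E (λ x → noise (odd f) x * odd g x)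
    ≡⟨ cong₂ _+_ (E-cong (λ x → cong (_* even g x) (sym (even-noise f x))))
         (trans (sym (E-* ½ (λ x → noise (odd f) x * odd g x)))
           (E-cong (λ x → trans (sym (*-assoc ½ (noise (odd f) x) (odd g x))) (cong (_* odd g x) (sym (odd-noise f x)))))) ⟩
  E (λ x → even (noise f) x * even g x) + E (λ x → odd (noise f) x * odd g x)
    ≡⟨ E-*-even-odd (noise f) g ⟨
  E (λ x → noise f x * g x) ∎
  where
  open ≡-Reasoning
  out : ∀ a b → a * (½ * b) ≡ ½ * (a * b)
  out = solve-∀ ℚ-ring

¼ : ℚ
¼ = ½ * ½

spectral-noise : ∀ {n} (f : Cube n → ℚ) → spectral (¼ ^ℚ_) f ≡ E (λ x → noise f x * noise f x)
spectral-noise {zero}  f = *-identityˡ (f [] * f [])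
spectral-noise {suc n} f = trans
  (cong₂ _+_ (trans (spectral-noise (even f)) (E-cong (λ x → cong₂ _*_ (sym (even-noise f x)) (sym (even-noise f x)))))
    (trans (spectral-* ¼ (¼ ^ℚ_) (odd f)) (trans (cong (¼ *_) (spectral-noise (odd f)))
      (trans (sym (E-* ¼ (λ x → noise (odd f) x * noise (odd f) x)))
        (E-cong (λ x → trans (sq (noise (odd f) x)) (cong₂ _*_ (sym (odd-noise f x)) (sym (odd-noise f x)))))))))
  (sym (E-*-even-odd (noise f) (noise f)))
  where
  sq : ∀ a → ½ * ½ * (a * a) ≡ ½ * a * (½ * a)
  sq = solve-∀ ℚ-ring

sq-cancel-≤ : ∀ {p r} → 0ℚ ≤ r → p * p ≤ r * r → p ≤ r
sq-cancel-≤ {p} {r} 0≤r le with ≤-total p r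
... | inj₁ p≤r = p≤r
... | inj₂ r≤p with p ℚₚ.≤? r
...   | yes p≤r = p≤r
...   | no  p≰r = ⊥-elim (<-irrefl refl (<-≤-trans
  (<-≤-trans (*-monoʳ-<-pos p {{positive (≤-<-trans 0≤r (≰⇒> p≰r))}} (≰⇒> p≰r)) le) (*-monoʳ-≤-nonNeg r {{nonNegative 0≤r}} r≤p)))

-- Induction on the dimension in squared form avoids square roots. The cross term is handled by
-- (2pr)² ≤ 4abcd ≤ (ad + cb)².
E-cauchy-schwarz : ∀ {n} (f g : Cube n → ℚ) →
  E (λ x → f x * g x) * E (λ x → f x * g x) ≤ E (λ x → f x * f x) * E (λ x → g x * g x)
E-cauchy-schwarz {zero}  f g = ≤-reflexive (swap (f []) (g []))
  where
  swap : ∀ a b → a * b * (a * b) ≡ a * a * (b * b)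
  swap = solve-∀ ℚ-ring
E-cauchy-schwarz {suc n} f g = two-point
  (E (λ x → f₁ x * g₁ x)) (E (λ x → f₀ x * g₀ x)) (E (λ x → f₁ x * f₁ x)) (E (λ x → g₁ x * g₁ x))
  (E (λ x → f₀ x * f₀ x)) (E (λ x → g₀ x * g₀ x))
  (E-nonNeg (λ x → sq-nonNeg (f₁ x))) (E-nonNeg (λ x → sq-nonNeg (g₁ x)))
  (E-nonNeg (λ x → sq-nonNeg (f₀ x))) (E-nonNeg (λ x → sq-nonNeg (g₀ x)))
  (E-cauchy-schwarz f₁ g₁) (E-cauchy-schwarz f₀ g₀)
  where
  f₁ = f ∘ (true ∷_)
  f₀ = f ∘ (false ∷_)
  g₁ = g ∘ (true ∷_)
  g₀ = g ∘ (false ∷_)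
  two-point : ∀ p r a b c d → 0ℚ ≤ a → 0ℚ ≤ b → 0ℚ ≤ c → 0ℚ ≤ d → p * p ≤ a * b → r * r ≤ c * d →
    ½ * (p + r) * (½ * (p + r)) ≤ ½ * (a + c) * (½ * (b + d))
  two-point p r a b c d 0≤a 0≤b 0≤c 0≤d p²≤ r²≤ = final p r a b c d p²≤ r²≤
      (sq-cancel-≤ (*-nonNeg 0≤a 0≤d ⊕ *-nonNeg 0≤c 0≤b) (cross p r a b c d p²≤ r²≤ (*-nonNeg 0≤a 0≤b) (sq-nonNeg (a * d - c * b)) (sq-nonNeg r)))
    where
    cross : ∀ p r a b c d → p * p ≤ a * b → r * r ≤ c * d → 0ℚ ≤ a * b → 0ℚ ≤ (a * d - c * b) * (a * d - c * b) → 0ℚ ≤ r * r →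
      fromℕ 2 * (p * r) * (fromℕ 2 * (p * r)) ≤ (a * d + c * b) * (a * d + c * b)
    cross p r a b c d p₁ p₂ p₃ p₄ p₅ = linear (fromℕ 4 ⊙ p₅ ⊡ p₁ ⊕ fromℕ 4 ⊙ p₃ ⊡ p₂ ⊕ p₄)
      (solve (p ∷ₗ r ∷ₗ a ∷ₗ b ∷ₗ c ∷ₗ d ∷ₗ []ₗ) ℚ-ring)
    final : ∀ p r a b c d → p * p ≤ a * b → r * r ≤ c * d → fromℕ 2 * (p * r) ≤ a * d + c * b →
      ½ * (p + r) * (½ * (p + r)) ≤ ½ * (a + c) * (½ * (b + d))
    final p r a b c d p₁ p₂ p₃ = linear (½ ⊙ ½ ⊙ (p₁ ⊕ p₂ ⊕ p₃)) (solve (p ∷ₗ r ∷ₗ a ∷ₗ b ∷ₗ c ∷ₗ d ∷ₗ []ₗ) ℚ-ring)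

-- Bonami's induction: averaging over the first coordinate leaves E P² + 3/2 E PR + 1/16 E R², and
-- since 3/2 ≤ 2, Cauchy-Schwarz bounds this by a perfect square. The noise parameter ½ is below the
-- critical 1/√3 and keeps everything rational.
hypercontractive : ∀ {n} (f : Cube n → ℚ) →
  E (λ x → noise f x * noise f x * (noise f x * noise f x)) ≤ E (λ x → f x * f x) * E (λ x → f x * f x)
hypercontractive {zero}  f = ≤-refl
hypercontractive {suc n} f = ≤-trans (≤-reflexive expand) (≤-trans
  (two-point (E (λ x → P x * P x)) (E (λ x → P x * R x)) (E (λ x → R x * R x)) A B
    (E-nonNeg (λ x → sq-nonNeg (even f x))) (E-nonNeg (λ x → sq-nonNeg (odd f x)))
    (E-nonNeg (λ x → sq-nonNeg (R x)))
    (hypercontractive (even f)) (hypercontractive (odd f)) (E-cauchy-schwarz P R))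
  (≤-reflexive (cong₂ _*_ (sym (E-*-even-odd f f)) (sym (E-*-even-odd f f)))))
  where
  p = noise (even f)
  r = noise (odd f)
  P R : Cube n → ℚ
  P x = p x * p x
  R x = r x * r x
  A B : ℚ
  A = E (λ x → even f x * even f x)
  B = E (λ x → odd f x * odd f x)
  binomial : ∀ p r → ½ * ((p + ½ * r) * (p + ½ * r) * ((p + ½ * r) * (p + ½ * r)) + (p - ½ * r) * (p - ½ * r) * ((p - ½ * r) * (p - ½ * r)))
    ≡ p * p * (p * p) + ((+ 3 / 2) * (p * p * (r * r)) + (+ 1 / 16) * (r * r * (r * r)))
  binomial = solve-∀ ℚ-ring
  F : Cube (suc n) → ℚ
  F x = noise f x * noise f x * (noise f x * noise f x)
  expand : E F ≡ E (λ x → P x * P x) + ((+ 3 / 2) * E (λ x → P x * R x) + (+ 1 / 16) * E (λ x → R x * R x))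
  expand = trans (sym (E-even F)) (trans (E-cong (λ x → binomial (p x) (r x)))
    (trans (E-+ (λ x → P x * P x) (λ x → (+ 3 / 2) * (P x * R x) + (+ 1 / 16) * (R x * R x)))
      (cong (λ z → E (λ x → P x * P x) + z) (trans (E-+ (λ x → (+ 3 / 2) * (P x * R x)) (λ x → (+ 1 / 16) * (R x * R x)))
        (cong₂ _+_ (E-* (+ 3 / 2) (λ x → P x * R x)) (E-* (+ 1 / 16) (λ x → R x * R x)))))))
  two-point : ∀ pp pr rr A B → 0ℚ ≤ A → 0ℚ ≤ B → 0ℚ ≤ rr → pp ≤ A * A → rr ≤ B * B → pr * pr ≤ pp * rr →
    pp + ((+ 3 / 2) * pr + (+ 1 / 16) * rr) ≤ (A + B) * (A + B)
  two-point pp pr rr A B 0≤A 0≤B 0≤rr p₁ p₂ p₃ = final pp pr rr A B p₁ p₂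
      (sq-cancel-≤ (*-nonNeg 0≤A 0≤B) (cross pp pr rr A B p₃ 0≤rr (sq-nonNeg A) p₁ p₂)) (*-nonNeg 0≤A 0≤B) (sq-nonNeg B)
    where
    cross : ∀ pp pr rr A B → pr * pr ≤ pp * rr → 0ℚ ≤ rr → 0ℚ ≤ A * A → pp ≤ A * A → rr ≤ B * B → pr * pr ≤ A * B * (A * B)
    cross pp pr rr A B p₁ p₂ p₃ p₄ p₅ = linear (p₁ ⊕ p₂ ⊡ p₄ ⊕ p₃ ⊡ p₅) (solve (pp ∷ₗ pr ∷ₗ rr ∷ₗ A ∷ₗ B ∷ₗ []ₗ) ℚ-ring)
    final : ∀ pp pr rr A B → pp ≤ A * A → rr ≤ B * B → pr ≤ A * B → 0ℚ ≤ A * B → 0ℚ ≤ B * B →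
      pp + ((+ 3 / 2) * pr + (+ 1 / 16) * rr) ≤ (A + B) * (A + B)
    final pp pr rr A B p₁ p₂ p₃ p₄ p₅ = linear (p₁ ⊕ (+ 1 / 16) ⊙ p₂ ⊕ (+ 3 / 2) ⊙ p₃ ⊕ ½ ⊙ p₄ ⊕ (+ 15 / 16) ⊙ p₅)
      (solve (pp ∷ₗ pr ∷ₗ rr ∷ₗ A ∷ₗ B ∷ₗ []ₗ) ℚ-ring)

-- Duality turns hypercontractivity into ‖noise g‖₂⁴ ≤ ‖g‖₁³ up to constants, for g = ∂ᵢf.
noise-∂≤ : ∀ {n} (f : Cube n → ℚ) → IsBoolean f → ∀ i s → η f i ≤ ½ ^ℚ (s ℕ.+ s) →
  E (λ x → noise (∂ i f) x * noise (∂ i f) x) ≤ η f i * ½ ^ℚ s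
noise-∂≤ {n} f f01 i s small = conclude (½ ^ℚ s) z Q (η f i) U
  (E-nonNeg (λ x → sq-nonNeg (noise g x))) (*-nonNeg (η-nonNeg f i) (½^-nonNeg s)) (η-nonNeg f i)
  (≤-trans small (≤-reflexive (½^-+ s s))) z²≤ Q²≤
  (hypercontractive (noise g)) (E-nonNeg (λ x → *-nonNeg (s-nonNeg x) (sq-nonNeg (u x))))
  where
  g u S : Cube n → ℚ
  g = ∂ i f
  u = noise (noise g)
  -- The indicator of the support of `g`. Inserting it lets each of two applications of
  -- Cauchy-Schwarz gain a factor η: z² ≤ ½ η Q and Q² ≤ 2 η U, while hypercontractivity closes the
  -- loop with U ≤ z².
  S x = fromℕ 2 * D i f x
  s-nonNeg : ∀ x → 0ℚ ≤ S x
  s-nonNeg x = *-nonNeg (fromℕ-nonNeg 2) (D-nonNeg i f x)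
  z Q U : ℚ
  z = E (λ x → noise g x * noise g x)
  Q = E (λ x → S x * (u x * u x))
  U = E (λ x → u x * u x * (u x * u x))
  g-support : ∀ x → g x ≡ g x * S x
  g-support x = go (f01 x) (f01 (flipAt i x))
    where
    go : ∀ {p r} → p ≡ 0ℚ ⊎ p ≡ 1ℚ → r ≡ 0ℚ ⊎ r ≡ 1ℚ → ½ * (p - r) ≡ ½ * (p - r) * (fromℕ 2 * (½ * ∣ p - r ∣))
    go (inj₁ refl) (inj₁ refl) = refl
    go (inj₁ refl) (inj₂ refl) = refl
    go (inj₂ refl) (inj₁ refl) = refl
    go (inj₂ refl) (inj₂ refl) = refl
  S-idempotent : ∀ x → S x * S x ≡ S x
  S-idempotent x = go (f01 x) (f01 (flipAt i x))
    where
    go : ∀ {p r} → p ≡ 0ℚ ⊎ p ≡ 1ℚ → r ≡ 0ℚ ⊎ r ≡ 1ℚ →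
      fromℕ 2 * (½ * ∣ p - r ∣) * (fromℕ 2 * (½ * ∣ p - r ∣)) ≡ fromℕ 2 * (½ * ∣ p - r ∣)
    go (inj₁ refl) (inj₁ refl) = refl
    go (inj₁ refl) (inj₂ refl) = refl
    go (inj₂ refl) (inj₁ refl) = refl
    go (inj₂ refl) (inj₂ refl) = refl
  g²≡½D : ∀ x → g x * g x ≡ ½ * D i f x
  g²≡½D x = go (f01 x) (f01 (flipAt i x))
    where
    go : ∀ {p r} → p ≡ 0ℚ ⊎ p ≡ 1ℚ → r ≡ 0ℚ ⊎ r ≡ 1ℚ → ½ * (p - r) * (½ * (p - r)) ≡ ½ * (½ * ∣ p - r ∣)
    go (inj₁ refl) (inj₁ refl) = refl
    go (inj₁ refl) (inj₂ refl) = refl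
    go (inj₂ refl) (inj₁ refl) = refl
    go (inj₂ refl) (inj₂ refl) = refl
  square-out : ∀ s u → s * s ≡ s → s * u * (s * u) ≡ s * (u * u)
  square-out s u idem = trans (eq s u) (cong (_* (u * u)) idem)
    where
    eq : ∀ s u → s * u * (s * u) ≡ s * s * (u * u)
    eq = solve-∀ ℚ-ring
  z≡ : z ≡ E (λ x → g x * (S x * u x))
  z≡ = trans (sym (noise-selfAdjoint g (noise g)))
    (E-cong (λ x → trans (cong (_* u x) (g-support x)) (*-assoc (g x) (S x) (u x))))
  z²≤ : z * z ≤ ½ * η f i * Q
  z²≤ = ≤-trans (≤-reflexive (cong₂ _*_ z≡ z≡)) (≤-trans (E-cauchy-schwarz g (λ x → S x * u x))
    (≤-reflexive (cong₂ _*_ (trans (E-cong g²≡½D) (E-* ½ (D i f)))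
      (E-cong (λ x → square-out (S x) (u x) (S-idempotent x))))))
  Q²≤ : Q * Q ≤ fromℕ 2 * η f i * U
  Q²≤ = ≤-trans (E-cauchy-schwarz S (λ x → u x * u x))
    (≤-reflexive (cong (_* U) (trans (E-cong S-idempotent) (E-* (fromℕ 2) (D i f)))))
  cancel : ∀ z Y → 0ℚ ≤ z → 0ℚ ≤ Y → z * z * (z * z) ≤ Y * Y * (z * z) → z ≤ Y
  cancel z Y 0≤z 0≤Y le with z ℚₚ.≤? Y
  ... | yes z≤Y = z≤Y
  ... | no  z≰Y = sq-cancel-≤ 0≤Y (*-cancelʳ-≤-pos (z * z) {{positive (*-pos 0<z 0<z)}} le)
    where
    0<z : 0ℚ < z
    0<z = ≤-<-trans 0≤Y (≰⇒> z≰Y)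
  conclude : ∀ y z Q e U → 0ℚ ≤ z → 0ℚ ≤ e * y → 0ℚ ≤ e → e ≤ y * y → z * z ≤ ½ * e * Q → Q * Q ≤ fromℕ 2 * e * U →
    U ≤ z * z → 0ℚ ≤ Q → z ≤ e * y
  conclude y z Q e U 0≤z 0≤ey 0≤e e≤y² z²≤ Q²≤ U≤ 0≤Q = cancel z (e * y) 0≤z 0≤ey
      (≤-trans (square z²≤) (chain y z Q e U (sq-nonNeg e) 0≤e (sq-nonNeg z) e≤y² Q²≤ U≤ (sq-nonNeg y)))
    where
    square : z * z ≤ ½ * e * Q → z * z * (z * z) ≤ ½ * e * Q * (½ * e * Q)
    square le = ≤-trans (sq-nonNeg z ⊡ le) (*-monoʳ-≤-nonNeg (½ * e * Q) {{nonNegative (*-nonNeg (*-nonNeg 0≤½ 0≤e) 0≤Q)}} le)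
    chain : ∀ y z Q e U → 0ℚ ≤ e * e → 0ℚ ≤ e → 0ℚ ≤ z * z → e ≤ y * y → Q * Q ≤ fromℕ 2 * e * U → U ≤ z * z → 0ℚ ≤ y * y →
      ½ * e * Q * (½ * e * Q) ≤ e * y * (e * y) * (z * z)
    chain y z Q e U p₀ p₁ p₂ p₃ p₄ p₅ p₆ = linear
      (½ ⊙ ½ ⊙ p₀ ⊡ p₄ ⊕ ½ ⊙ *-nonNeg p₀ p₁ ⊡ p₅ ⊕ ½ ⊙ *-nonNeg p₀ p₂ ⊡ p₃ ⊕ ½ ⊙ *-nonNeg (*-nonNeg p₀ p₂) p₆)
      (solve (y ∷ₗ z ∷ₗ Q ∷ₗ e ∷ₗ U ∷ₗ []ₗ) ℚ-ring)

4^ : ℕ → ℚ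
4^ = fromℕ 4 ^ℚ_

4^*½^*½^≡1 : ∀ d → 4^ d * (½ ^ℚ d * ½ ^ℚ d) ≡ 1ℚ
4^*½^*½^≡1 zero    = refl
4^*½^*½^≡1 (suc d) = trans (eq (4^ d) (½ ^ℚ d)) (4^*½^*½^≡1 d)
  where
  eq : ∀ p h → fromℕ 4 * p * (½ * h * (½ * h)) ≡ p * (h * h)
  eq = solve-∀ ℚ-ring

1≤4^*¼^ : ∀ {k d} → k ℕ.≤ d → 1ℚ ≤ 4^ d * ¼ ^ℚ k
1≤4^*¼^ {d = d} ℕ.z≤n = ≤-trans (1≤4^ d) (≤-reflexive (sym (*-identityʳ (4^ d))))
  where
  1≤4^ : ∀ d → 1ℚ ≤ 4^ d
  1≤4^ zero    = ≤-refl
  1≤4^ (suc d) = arith (4^ d) (1≤4^ d)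
    where
    arith : ∀ p → 1ℚ ≤ p → 1ℚ ≤ fromℕ 4 * p
    arith p le = linear (fromℕ 4 ⊙ le ⊕ fromℕ-nonNeg 3) (solve (p ∷ₗ []ₗ) ℚ-ring)
1≤4^*¼^ {suc k} {suc d} (ℕ.s≤s k≤d) = ≤-trans (1≤4^*¼^ k≤d) (≤-reflexive (eq (4^ d) (¼ ^ℚ k)))
  where
  eq : ∀ p r → p * r ≡ fromℕ 4 * p * (½ * ½ * r)
  eq = solve-∀ ℚ-ring

fromℕ*½^≤1 : ∀ n → fromℕ n * ½ ^ℚ n ≤ 1ℚ
fromℕ*½^≤1 zero    = ≤ᵇ⇒≤ _
fromℕ*½^≤1 (suc n) = arith (fromℕ n) (½ ^ℚ n) (½^≤1 n) (fromℕ*½^≤1 n)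
  where
  arith : ∀ p h → h ≤ 1ℚ → p * h ≤ 1ℚ → (1ℚ + p) * (½ * h) ≤ 1ℚ
  arith p h p₁ p₂ = linear (½ ⊙ (p₁ ⊕ p₂)) (solve (p ∷ₗ h ∷ₗ []ₗ) ℚ-ring)

^ℚ-nonNeg : ∀ {p} → 0ℚ ≤ p → ∀ k → 0ℚ ≤ p ^ℚ k
^ℚ-nonNeg 0≤p zero    = 0≤1
^ℚ-nonNeg 0≤p (suc k) = *-nonNeg 0≤p (^ℚ-nonNeg 0≤p k)

-- Levels k ≥ d are paid for by the energy weight k, levels 1 ≤ k ≤ d by the noisy weight, for which
-- 4ᵈ 4⁻ᵏ ≥ 1. Level 0 carries no variance.
variance-weight : ∀ d k → fromℕ d * (1ℚ + - 1ℚ * δ₀ k) ≤ fromℕ k * 1ℚ + fromℕ d * 4^ d * (fromℕ k * ¼ ^ℚ k)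
variance-weight d zero = ≤-reflexive (eq (fromℕ d) (4^ d))
  where
  eq : ∀ d p → d * (1ℚ + - 1ℚ * 1ℚ) ≡ 0ℚ * 1ℚ + d * p * (0ℚ * 1ℚ)
  eq = solve-∀ ℚ-ring
variance-weight d (suc k) with ℕₚ.≤-total d (suc k)
... | inj₁ d≤k = high (fromℕ d) (fromℕ (suc k)) (fromℕ d * 4^ d * (fromℕ (suc k) * ¼ ^ℚ suc k)) (fromℕ-mono d≤k)
  (*-nonNeg (*-nonNeg (fromℕ-nonNeg d) (^ℚ-nonNeg (fromℕ-nonNeg 4) d))
    (*-nonNeg (fromℕ-nonNeg (suc k)) (^ℚ-nonNeg (*-nonNeg 0≤½ 0≤½) (suc k))))
  where
  high : ∀ d k r → d ≤ k → 0ℚ ≤ r → d * (1ℚ + - 1ℚ * 0ℚ) ≤ k * 1ℚ + r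
  high d k r p₁ p₂ = linear (p₁ ⊕ p₂) (solve (d ∷ₗ k ∷ₗ r ∷ₗ []ₗ) ℚ-ring)
... | inj₂ k≤d = low (fromℕ d) (fromℕ k) (4^ d) (¼ ^ℚ suc k) (fromℕ-nonNeg d) (fromℕ-nonNeg k) (1≤4^*¼^ k≤d)
  where
  low : ∀ d k p r → 0ℚ ≤ d → 0ℚ ≤ k → 1ℚ ≤ p * r → d * (1ℚ + - 1ℚ * 0ℚ) ≤ (1ℚ + k) * 1ℚ + d * p * ((1ℚ + k) * r)
  low d k p r p₁ p₂ p₃ = linear (0≤1 ⊕ p₂ ⊕ p₁ ⊡ p₃ ⊕ *-nonNeg p₁ p₂ ⊡ p₃ ⊕ *-nonNeg p₁ p₂)
    (solve (d ∷ₗ k ∷ₗ p ∷ₗ r ∷ₗ []ₗ) ℚ-ring)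

-- For d = 8X the first summand cancels 4ᵈ, and X + 5 absorbs the factor d, because 8X · 2⁻ˣ / 32 ≤
-- ¼.
dense-exponent : ℕ → ℕ
dense-exponent X = (8 ℕ.* X ℕ.+ 8 ℕ.* X) ℕ.+ (X ℕ.+ 5)

-- The Kahn–Kalai–Linial argument.
influence-of-dense : ∀ {n} (f : Cube n → ℚ) → IsBoolean f → ∀ X → 0ℚ < fromℕ X → 0ℚ < E f → E f ≤ + 7 / 8 →
  Σᶠ (η f) ≤ fromℕ X * E f → ¬ (∀ i → η f i ≤ ½ ^ℚ (dense-exponent X ℕ.+ dense-exponent X))
influence-of-dense {n} f f01 X 0<X 0<α α≤⅞ H≤ small = <-irrefl refl (<-≤-trans (*-pos 0<X 0<α)
  (contradictory (fromℕ X) α (fromℕ d) (fromℕ d * 4^ d * y) H (≤-trans total (≤-reflexive (cong (λ z → ½ * H + z) (sym (*-assoc (fromℕ d * 4^ d) y H))))) d≡ α≤⅞ (<⇒≤ 0<α) (<⇒≤ 0<X) H≤ factor≤¼ 0≤factor))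
  where
  α = E f
  -- Since α ≤ 7/8, the variance α (1 - α) is at least α / 8, so `d` times it is at least X α. The
  -- spectral bound allows only ¾ H ≤ ¾ X α.
  d = 8 ℕ.* X
  s = dense-exponent X
  y = ½ ^ℚ s
  H = Σᶠ (η f)
  d≡ : fromℕ d ≡ fromℕ 8 * fromℕ X
  d≡ = fromℕ-* 8 X
  E-f² : E (λ x → f x * f x) ≡ α
  E-f² = E-cong (λ x → go (f01 x))
    where
    go : ∀ {p} → p ≡ 0ℚ ⊎ p ≡ 1ℚ → p * p ≡ p
    go (inj₁ refl) = refl
    go (inj₂ refl) = refl
  variance : spectral (λ k → fromℕ d * (1ℚ + - 1ℚ * δ₀ k)) f ≡ fromℕ d * (α + - 1ℚ * (α * α))
  variance = trans (spectral-* (fromℕ d) (λ k → 1ℚ + - 1ℚ * δ₀ k) f) (cong (fromℕ d *_)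
    (trans (spectral-+ (λ _ → 1ℚ) (λ k → - 1ℚ * δ₀ k) f) (cong₂ _+_ (trans (parseval f) E-f²)
      (trans (spectral-* (- 1ℚ) δ₀ f) (cong (- 1ℚ *_) (spectral-δ₀ f))))))
  energy : spectral (λ k → fromℕ k * 1ℚ) f ≡ ½ * H
  energy = trans (sym (Σ-spectral-∂ (λ _ → 1ℚ) f)) (trans
    (Σᶠ-cong (λ i → trans (parseval (∂ i f)) (trans (E-cong (λ x → go (f01 x) (f01 (flipAt i x)))) (E-* ½ (D i f)))))
    (Σᶠ-* ½ (η f)))
    where
    go : ∀ {p r} → p ≡ 0ℚ ⊎ p ≡ 1ℚ → r ≡ 0ℚ ⊎ r ≡ 1ℚ → ½ * (p - r) * (½ * (p - r)) ≡ ½ * (½ * ∣ p - r ∣)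
    go (inj₁ refl) (inj₁ refl) = refl
    go (inj₁ refl) (inj₂ refl) = refl
    go (inj₂ refl) (inj₁ refl) = refl
    go (inj₂ refl) (inj₂ refl) = refl
  noisy : spectral (λ k → fromℕ d * 4^ d * (fromℕ k * ¼ ^ℚ k)) f ≤ fromℕ d * 4^ d * (y * H)
  noisy = ≤-trans (≤-reflexive (spectral-* (fromℕ d * 4^ d) (λ k → fromℕ k * ¼ ^ℚ k) f))
    (*-nonNeg (fromℕ-nonNeg d) (^ℚ-nonNeg (fromℕ-nonNeg 4) d) ⊡ ≤-trans
      (≤-reflexive (trans (sym (Σ-spectral-∂ (¼ ^ℚ_) f)) (Σᶠ-cong (λ i → spectral-noise (∂ i f)))))
      (≤-trans (Σᶠ-mono (λ i → ≤-trans (noise-∂≤ f f01 i s (small i)) (≤-reflexive (*-comm (η f i) y)))) (≤-reflexive (Σᶠ-* y (η f)))))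
  total : fromℕ d * (α + - 1ℚ * (α * α)) ≤ ½ * H + fromℕ d * 4^ d * (y * H)
  total = ≤-trans (≤-reflexive (sym variance)) (≤-trans (spectral-mono f (variance-weight d))
    (≤-trans (≤-reflexive (spectral-+ (λ k → fromℕ k * 1ℚ) (λ k → fromℕ d * 4^ d * (fromℕ k * ¼ ^ℚ k)) f))
      (≤-reflexive energy ⊕ noisy)))
  y≡ : y ≡ ½ ^ℚ d * ½ ^ℚ d * (½ ^ℚ X * ½ ^ℚ 5)
  y≡ = trans (½^-+ (d ℕ.+ d) (X ℕ.+ 5)) (cong₂ _*_ (½^-+ d d) (½^-+ X 5))
  0≤factor : 0ℚ ≤ fromℕ d * 4^ d * y
  0≤factor = *-nonNeg (*-nonNeg (fromℕ-nonNeg d) (^ℚ-nonNeg (fromℕ-nonNeg 4) d)) (½^-nonNeg s)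
  factor≤¼ : fromℕ d * 4^ d * y ≤ ½ * ½
  factor≤¼ = arith (fromℕ d) (4^ d) y (½ ^ℚ d * ½ ^ℚ d) (½ ^ℚ X) (fromℕ X) d≡ y≡ (4^*½^*½^≡1 d) (fromℕ*½^≤1 X)
    where
    cancel : ∀ X p h hX → fromℕ 8 * X * p * (h * (hX * ½ ^ℚ 5)) ≡ ½ * ½ * (p * h) * (X * hX)
    cancel = solve-∀ ℚ-ring
    arith : ∀ d p y h hX X → d ≡ fromℕ 8 * X → y ≡ h * (hX * ½ ^ℚ 5) → p * h ≡ 1ℚ → X * hX ≤ 1ℚ → d * p * y ≤ ½ * ½
    arith _ p _ h hX X refl refl ph≡1 le = ≤-trans (≤-reflexive (trans (cancel X p h hX) (cong (λ z → ½ * ½ * z * (X * hX)) ph≡1)))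
      (≤-trans ((½ * ½ * 1ℚ) ⊙ le) (≤ᵇ⇒≤ _))
  contradictory : ∀ X α d F H → d * (α + - 1ℚ * (α * α)) ≤ ½ * H + F * H → d ≡ fromℕ 8 * X → α ≤ + 7 / 8 →
    0ℚ ≤ α → 0ℚ ≤ X → H ≤ X * α → F ≤ ½ * ½ → 0ℚ ≤ F → X * α ≤ 0ℚ
  contradictory X α _ F H p₁ refl p₂ p₃ p₄ p₅ p₆ p₇ = linear
    (fromℕ 4 ⊙ p₁ ⊕ fromℕ 32 ⊙ *-nonNeg p₃ p₄ ⊡ p₂ ⊕ fromℕ 2 ⊙ p₅ ⊕ fromℕ 4 ⊙ p₇ ⊡ p₅ ⊕ fromℕ 4 ⊙ *-nonNeg p₃ p₄ ⊡ p₆)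
    (solve (X ∷ₗ α ∷ₗ F ∷ₗ H ∷ₗ []ₗ) ℚ-ring)

-- Counting

influential-direction : ∀ {n} (f : Cube n → ℚ) → IsBoolean f → ∀ t κ → 0ℚ < E f → E f ≤ + 7 / 8 →
  ½ ^ℚ suc t ≤ E f → E f ≤ ½ ^ℚ t → Σᶠ (η f) ≤ fromℕ (t ℕ.+ suc κ) * E f →
  ∃ λ i → ½ ^ℚ sparse-exponent κ * E f ≤ η f i
influential-direction {n} f f01 t κ 0<α α≤⅞ ½^≤α α≤½^t H≤ with Finₚ.any? (λ i → (½ ^ℚ sparse-exponent κ * E f) ℚₚ.≤? η f i)
... | yes found = found
... | no none = ⊥-elim (go (ℕₚ.≤-total (34 ℕ.+ 8 ℕ.* κ) t))
  where
  α = E f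
  M = sparse-exponent κ
  small : ∀ i → η f i ≤ ½ ^ℚ (t ℕ.+ M)
  small i = ≤-trans (<⇒≤ (≰⇒> (λ le → none (i , le)))) (≤-trans (½^-nonNeg M ⊡ α≤½^t)
    (≤-reflexive (trans (*-comm (½ ^ℚ M) (½ ^ℚ t)) (sym (½^-+ t M)))))
  ½^t≤2α : ½ ^ℚ t ≤ fromℕ 2 * α
  ½^t≤2α = arith (½ ^ℚ t) α ½^≤α
    where
    arith : ∀ h α → ½ * h ≤ α → h ≤ fromℕ 2 * α
    arith h α p = linear (fromℕ 2 ⊙ p) (solve (h ∷ₗ α ∷ₗ []ₗ) ℚ-ring)
  X = t ℕ.+ suc κ
  0<X : 0ℚ < fromℕ X
  0<X = <-≤-trans (positive⁻¹ 1ℚ) (≤-trans (fromℕ-mono {1} {suc κ} (ℕ.s≤s ℕ.z≤n)) (fromℕ-mono (ℕₚ.m≤n+m (suc κ) t)))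
  -- In this range X ≤ 35 + 9 κ, so twice the dense exponent is at most 1200 + 306 κ, which is below
  -- 8000 (κ + 1).
  dense≤sparse : t ℕ.≤ 34 ℕ.+ 8 ℕ.* κ → dense-exponent X ℕ.+ dense-exponent X ℕ.≤ t ℕ.+ M
  dense≤sparse t≤ = ℕₚ.≤-trans (ℕₚ.+-mono-≤ (dense-mono X≤) (dense-mono X≤))
    (ℕₚ.≤-trans (ℕₚ.m≤m+n _ (6800 ℕ.+ 7694 ℕ.* κ)) (ℕₚ.≤-trans (ℕₚ.≤-reflexive (eq κ)) (ℕₚ.m≤n+m M t)))
    where
    X≤ : X ℕ.≤ 35 ℕ.+ 9 ℕ.* κ
    X≤ = ℕₚ.≤-trans (ℕₚ.+-monoˡ-≤ (suc κ) t≤) (ℕₚ.≤-reflexive (eq′ κ))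
      where
      eq′ : ∀ κ → 34 ℕ.+ 8 ℕ.* κ ℕ.+ suc κ ≡ 35 ℕ.+ 9 ℕ.* κ
      eq′ = ℕSolver.solve-∀
    dense-mono : ∀ {a b} → a ℕ.≤ b → dense-exponent a ℕ.≤ dense-exponent b
    dense-mono a≤b = ℕₚ.+-mono-≤ (ℕₚ.+-mono-≤ (ℕₚ.*-monoʳ-≤ 8 a≤b) (ℕₚ.*-monoʳ-≤ 8 a≤b)) (ℕₚ.+-monoˡ-≤ 5 a≤b)
    eq : ∀ κ → (((8 ℕ.* (35 ℕ.+ 9 ℕ.* κ) ℕ.+ 8 ℕ.* (35 ℕ.+ 9 ℕ.* κ)) ℕ.+ ((35 ℕ.+ 9 ℕ.* κ) ℕ.+ 5)) ℕ.+
      ((8 ℕ.* (35 ℕ.+ 9 ℕ.* κ) ℕ.+ 8 ℕ.* (35 ℕ.+ 9 ℕ.* κ)) ℕ.+ ((35 ℕ.+ 9 ℕ.* κ) ℕ.+ 5))) ℕ.+ (6800 ℕ.+ 7694 ℕ.* κ)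
      ≡ 20 ℕ.* (20 ℕ.* (20 ℕ.* suc κ))
    eq = ℕSolver.solve-∀
  go : 34 ℕ.+ 8 ℕ.* κ ℕ.≤ t ⊎ t ℕ.≤ 34 ℕ.+ 8 ℕ.* κ → ⊥
  go (inj₁ t-large) = influence-of-sparse f f01 t κ 0<α α≤½^t ½^t≤2α H≤ t-large small
  go (inj₂ t-small) = influence-of-dense f f01 X 0<X 0<α α≤⅞ H≤
    (λ i → ≤-trans (small i) (½^-antimono (dense≤sparse t-small)))

fromℤ : ℤ → ℚ
fromℤ (+ n)    = fromℕ n
fromℤ -[1+ n ] = - fromℕ (suc n)

private
  toℚᵘ-fromℕ : ∀ n → Data.Rational.toℚᵘ (fromℕ n) ℚᵘ.≃ mkℚᵘ (+ n) 0
  toℚᵘ-fromℕ zero    = ℚᵘₚ.≃-refl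
  toℚᵘ-fromℕ (suc n) = ℚᵘₚ.≃-trans (toℚᵘ-homo-+ 1ℚ (fromℕ n))
    (ℚᵘₚ.≃-trans (ℚᵘₚ.+-congʳ (Data.Rational.toℚᵘ 1ℚ) (toℚᵘ-fromℕ n)) (*≡* (eq (+ n))))
    where
    eq : ∀ i → (+ 1 ℤ.* + 1 ℤ.+ i ℤ.* + 1) ℤ.* + 1 ≡ (+ 1 ℤ.+ i) ℤ.* (+ 1 ℤ.* + 1)
    eq = ℤSolver.solve-∀

  toℚᵘ-fromℤ : ∀ i → Data.Rational.toℚᵘ (fromℤ i) ℚᵘ.≃ mkℚᵘ i 0
  toℚᵘ-fromℤ (+ n)    = toℚᵘ-fromℕ n
  toℚᵘ-fromℤ -[1+ n ] = ℚᵘₚ.≃-trans (toℚᵘ-homo‿- (fromℕ (suc n))) (ℚᵘₚ.-‿cong (toℚᵘ-fromℕ (suc n)))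

/-*-cancel : ∀ i k .{{_ : ℕ.NonZero k}} → (i / k) * fromℕ k ≡ fromℤ i
/-*-cancel i (suc k) = toℚᵘ-injective (ℚᵘₚ.≃-trans (toℚᵘ-homo-* (i / suc k) (fromℕ (suc k)))
  (ℚᵘₚ.≃-trans (ℚᵘₚ.*-cong (toℚᵘ-fromℚᵘ (mkℚᵘ i k)) (toℚᵘ-fromℕ (suc k)))
    (ℚᵘₚ.≃-trans (*≡* (eq i (+ suc k))) (ℚᵘₚ.≃-sym (toℚᵘ-fromℤ i)))))
  where
  eq : ∀ i k → (i ℤ.* k) ℤ.* + 1 ≡ i ℤ.* (k ℤ.* + 1)
  eq = ℤSolver.solve-∀

/1≡fromℕ : ∀ n → + n / 1 ≡ fromℕ n
/1≡fromℕ n = trans (sym (*-identityʳ (+ n / 1))) (/-*-cancel (+ n) 1)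

↥↧-spec : ∀ x → x * fromℕ (↧ₙ x) ≡ fromℤ (↥ x)
↥↧-spec x = trans (cong (_* fromℕ (↧ₙ x)) (sym (↥p/↧p≡p x))) (/-*-cancel (↥ x) (↧ₙ x))

indicator : ∀ {n} → Family n → Cube n → ℚ
indicator A x = if A x then 1ℚ else 0ℚ

indicator-boolean : ∀ {n} (A : Family n) → IsBoolean (indicator A)
indicator-boolean A x with A x
... | true  = inj₂ refl
... | false = inj₁ refl

fromℕ-count : ∀ {n} (P : Cube n → Bool) → fromℕ (count P) ≡ fromℕ (2 ℕ.^ n) * E (indicator P)
fromℕ-count {zero} P with P []
... | true  = refl
... | false = refl
fromℕ-count {suc n} P = begin
  fromℕ (ListAction.sum (List.map h (List.map (true ∷_) (cube n) List.++ List.map (false ∷_) (cube n))))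
    ≡⟨ cong (fromℕ ∘ ListAction.sum) (Listₚ.map-++ h (List.map (true ∷_) (cube n)) (List.map (false ∷_) (cube n))) ⟩
  fromℕ (ListAction.sum (List.map h (List.map (true ∷_) (cube n)) List.++ List.map h (List.map (false ∷_) (cube n))))
    ≡⟨ cong fromℕ (ListActionₚ.sum-++ (List.map h (List.map (true ∷_) (cube n))) (List.map h (List.map (false ∷_) (cube n)))) ⟩
  fromℕ (ListAction.sum (List.map h (List.map (true ∷_) (cube n))) ℕ.+ ListAction.sum (List.map h (List.map (false ∷_) (cube n))))
    ≡⟨ fromℕ-+ (ListAction.sum (List.map h (List.map (true ∷_) (cube n)))) (ListAction.sum (List.map h (List.map (false ∷_) (cube n)))) ⟩
  fromℕ (ListAction.sum (List.map h (List.map (true ∷_) (cube n)))) + fromℕ (ListAction.sum (List.map h (List.map (false ∷_) (cube n))))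
    ≡⟨ cong₂ (λ a b → fromℕ (ListAction.sum a) + fromℕ (ListAction.sum b)) (sym (Listₚ.map-∘ (cube n))) (sym (Listₚ.map-∘ (cube n))) ⟩
  fromℕ (count (P ∘ (true ∷_))) + fromℕ (count (P ∘ (false ∷_)))
    ≡⟨ cong₂ _+_ (fromℕ-count (P ∘ (true ∷_))) (fromℕ-count (P ∘ (false ∷_))) ⟩
  fromℕ (2 ℕ.^ n) * e₁ + fromℕ (2 ℕ.^ n) * e₀
    ≡⟨ eq (fromℕ (2 ℕ.^ n)) e₁ e₀ ⟩
  fromℕ 2 * fromℕ (2 ℕ.^ n) * (½ * (e₁ + e₀))
    ≡⟨ cong (_* (½ * (e₁ + e₀))) (sym (fromℕ-* 2 (2 ℕ.^ n))) ⟩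
  fromℕ (2 ℕ.^ suc n) * (½ * (e₁ + e₀)) ∎
  where
  open ≡-Reasoning
  h : Cube (suc n) → ℕ
  h x = if P x then 1 else 0
  e₁ e₀ : ℚ
  e₁ = E (indicator (P ∘ (true ∷_)))
  e₀ = E (indicator (P ∘ (false ∷_)))
  eq : ∀ k a b → k * a + k * b ≡ fromℕ 2 * k * (½ * (a + b))
  eq = solve-∀ ℚ-ring

fromℕ-pos : ∀ n .{{_ : ℕ.NonZero n}} → 0ℚ < fromℕ n
fromℕ-pos (suc n) = <-≤-trans (positive⁻¹ 1ℚ) (fromℕ-mono {1} {suc n} (ℕ.s≤s ℕ.z≤n))

*-cancelʳ-≡-pos : ∀ {p r} s → 0ℚ < s → p * s ≡ r * s → p ≡ r
*-cancelʳ-≡-pos s 0<s eq = ≤-antisym (*-cancelʳ-≤-pos s {{positive 0<s}} (≤-reflexive eq))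
  (*-cancelʳ-≤-pos s {{positive 0<s}} (≤-reflexive (sym eq)))

0<2^ : ∀ n → 0ℚ < fromℕ (2 ℕ.^ n)
0<2^ n = fromℕ-pos (2 ℕ.^ n) {{ℕₚ.m^n≢0 2 n}}

count/2^n : ∀ {n} (P : Cube n → Bool) → _/_ (+ count P) (2 ℕ.^ n) {{ℕₚ.m^n≢0 2 n}} ≡ E (indicator P)
count/2^n {n} P = *-cancelʳ-≡-pos (fromℕ (2 ℕ.^ n)) (0<2^ n)
  (trans (/-*-cancel (+ count P) (2 ℕ.^ n) {{ℕₚ.m^n≢0 2 n}}) (trans (fromℕ-count P) (*-comm (fromℕ (2 ℕ.^ n)) (E (indicator P)))))

indicator-xor : ∀ a b → (if a xor b then 1ℚ else 0ℚ) ≡ ∣ (if a then 1ℚ else 0ℚ) - (if b then 1ℚ else 0ℚ) ∣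
indicator-xor true  true  = refl
indicator-xor true  false = refl
indicator-xor false true  = refl
indicator-xor false false = refl

E-boundary : ∀ {n} (A : Family n) i → ½ * E (indicator (λ x → A x xor A (flipAt i x))) ≡ η (indicator A) i
E-boundary A i = trans (sym (E-* ½ (indicator (λ x → A x xor A (flipAt i x)))))
  (E-cong (λ x → cong (½ *_) (indicator-xor (A x) (A (flipAt i x)))))

influence≡2η : ∀ {n} (A : Family n) i → influence A i ≡ fromℕ 2 * η (indicator A) i
influence≡2η A i = trans (count/2^n (λ x → A x xor A (flipAt i x)))
  (trans (double (E (indicator (λ x → A x xor A (flipAt i x))))) (cong (fromℕ 2 *_) (E-boundary A i)))
  where
  double : ∀ p → p ≡ fromℕ 2 * (½ * p)
  double = solve-∀ ℚ-ring

-- Invariance under flipping `i` puts exactly half of the mass on each face. This reconciles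
-- `edgeBoundary`, which lists an edge by its lower end, with η, which sees both ends.
E-lower-face : ∀ {n} (s : Cube n → Bool) i → (∀ x → s (flipAt i x) ≡ s x) →
  E (indicator (λ x → not (lookup x i) ∧ s x)) ≡ ½ * E (indicator s)
E-lower-face {suc n} s zero inv = cong (½ *_) (trans (cong (_+ E (indicator (s ∘ (false ∷_)))) (E-const n 0ℚ))
  (trans (+-identityˡ (E (indicator (s ∘ (false ∷_))))) (trans (sym (½*p+p≡p (E (indicator (s ∘ (false ∷_))))))
    (cong (λ z → ½ * (z + E (indicator (s ∘ (false ∷_))))) (E-cong (λ x → cong (λ b → if b then 1ℚ else 0ℚ) (inv (true ∷ x))))))))
E-lower-face s (suc i) inv = trans
  (cong₂ (λ a b → ½ * (a + b)) (E-lower-face (s ∘ (true ∷_)) i (inv ∘ (true ∷_))) (E-lower-face (s ∘ (false ∷_)) i (inv ∘ (false ∷_))))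
  (cong (½ *_) (sym (*-distribˡ-+ ½ (E (indicator (s ∘ (true ∷_)))) (E (indicator (s ∘ (false ∷_)))))))

fromℕ-sum-tabulate : ∀ {n} (g : Fin n → ℕ) → fromℕ (ListAction.sum (List.tabulate g)) ≡ Σᶠ (fromℕ ∘ g)
fromℕ-sum-tabulate {zero}  g = refl
fromℕ-sum-tabulate {suc n} g = trans (fromℕ-+ (g zero) (ListAction.sum (List.tabulate (g ∘ suc))))
  (cong (λ z → fromℕ (g zero) + z) (fromℕ-sum-tabulate (g ∘ suc)))

fromℕ-edgeBoundary : ∀ {n} (A : Family n) → fromℕ (edgeBoundary A) ≡ fromℕ (2 ℕ.^ n) * Σᶠ (η (indicator A))
fromℕ-edgeBoundary {n} A = begin
  fromℕ (ListAction.sum (List.map g (List.tabulate id)))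
    ≡⟨ cong (fromℕ ∘ ListAction.sum) (Listₚ.map-tabulate id g) ⟩
  fromℕ (ListAction.sum (List.tabulate g))
    ≡⟨ fromℕ-sum-tabulate g ⟩
  Σᶠ (fromℕ ∘ g)
    ≡⟨ Σᶠ-cong (λ i → trans (fromℕ-count (λ x → not (lookup x i) ∧ (A x xor A (flipAt i x))))
         (cong (fromℕ (2 ℕ.^ n) *_) (trans (E-lower-face (λ x → A x xor A (flipAt i x)) i (xor-flip i)) (E-boundary A i)))) ⟩
  Σᶠ (λ i → fromℕ (2 ℕ.^ n) * η (indicator A) i)
    ≡⟨ Σᶠ-* (fromℕ (2 ℕ.^ n)) (η (indicator A)) ⟩
  fromℕ (2 ℕ.^ n) * Σᶠ (η (indicator A)) ∎
  where
  open ≡-Reasoning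
  g : Fin n → ℕ
  g i = count (λ x → not (lookup x i) ∧ (A x xor A (flipAt i x)))
  xor-flip : ∀ i x → A (flipAt i x) xor A (flipAt i (flipAt i x)) ≡ A x xor A (flipAt i x)
  xor-flip i x = trans (cong (λ y → A (flipAt i x) xor A y) (flip-involutive i x)) (Boolₚ.xor-comm (A (flipAt i x)) (A x))

-- Binary logarithms through integer powers

2ℚ : ℚ
2ℚ = + 2 / 1

^ℚ-mono : ∀ {p r} → 0ℚ ≤ p → p ≤ r → ∀ k → p ^ℚ k ≤ r ^ℚ k
^ℚ-mono 0≤p p≤r zero    = ≤-refl
^ℚ-mono {p} {r} 0≤p p≤r (suc k) = ≤-trans (0≤p ⊡ ^ℚ-mono 0≤p p≤r k)
  (*-monoʳ-≤-nonNeg (r ^ℚ k) {{nonNegative (^ℚ-nonNeg (≤-trans 0≤p p≤r) k)}} p≤r)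

^ℚ-+ : ∀ p m n → p ^ℚ (m ℕ.+ n) ≡ p ^ℚ m * p ^ℚ n
^ℚ-+ p zero    n = sym (*-identityˡ (p ^ℚ n))
^ℚ-+ p (suc m) n = trans (cong (p *_) (^ℚ-+ p m n)) (sym (*-assoc p (p ^ℚ m) (p ^ℚ n)))

^ℚ-distrib-* : ∀ p r n → (p * r) ^ℚ n ≡ p ^ℚ n * r ^ℚ n
^ℚ-distrib-* p r zero    = refl
^ℚ-distrib-* p r (suc n) = trans (cong (p * r *_) (^ℚ-distrib-* p r n)) (interchange p r (p ^ℚ n) (r ^ℚ n))
  where
  interchange : ∀ a b c d → a * b * (c * d) ≡ a * c * (b * d)
  interchange = solve-∀ ℚ-ring

1^ℚ : ∀ n → 1ℚ ^ℚ n ≡ 1ℚ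
1^ℚ zero    = refl
1^ℚ (suc n) = trans (*-identityˡ (1ℚ ^ℚ n)) (1^ℚ n)

^ℚ-* : ∀ p m n → p ^ℚ (n ℕ.* m) ≡ (p ^ℚ m) ^ℚ n
^ℚ-* p m zero    = refl
^ℚ-* p m (suc n) = trans (^ℚ-+ p m (n ℕ.* m)) (cong (p ^ℚ m *_) (^ℚ-* p m n))

^ℚ-comm : ∀ p m n → (p ^ℚ m) ^ℚ n ≡ (p ^ℚ n) ^ℚ m
^ℚ-comm p m n = trans (sym (^ℚ-* p m n)) (trans (cong (p ^ℚ_) (ℕₚ.*-comm n m)) (^ℚ-* p n m))

2^*½^≡1 : ∀ r → 2ℚ ^ℚ r * ½ ^ℚ r ≡ 1ℚ
2^*½^≡1 r = trans (sym (^ℚ-distrib-* 2ℚ ½ r)) (1^ℚ r)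

0≤2 : 0ℚ ≤ 2ℚ
0≤2 = nonNegative⁻¹ 2ℚ

1≤2^ : ∀ r → 1ℚ ≤ 2ℚ ^ℚ r
1≤2^ r = ≤-trans (≤-reflexive (sym (1^ℚ r))) (^ℚ-mono 0≤1 (≤ᵇ⇒≤ _) r)

2^-cancel-≤ : ∀ m n → 2ℚ ^ℚ m ≤ 2ℚ ^ℚ n → m ℕ.≤ n
2^-cancel-≤ zero    n       _  = ℕ.z≤n
2^-cancel-≤ (suc m) zero    le = ⊥-elim (<-irrefl refl (<-≤-trans 1<2 (≤-trans (0≤2 ⊡ 1≤2^ m) le)))
  where
  1<2 : 1ℚ < 2ℚ * 1ℚ
  1<2 = ≰⇒> λ { (Data.Rational.*≤* (ℤ.+≤+ (ℕ.s≤s ()))) }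
2^-cancel-≤ (suc m) (suc n) le = ℕ.s≤s (2^-cancel-≤ m n (*-cancelˡ-≤-pos 2ℚ le))

*½^≤1⇒≤2^ : ∀ z r → z * ½ ^ℚ r ≤ 1ℚ → z ≤ 2ℚ ^ℚ r
*½^≤1⇒≤2^ z r le = ≤-trans (≤-reflexive (trans (sym (*-identityʳ z)) (trans (cong (z *_) (sym (2^*½^≡1 r)))
  (rearrange z (2ℚ ^ℚ r) (½ ^ℚ r))))) (≤-trans (^ℚ-nonNeg 0≤2 r ⊡ le) (≤-reflexive (*-identityʳ (2ℚ ^ℚ r))))
  where
  rearrange : ∀ z a b → z * (a * b) ≡ a * (z * b)
  rearrange = solve-∀ ℚ-ring

↧-pos : ∀ x → 0ℚ < fromℕ (↧ₙ x)
↧-pos x = fromℕ-pos (↧ₙ x)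

-- With x = p/den, the inequalities 2^p ≤ y^den and y^s ≤ 2^r give 2^(sp) ≤ 2^(den r), and exponents
-- can be compared. Values s > 1 give access to fractional bounds r/s on the logarithm. A negative
-- numerator makes the claim trivial, `r` being natural.
log-upper : ∀ x y s r → x ≤log₂ y → 0ℚ ≤ y → y ^ℚ s ≤ 2ℚ ^ℚ r → fromℕ s * x ≤ fromℕ r
log-upper x y s r x≤log₂y 0≤y y^s≤2^r = go (↥ x) (↥↧-spec x) x≤log₂y
  where
  den = ↧ₙ x
  go : ∀ num → x * fromℕ den ≡ fromℤ num → pow2ℤ num * 1ℚ ^ℚ den ≤ y ^ℚ den → fromℕ s * x ≤ fromℕ r
  go (+ p) eq le = *-cancelʳ-≤-pos (fromℕ den) {{positive (↧-pos x)}}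
    (≤-trans (≤-reflexive (trans (*-assoc (fromℕ s) x (fromℕ den)) (trans (cong (fromℕ s *_) eq) (sym (fromℕ-* s p)))))
      (≤-trans (fromℕ-mono (2^-cancel-≤ (s ℕ.* p) (den ℕ.* r) powers)) (≤-reflexive (trans (fromℕ-* den r) (*-comm (fromℕ den) (fromℕ r))))))
    where
    2^p≤y^den : 2ℚ ^ℚ p ≤ y ^ℚ den
    2^p≤y^den = ≤-trans (≤-reflexive (sym (trans (cong (2ℚ ^ℚ p *_) (1^ℚ den)) (*-identityʳ (2ℚ ^ℚ p))))) le
    powers : 2ℚ ^ℚ (s ℕ.* p) ≤ 2ℚ ^ℚ (den ℕ.* r)
    powers = ≤-trans (≤-reflexive (^ℚ-* 2ℚ p s)) (≤-trans (^ℚ-mono (^ℚ-nonNeg 0≤2 p) 2^p≤y^den s)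
      (≤-trans (≤-reflexive (^ℚ-comm y den s)) (≤-trans (^ℚ-mono (^ℚ-nonNeg 0≤y s) y^s≤2^r den)
        (≤-reflexive (sym (^ℚ-* 2ℚ r den))))))
  go -[1+ k ] eq _ = ≤-trans (≤-trans (fromℕ-nonNeg s ⊡ x≤0) (≤-reflexive (*-zeroʳ (fromℕ s)))) (fromℕ-nonNeg r)
    where
    x≤0 : x ≤ 0ℚ
    x≤0 = *-cancelʳ-≤-pos (fromℕ den) {{positive (↧-pos x)}} (≤-trans (≤-reflexive eq)
      (≤-trans (neg-antimono-≤ (fromℕ-nonNeg (suc k))) (≤-reflexive (sym (*-zeroˡ (fromℕ den))))))

-- Raise the hypothesis to the power den and compare 2^(-M den) with the power of ½ that encodes the
-- negative numerator; `0 < - x` rules out the other constructor.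
2^-lower : ∀ x M {b y} → 0ℚ < - x → fromℕ M ≤ - x → 0ℚ ≤ b → ½ ^ℚ M * b ≤ y → 2^[ x ]· b ≤ y
2^-lower x M {b} {y} 0<-x M≤-x 0≤b le = go (↥ x) (↥↧-spec x)
  where
  den = ↧ₙ x
  finish : ∀ num → pow2ℤ num ≤ (½ ^ℚ M) ^ℚ den → pow2ℤ num * b ^ℚ den ≤ y ^ℚ den
  finish num p = ≤-trans (*-monoʳ-≤-nonNeg (b ^ℚ den) {{nonNegative (^ℚ-nonNeg 0≤b den)}} p)
    (≤-trans (≤-reflexive (sym (^ℚ-distrib-* (½ ^ℚ M) b den))) (^ℚ-mono (*-nonNeg (½^-nonNeg M) 0≤b) le den))
  0<-num : ∀ num → x * fromℕ den ≡ fromℤ num → 0ℚ < - fromℤ num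
  0<-num num eq = <-≤-trans (*-pos 0<-x (↧-pos x)) (≤-reflexive (trans (sym (neg-distribˡ-* x (fromℕ den))) (cong -_ eq)))
  go : ∀ num → x * fromℕ den ≡ fromℤ num → pow2ℤ num * b ^ℚ den ≤ y ^ℚ den
  go (+ p) eq = ⊥-elim (<-irrefl refl (<-≤-trans (0<-num (+ p) eq) (neg-antimono-≤ (fromℕ-nonNeg p))))
  go -[1+ k ] eq = finish -[1+ k ] (≤-trans (½^-antimono {den ℕ.* M} {suc k} (fromℕ-cancel-≤ {den ℕ.* M} {suc k} den*M≤)) (≤-reflexive (^ℚ-* ½ M den)))
    where
    fromℕ-cancel-≤ : ∀ {m n} → fromℕ m ≤ fromℕ n → m ℕ.≤ n
    fromℕ-cancel-≤ {zero}          _  = ℕ.z≤n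
    fromℕ-cancel-≤ {suc m} {zero}  le = ⊥-elim (<-irrefl refl (<-≤-trans (fromℕ-pos (suc m)) le))
    fromℕ-cancel-≤ {suc m} {suc n} le = ℕ.s≤s (fromℕ-cancel-≤ (cancel (fromℕ m) (fromℕ n) le))
      where
      cancel : ∀ a b → 1ℚ + a ≤ 1ℚ + b → a ≤ b
      cancel a b p = linear p (solve (a ∷ₗ b ∷ₗ []ₗ) ℚ-ring)
    den*M≤ : fromℕ (den ℕ.* M) ≤ fromℕ (suc k)
    den*M≤ = ≤-trans (≤-reflexive (fromℕ-* den M)) (≤-trans (fromℕ-nonNeg den ⊡ M≤-x)
      (≤-reflexive (trans (swap (fromℕ den) x) (trans (cong -_ eq) (double-neg (fromℕ (suc k)))))))
      where
      swap : ∀ d x → d * - x ≡ - (x * d)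
      swap = solve-∀ ℚ-ring
      double-neg : ∀ p → - (- p) ≡ p
      double-neg = solve-∀ ℚ-ring

dyadic-scale : ∀ k {α} → ½ ^ℚ k ≤ α → α ≤ 1ℚ → ∃ λ t → ½ ^ℚ suc t ≤ α × α ≤ ½ ^ℚ t
dyadic-scale zero    {α} 1≤α α≤1 = 0 , ≤-trans (≤ᵇ⇒≤ _) 1≤α , α≤1
dyadic-scale (suc k) {α} ½^≤α α≤1 with ≤-total (½ ^ℚ k) α
... | inj₁ ½^k≤α = dyadic-scale k ½^k≤α α≤1
... | inj₂ α≤½^k = k , ½^≤α , α≤½^k

-- The alternative κ ≡ 0 covers negative K, where `1 ≤ 1 + K` fails; otherwise rounding up costs at
-- most 1.
nat-ceiling : ∀ n {K} → K ≤ fromℕ n → ∃ λ κ → K ≤ fromℕ κ × (κ ≡ 0 ⊎ fromℕ κ ≤ 1ℚ + K × 1ℚ ≤ 1ℚ + K)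
nat-ceiling zero    K≤ = 0 , K≤ , inj₁ refl
nat-ceiling (suc n) {K} K≤ with ≤-total K (fromℕ n)
... | inj₁ K≤n = nat-ceiling n K≤n
... | inj₂ n≤K = suc n , K≤ , inj₂ (+-monoʳ-≤ 1ℚ n≤K , +-monoʳ-≤ 1ℚ (≤-trans (fromℕ-nonNeg n) n≤K))

archimedean : ∀ K → ∃ λ n → K ≤ fromℕ n
archimedean K = go (↥ K) (↥↧-spec K)
  where
  go : ∀ num → K * fromℕ (↧ₙ K) ≡ fromℤ num → ∃ λ n → K ≤ fromℕ n
  go (+ p) eq = p , *-cancelʳ-≤-pos (fromℕ (↧ₙ K)) {{positive (↧-pos K)}} (≤-trans (≤-reflexive eq)
    (≤-trans (≤-reflexive (sym (*-identityʳ (fromℕ p)))) (fromℕ-nonNeg p ⊡ fromℕ-mono {1} {↧ₙ K} (ℕ.s≤s ℕ.z≤n))))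
  go -[1+ k ] eq = 0 , *-cancelʳ-≤-pos (fromℕ (↧ₙ K)) {{positive (↧-pos K)}} (≤-trans (≤-reflexive eq)
    (≤-trans (neg-antimono-≤ (fromℕ-nonNeg (suc k))) (≤-reflexive (sym (*-zeroˡ (fromℕ (↧ₙ K)))))))

-- Since t + log₂ u = log₂ y, with u = y/2^{t+1} ∈ [½, 1], the hypothesis on the
-- boundary and the (almost sharp) edge-isoperimetric inequality keep K away from -1.
excess-lower : ∀ t y r K u → u ≡ y * ½ ^ℚ suc t → ½ ≤ u → u ≤ 1ℚ → (r - K) ≤log₂ y → 0ℚ ≤ y →
  fromℕ t - 1ℚ + (+ 15 / 8) * u ≤ r → + 3 / 10 ≤ K + 1ℚ
excess-lower t y r K u u≡ ½≤u u≤1 log 0≤y r≥ with ≤-total u (+ 3 / 4)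
-- Here log₂ y ≤ t + 1 suffices, since 15/8 · 3/4 - 1 = 13/32 > 3/10.
... | inj₂ ¾≤u = arith (fromℕ t) r K u (log-upper (r - K) y 1 (suc t) log 0≤y
    (≤-trans (≤-reflexive (*-identityʳ y)) (*½^≤1⇒≤2^ y (suc t) (≤-trans (≤-reflexive (sym u≡)) u≤1)))) ¾≤u r≥
  where
  arith : ∀ t r K u → fromℕ 1 * (r - K) ≤ 1ℚ + t → + 3 / 4 ≤ u → t - 1ℚ + (+ 15 / 8) * u ≤ r → + 3 / 10 ≤ K + 1ℚ
  arith t r K u p₁ p₂ p₃ = linear (p₁ ⊕ (+ 15 / 8) ⊙ p₂ ⊕ p₃ ⊕ nonNegative⁻¹ (+ 17 / 160)) (solve (t ∷ₗ r ∷ₗ K ∷ₗ u ∷ₗ []ₗ) ℚ-ring)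
-- As (3/4)⁵ < 1/4, the fifth power improves the bound to log₂ y ≤ t + 3/5. This is enough even at u
-- = ½, where 15/16 - 3/5 = 27/80 > 3/10.
... | inj₁ u≤¾ = arith (fromℕ t) r K u (≤-trans (log-upper (r - K) y 5 e log 0≤y y⁵≤) (≤-reflexive (trans (fromℕ-+ 3 (5 ℕ.* t)) (cong (λ z → fromℕ 3 + z) (fromℕ-* 5 t))))) ½≤u r≥
  where
  e = 3 ℕ.+ 5 ℕ.* t
  arith : ∀ t r K u → fromℕ 5 * (r - K) ≤ fromℕ 3 + fromℕ 5 * t → ½ ≤ u → t - 1ℚ + (+ 15 / 8) * u ≤ r → + 3 / 10 ≤ K + 1ℚ
  arith t r K u p₁ p₂ p₃ = linear ((+ 1 / 5) ⊙ p₁ ⊕ (+ 15 / 8) ⊙ p₂ ⊕ p₃ ⊕ nonNegative⁻¹ (+ 3 / 80)) (solve (t ∷ₗ r ∷ₗ K ∷ₗ u ∷ₗ []ₗ) ℚ-ring)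
  exponent : ∀ t → 5 ℕ.* suc t ≡ 3 ℕ.+ 5 ℕ.* t ℕ.+ 2
  exponent = ℕSolver.solve-∀
  u⁵≡ : u ^ℚ 5 ≡ y ^ℚ 5 * ½ ^ℚ e * ½ ^ℚ 2
  u⁵≡ = trans (cong (_^ℚ 5) u≡) (trans (^ℚ-distrib-* y (½ ^ℚ suc t) 5)
    (trans (cong (y ^ℚ 5 *_) (trans (sym (^ℚ-* ½ (suc t) 5)) (trans (cong (½ ^ℚ_) (exponent t)) (^ℚ-+ ½ e 2))))
      (sym (*-assoc (y ^ℚ 5) (½ ^ℚ e) (½ ^ℚ 2)))))
  y⁵≤ : y ^ℚ 5 ≤ 2ℚ ^ℚ e
  y⁵≤ = *½^≤1⇒≤2^ (y ^ℚ 5) e (*-cancelʳ-≤-pos (½ ^ℚ 2) {{positive (½^-pos 2)}}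
    (≤-trans (≤-reflexive (sym u⁵≡)) (≤-trans (^ℚ-mono (≤-trans 0≤½ ½≤u) u≤¾ 5) (≤ᵇ⇒≤ _))))

-- Densities of the family, the lower bound on K + 1 and the final constant

fromℕ-2^ : ∀ n → fromℕ (2 ℕ.^ n) ≡ 2ℚ ^ℚ n
fromℕ-2^ zero    = refl
fromℕ-2^ (suc n) = trans (fromℕ-* 2 (2 ℕ.^ n)) (cong (2ℚ *_) (fromℕ-2^ n))

constant : ℚ
constant = fromℕ 20 * (fromℕ 20 * (fromℕ 20 * fromℕ 15))

0<constant : 0ℚ < constant
0<constant = *-pos (fromℕ-pos 20) (*-pos (fromℕ-pos 20) (*-pos (fromℕ-pos 20) (fromℕ-pos 15)))

module Densities (K : ℚ) {n : ℕ} (A : Family n) (nonempty : card A > 0)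
  (c≤⅞2ⁿ : (+ card A / 1) ≤ (+ 7 / 8) * (+ (2 ℕ.^ n) / 1))
  (log : (_/_ (+ edgeBoundary A) (card A) {{>-nonZero nonempty}}) - K
    ≤log₂ (_/_ (+ (2 ℕ.^ n)) (card A) {{>-nonZero nonempty}})) where

  f : Cube n → ℚ
  f = indicator A

  f01 : IsBoolean f
  f01 = indicator-boolean A

  α H P c y r : ℚ
  α = E f
  H = Σᶠ (η f)
  P = fromℕ (2 ℕ.^ n)
  c = fromℕ (card A)
  y = _/_ (+ (2 ℕ.^ n)) (card A) {{>-nonZero nonempty}}
  r = _/_ (+ edgeBoundary A) (card A) {{>-nonZero nonempty}}

  private
    c≡Pα : c ≡ P * α
    c≡Pα = fromℕ-count A

    0<c : 0ℚ < c
    0<c = fromℕ-pos (card A) {{>-nonZero nonempty}}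

    quotient : ∀ p r → p * c ≡ P * r → p * α ≡ r
    quotient p r eq = *-cancelʳ-≡-pos P (0<2^ n) (trans (rearrange p α P) (trans (cong (p *_) (sym c≡Pα)) (trans eq (*-comm P r))))
      where
      rearrange : ∀ p α P → p * α * P ≡ p * (P * α)
      rearrange = solve-∀ ℚ-ring

  yα≡1 : y * α ≡ 1ℚ
  yα≡1 = quotient y 1ℚ (trans (/-*-cancel (+ (2 ℕ.^ n)) (card A) {{>-nonZero nonempty}}) (sym (*-identityʳ P)))

  rα≡H : r * α ≡ H
  rα≡H = quotient r H (trans (/-*-cancel (+ edgeBoundary A) (card A) {{>-nonZero nonempty}}) (fromℕ-edgeBoundary A))

  0<α : 0ℚ < α
  0<α = *-cancelˡ-<-nonNeg P {{nonNegative (<⇒≤ (0<2^ n))}} (subst₂ _<_ (sym (*-zeroʳ P)) c≡Pα 0<c)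

  α≤⅞ : α ≤ + 7 / 8
  α≤⅞ = *-cancelˡ-≤-pos P {{positive (0<2^ n)}} (subst₂ _≤_ (trans (/1≡fromℕ (card A)) c≡Pα)
    (trans (cong (+ 7 / 8 *_) (/1≡fromℕ (2 ℕ.^ n))) (*-comm (+ 7 / 8) P)) c≤⅞2ⁿ)

  0≤y : 0ℚ ≤ y
  0≤y = nonNegative⁻¹ y {{normalize-nonNeg (2 ℕ.^ n) (card A) {{>-nonZero nonempty}}}}

  ½^n≤α : ½ ^ℚ n ≤ α
  ½^n≤α = *-cancelˡ-≤-pos P {{positive (0<2^ n)}} (≤-trans
    (≤-reflexive (trans (cong (_* ½ ^ℚ n) (fromℕ-2^ n)) (2^*½^≡1 n)))
    (≤-trans (fromℕ-mono {1} {card A} nonempty) (≤-reflexive c≡Pα)))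

  scale : ∃ λ t → ½ ^ℚ suc t ≤ α × α ≤ ½ ^ℚ t
  scale = dyadic-scale n ½^n≤α (≤-trans α≤⅞ (≤ᵇ⇒≤ _))

  t : ℕ
  t = proj₁ scale

  u : ℚ
  u = y * ½ ^ℚ suc t

  u≤1 : u ≤ 1ℚ
  u≤1 = ≤-trans (0≤y ⊡ proj₁ (proj₂ scale)) (≤-reflexive yα≡1)

  ½≤u : ½ ≤ u
  ½≤u = arith y (½ ^ℚ t) (≤-trans (≤-reflexive (sym yα≡1)) (0≤y ⊡ proj₂ (proj₂ scale)))
    where
    arith : ∀ y h → 1ℚ ≤ y * h → ½ ≤ y * (½ * h)
    arith y h p = linear (½ ⊙ p) (solve (y ∷ₗ h ∷ₗ []ₗ) ℚ-ring)

  r-lower : fromℕ t - 1ℚ + (+ 15 / 8) * u ≤ r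
  -- Truncating `q` at N = t + 4 loses 2⁻ᵗ/16 and leaves 15/16 of 2⁻ᵗ; as y 2⁻ᵗ = 2u, this becomes
  -- 15/8 u.
  r-lower = arith (fromℕ t) α y r (½ ^ℚ t) (½ ^ℚ (t ℕ.+ 4)) (½^-+ t 4) yα≡1 0≤y
    (≤-trans (q-lower-sharp t (ℕₚ.m≤m+n t 4) (proj₁ (proj₂ scale)) (proj₂ (proj₂ scale)))
      (≤-trans (edge-isoperimetry f f01 (t ℕ.+ 4)) (≤-reflexive (sym rα≡H))))
    where
    lhs : ∀ t α y h → y * ((t - 1ℚ) * α + h - h * ½ ^ℚ 4) ≡ (t - 1ℚ) * (y * α) + (+ 15 / 8) * (y * (½ * h))
    lhs = solve-∀ ℚ-ring
    rhs : ∀ α y r → y * (r * α) ≡ r * (y * α)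
    rhs = solve-∀ ℚ-ring
    arith : ∀ t α y r h h′ → h′ ≡ h * ½ ^ℚ 4 → y * α ≡ 1ℚ → 0ℚ ≤ y → (t - 1ℚ) * α + h - h′ ≤ r * α →
      t - 1ℚ + (+ 15 / 8) * (y * (½ * h)) ≤ r
    arith t α y r h _ refl eq 0≤y p = subst₂ _≤_
      (trans (lhs t α y h) (cong (λ z → z + (+ 15 / 8) * (y * (½ * h))) (trans (cong ((t - 1ℚ) *_) eq) (*-identityʳ (t - 1ℚ)))))
      (trans (rhs α y r) (trans (cong (r *_) eq) (*-identityʳ r))) (0≤y ⊡ p)

  K+1-lower : + 3 / 10 ≤ K + 1ℚ
  K+1-lower = excess-lower t y r K u refl ½≤u u≤1 log 0≤y r-lower

  H-upper : ∀ κ → K ≤ fromℕ κ → H ≤ fromℕ (t ℕ.+ suc κ) * α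
  H-upper κ K≤κ = subst₂ _≤_ rα≡H (cong (_* α) (sym (fromℕ-+ t (suc κ))))
    (*-monoʳ-≤-nonNeg α {{nonNegative (<⇒≤ 0<α)}} (arith (fromℕ t) (fromℕ κ) K r r-K≤ K≤κ))
    where
    r-K≤ : fromℕ 1 * (r - K) ≤ 1ℚ + fromℕ t
    r-K≤ = log-upper (r - K) y 1 (suc t) log 0≤y (≤-trans (≤-reflexive (*-identityʳ y)) (*½^≤1⇒≤2^ y (suc t) u≤1))
    arith : ∀ t κ K r → fromℕ 1 * (r - K) ≤ 1ℚ + t → K ≤ κ → r ≤ t + (1ℚ + κ)
    arith t κ K r p₁ p₂ = linear (p₁ ⊕ p₂) (solve (t ∷ₗ κ ∷ₗ K ∷ₗ r ∷ₗ []ₗ) ℚ-ring)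

-- The exponent found so far is linear in κ + 1, and this step turns it into a square. For κ = 0 the
-- bound K + 1 ≥ 3/10 gives 15 (K + 1)² ≥ 27/20; otherwise K ≥ 0 and 1 + κ ≤ K + 2.
1+κ≤15[K+1]² : ∀ K κ → + 3 / 10 ≤ K + 1ℚ → κ ≡ 0 ⊎ fromℕ κ ≤ 1ℚ + K × 1ℚ ≤ 1ℚ + K →
  1ℚ + fromℕ κ ≤ fromℕ 15 * ((K + 1ℚ) * (K + 1ℚ))
1+κ≤15[K+1]² K .0 K≥ (inj₁ refl) = arith K K≥ (sq-nonNeg (K + 1ℚ - + 3 / 10))
  where
  arith : ∀ K → + 3 / 10 ≤ K + 1ℚ → 0ℚ ≤ (K + 1ℚ - + 3 / 10) * (K + 1ℚ - + 3 / 10) →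
    1ℚ + fromℕ 0 ≤ fromℕ 15 * ((K + 1ℚ) * (K + 1ℚ))
  arith K p p′ = linear ((+ 15 / 1) ⊙ p′ ⊕ (+ 9 / 1) ⊙ p ⊕ nonNegative⁻¹ (+ 7 / 20)) (solve (K ∷ₗ []ₗ) ℚ-ring)
1+κ≤15[K+1]² K κ _ (inj₂ (κ≤ , 1≤)) = arith K (fromℕ κ) κ≤ 1≤ (sq-nonNeg K)
  where
  arith : ∀ K κ → κ ≤ 1ℚ + K → 1ℚ ≤ 1ℚ + K → 0ℚ ≤ K * K → 1ℚ + κ ≤ fromℕ 15 * ((K + 1ℚ) * (K + 1ℚ))
  arith K κ p₁ p₂ p₃ = linear (p₁ ⊕ (+ 29 / 1) ⊙ p₂ ⊕ (+ 15 / 1) ⊙ p₃ ⊕ nonNegative⁻¹ (+ 13 / 1)) (solve (K ∷ₗ κ ∷ₗ []ₗ) ℚ-ring)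

sparse-exponent≤ : ∀ K κ → 1ℚ + fromℕ κ ≤ fromℕ 15 * ((K + 1ℚ) * (K + 1ℚ)) →
  fromℕ (sparse-exponent κ) ≤ constant * ((K + 1ℚ) * (K + 1ℚ))
sparse-exponent≤ K κ le = ≤-trans (≤-reflexive (trans (fromℕ-* 20 (20 ℕ.* (20 ℕ.* suc κ))) (cong (fromℕ 20 *_)
    (trans (fromℕ-* 20 (20 ℕ.* suc κ)) (cong (fromℕ 20 *_) (fromℕ-* 20 (suc κ)))))))
  (≤-trans (scale ⊡ scale ⊡ scale ⊡ le) (≤-reflexive (assoc (fromℕ 20) (fromℕ 15) ((K + 1ℚ) * (K + 1ℚ)))))
  where
  scale : 0ℚ ≤ fromℕ 20
  scale = fromℕ-nonNeg 20
  assoc : ∀ a b z → a * (a * (a * (b * z))) ≡ a * (a * (a * b)) * z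
  assoc = solve-∀ ℚ-ring

theorem6p1 : Σ ℚ λ C → (0ℚ < C) ×
    ((K : ℚ) (n : ℕ) (A : Family n) →
    (nonempty : card A > 0) →
    (+ card A / 1) ≤ (+ 7 / 8) * (+ (2 ℕ.^ n) / 1) →
    (_/_ (+ edgeBoundary A) (card A) {{>-nonZero nonempty}}) - K
    ≤log₂ (_/_ (+ (2 ℕ.^ n)) (card A) {{>-nonZero nonempty}}) →
    ∃ λ (i : Fin n) →
    2^[ - (C * ((K + 1ℚ) * (K + 1ℚ))) ]· density A ≤ influence A i)
theorem6p1 = constant , 0<constant , main
  where
  main : (K : ℚ) (n : ℕ) (A : Family n) (nonempty : card A > 0) →
    (+ card A / 1) ≤ (+ 7 / 8) * (+ (2 ℕ.^ n) / 1) →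
    (_/_ (+ edgeBoundary A) (card A) {{>-nonZero nonempty}}) - K
    ≤log₂ (_/_ (+ (2 ℕ.^ n)) (card A) {{>-nonZero nonempty}}) →
    ∃ λ (i : Fin n) → 2^[ - (constant * ((K + 1ℚ) * (K + 1ℚ))) ]· density A ≤ influence A i
  main K n A nonempty c≤⅞2ⁿ log = i , 2^-lower (- Z) M
      (<-≤-trans (<-≤-trans 0<M M≤Z) Z≤--Z) (≤-trans M≤Z Z≤--Z)
      (≤-trans (<⇒≤ 0<α) (≤-reflexive (sym (count/2^n A)))) large
    where
    open Densities K A nonempty c≤⅞2ⁿ log
    ceiling : ∃ λ κ → K ≤ fromℕ κ × (κ ≡ 0 ⊎ fromℕ κ ≤ 1ℚ + K × 1ℚ ≤ 1ℚ + K)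
    ceiling = nat-ceiling (proj₁ (archimedean K)) (proj₂ (archimedean K))
    κ M : ℕ
    κ = proj₁ ceiling
    M = sparse-exponent κ
    direction : ∃ λ i → ½ ^ℚ M * α ≤ η f i
    direction = influential-direction f f01 t κ 0<α α≤⅞ (proj₁ (proj₂ scale)) (proj₂ (proj₂ scale))
      (H-upper κ (proj₁ (proj₂ ceiling)))
    i : Fin n
    i = proj₁ direction
    Z : ℚ
    Z = constant * ((K + 1ℚ) * (K + 1ℚ))
    M≤Z : fromℕ M ≤ Z
    M≤Z = sparse-exponent≤ K κ (1+κ≤15[K+1]² K κ K+1-lower (proj₂ (proj₂ ceiling)))
    0<M : 0ℚ < fromℕ M
    0<M = fromℕ-pos M
    Z≤--Z : Z ≤ - (- Z)
    Z≤--Z = ≤-reflexive (double-neg Z)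
      where
      double-neg : ∀ p → p ≡ - (- p)
      double-neg = solve-∀ ℚ-ring
    large : ½ ^ℚ M * density A ≤ influence A i
    large = ≤-trans (≤-reflexive (cong (½ ^ℚ M *_) (count/2^n A))) (≤-trans (proj₂ direction)
      (≤-trans (double (η f i) (η-nonNeg f i)) (≤-reflexive (sym (influence≡2η A i)))))
      where
      double : ∀ p → 0ℚ ≤ p → p ≤ fromℕ 2 * p
      double p 0≤p = linear 0≤p (solve (p ∷ₗ []ₗ) ℚ-ring)
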